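{- Let $n\ge 1$ and $c,d\ge 0$ be integers with $c+d\le n$ (and $c<n$ if $d=0$). Let $1\le s_1<s_2<\cdots<s_c\le n$ and $1\le i_1<i_2<\cdots<i_d\le n$. Then the coefficient $A(n;s_1,\ldots,s_c;i_1,\ldots,i_d)$ equals the number of monotone $(d,n-c)$--trapezoids whose top row is $(i_1,\ldots,i_d)$ and whose bottom row consists of the elements of $\{1,2,\ldots,n\}\setminus\{s_1,\ldots,s_c\}$ arranged in increasing order. (For $d=0$ this is to be read as: the number of monotone triangles with $n-c$ rows whose bottom row consists of the elements of $\{1,\ldots,n\}\setminus\{s_1,\ldots,s_c\}$ in increasing order.)
   Context: A monotone triangle with $n$ rows is an array of integers $(a_{i,j})_{1\le i\le j\le n}$ such that $a_{i,j}\le a_{i+1,j+1}$ for $1\le i\le j<n$, $a_{i,j}\le a_{i-1,j}$ for $1<i\le j\le n$, and $a_{i,j}<a_{i,j+1}$ for $1\le i\le j\le n-1$. Its $i$-th row (counted from the bottom) is $(a_{i,i},a_{i,i+1},\ldots,a_{i,n})$; the bottom row is $(a_{1,1},\ldots,a_{1,n})$ and the top row is $(a_{n,n})$. For $1\le d\le m$, a monotone $(d,m)$--trapezoid is a monotone triangle with $m$ rows from which the top $d-1$ rows have been removed, i.e. the array $(a_{i,j})_{1\le i\le m-d+1,\ i\le j\le m}$; its top row $(a_{m-d+1,m-d+1},\ldots,a_{m-d+1,m})$ has $d$ entries. Let $E_x$ denote the shift operator $E_x p(x)=p(x+1)$. Define the polynomial $$\alpha(n;k_1,\ldots,k_n)=\Big(\prod_{1\le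 p<q\le n}(\mathrm{id}+E_{k_p}E_{k_q}-E_{k_q})\Big)\prod_{1\le i<j\le n}\frac{k_j-k_i}{j-i},$$ where the product of operators means composition. It is a known fact that $\alpha$ is a polynomial of degree at most $n-1$ in each $k_i$ and that for integers $k_1<\cdots<k_n$ it equals the number of monotone triangles with bottom row $(k_1,\ldots,k_n)$. For integers $c,d\ge0$ with $c+d\le n$, the numbers $A(n;s_1,\ldots,s_c;i_1,\ldots,i_d)$, $s_l,i_l\in\{1,\ldots,n\}$, are defined as the unique coefficients in the polynomial identity (in the variables $k_1,\ldots,k_c,k_{n-d+1},\ldots,k_n$) $$\alpha(n;k_1,\ldots,k_c,c+1,c+2,\ldots,n-d,k_{n-d+1},\ldots,k_n)=\sum_{s_1,\ldots,s_c=1}^{n}\ \sum_{i_1,\ldots,i_d=1}^{n}A(n;s_1,\ldots,s_c;i_1,\ldots,i_d)\,(-1)^{s_1+\cdots+s_c+c}\prod_{l=1}^{c}\binom{k_l-c-1}{s_{c+1-l}-1}\prod_{l=1}^{d}\binom{k_{n-d+l}-n+d-2+i_l}{i_l-1}.$$ (Uniqueness holds since for fixed shift the binomials $\binom{k+a}{s-1}$, $s=1,\ldots,n$, form a basis of polynomials in $k$ of degree at most $n-1$.) When $c=0$ or $d=0$ the corresponding list is empty and written as "$-$".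
   Formalization: In the definition of α, the operator id + E_{k_p}E_{k_q} − E_{k_q} is corrected to id + E_{k_p}E_{k_q} − E_{k_p}; as printed, α(2;1,2) = 0, although there are 2 monotone triangles with bottom row (1,2). -}

module Defs where

open import Data.Fin as F using (Fin; toℕ; opposite)
import Data.Fin.Properties as F
open import Data.Integer as ℤ using (ℤ; +_; -1ℤ)
open import Data.List as L using (List; []; _∷_)
open import Data.List.Relation.Binary.Pointwise using (Pointwise)
open import Data.List.Relation.Unary.All using (All)
open import Data.List.Relation.Unary.Linked using (Linked)
open import Data.Maybe using (just)
open import Data.Nat as ℕ using (ℕ; zero; suc; _∸_)
import Data.Nat.Properties as ℕ
open import Data.Product using (∃; _×_; _,_; uncurry)
open import Data.Rational using (ℚ; 0ℚ; 1ℚ; _+_; _*_; _-_; _/_)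
open import Data.Rational.Literals using (fromℤ)
open import Data.Unit using (⊤)
open import Data.Vec as V using (Vec; []; _∷_)
import Data.Vec.Membership.DecPropositional as DecMembership
import Data.Vec.Relation.Unary.Linked as VL
open import Function using (_∘′_; id)
open import Relation.Binary.PropositionalEquality using (_≡_; trans; cong; sym)
open import Relation.Nullary.Decidable using (¬?)

fromℕ : ℕ → ℚ
fromℕ n = fromℤ (+ n)

Σ[_] : ∀ {a} {A : Set a} → List A → (A → ℚ) → ℚ
Σ[ xs ] f = L.foldr _+_ 0ℚ (L.map f xs)

Π[_] : ∀ {a} {A : Set a} → List A → (A → ℚ) → ℚ
Π[ xs ] f = L.foldr _*_ 1ℚ (L.map f xs)

-- All pairs (p , q) with p < q.
orderedPairs : ∀ n → List (Fin n × Fin n)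
orderedPairs n =
  L.filter (uncurry F._<?_) (L.cartesianProduct (L.allFin n) (L.allFin n))

-- A polynomial in n variables over ℚ is represented by its polynomial
-- function; since ℚ is infinite, this loses no information.
PolynomialFunction : ℕ → Set
PolynomialFunction n = Vec ℚ n → ℚ

Operator : ℕ → Set
Operator n = PolynomialFunction n → PolynomialFunction n

E : ∀ {n} → Fin n → Operator n
E i f k = f (V.updateAt k i (_+ 1ℚ))

-- id + E_p E_q - E_p. The subtracted shift must be E_p, not E_q: for n = 2
-- this yields k₂ - k₁ + 1, the number of monotone triangles with bottom row
-- (k₁, k₂), whereas subtracting E_q would yield k₂ - k₁ - 1.
factor : ∀ {n} → Fin n → Fin n → Operator n
factor p q f k = f k + E p (E q f) k - E p f k

composeAll : ∀ {n} → List (Operator n) → Operator n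
composeAll = L.foldr _∘′_ id

-- For i < j the denominator is j - i, written as a successor so that it is
-- visibly nonzero.
vandermonde : ∀ n → PolynomialFunction n
vandermonde n k = Π[ orderedPairs n ] λ (i , j) →
  (V.lookup k j - V.lookup k i) * ((+ 1) / suc (toℕ j ∸ suc (toℕ i)))

-- The operators commute, so the order of composition is immaterial.
α : ∀ n → PolynomialFunction n
α n = composeAll (L.map (uncurry factor) (orderedPairs n)) (vandermonde n)

binom : ℚ → ℕ → ℚ
binom x zero    = 1ℚ
binom x (suc m) = binom x m * (x - fromℕ m) * ((+ 1) / suc m)

-- The elements of {1, …, n} are represented by Fin n, via i ↦ toℕ i + 1.
val : ∀ {n} → Fin n → ℕ
val i = suc (toℕ i)

tuples : ∀ n c → List (Vec (Fin n) c)
tuples n zero    = [] ∷ []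
tuples n (suc c) = L.cartesianProductWith _∷_ (L.allFin n) (tuples n c)

arguments-length : ∀ {n} c d → c ℕ.+ d ℕ.≤ n → c ℕ.+ ((n ∸ (c ℕ.+ d)) ℕ.+ d) ≡ n
arguments-length {n} c d c+d≤n =
  trans (cong (c ℕ.+_) (ℕ.+-comm (n ∸ (c ℕ.+ d)) d))
  (trans (sym (ℕ.+-assoc c d (n ∸ (c ℕ.+ d)))) (ℕ.m+[n∸m]≡n c+d≤n))

-- (k₁, …, k_c, c+1, …, n-d, k_{n-d+1}, …, k_n), where k′ = (k_{n-d+1}, …, k_n)
arguments : ∀ {n c d} → c ℕ.+ d ℕ.≤ n → Vec ℚ c → Vec ℚ d → Vec ℚ n
arguments {n} {c} {d} c+d≤n k k′ = V.cast (arguments-length c d c+d≤n)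
  (k V.++ (V.tabulate {n = n ∸ (c ℕ.+ d)} (λ j → fromℕ (c ℕ.+ val j)) V.++ k′))

-- (-1)^{s₁ + ⋯ + s_c + c}
sign : ∀ {n c} → Vec (Fin n) c → ℚ
sign {c = c} s = fromℤ (-1ℤ ℤ.^ (V.sum (V.map val s) ℕ.+ c))

-- Here toℕ (lookup s l) is s_l - 1, and opposite sends position l to c + 1 - l.
leftBasis : ∀ {n c} → Vec (Fin n) c → Vec ℚ c → ℚ
leftBasis {c = c} s k = Π[ L.allFin c ] λ l →
  binom (V.lookup k l - fromℕ c - 1ℚ) (toℕ (V.lookup s (opposite l)))

rightBasis : ∀ {n d} → Vec (Fin n) d → Vec ℚ d → ℚ
rightBasis {n} {d} i k′ = Π[ L.allFin d ] λ l →
  binom (V.lookup k′ l - fromℕ n + fromℕ d - fromℕ 2 + fromℕ (val (V.lookup i l)))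
        (toℕ (V.lookup i l))

-- The polynomial identity characterising the coefficients A(n; s; i).
IsCoefficients : ∀ n c d → c ℕ.+ d ℕ.≤ n →
                 (Vec (Fin n) c → Vec (Fin n) d → ℚ) → Set
IsCoefficients n c d c+d≤n A = ∀ (k : Vec ℚ c) (k′ : Vec ℚ d) →
  α n (arguments c+d≤n k k′) ≡
  Σ[ tuples n c ] λ s → Σ[ tuples n d ] λ i →
    A s i * sign s * leftBasis s k * rightBasis i k′

StrictlyIncreasing : ∀ {n c} → Vec (Fin n) c → Set
StrictlyIncreasing = VL.Linked F._<_

-- With upper = (a_{i+1,j})_{j ≥ i+1} and lower = (a_{i,j})_{j ≥ i}, the two
-- components say a_{i,j} ≤ a_{i+1,j+1} and a_{i+1,j} ≤ a_{i,j}.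
Interlaces : List ℤ → List ℤ → Set
Interlaces upper lower =
  Pointwise ℤ._≤_ (L.take (L.length upper) lower) upper ×
  Pointwise ℤ._≤_ upper (L.drop 1 lower)

-- Arrays are given as lists of rows, from the top row to the bottom row.
record IsMonotoneTriangle (m : ℕ) (rows : List (List ℤ)) : Set where
  field
    rowLengths  : L.map L.length rows ≡ L.map suc (L.upTo m)
    increasing  : All (Linked ℤ._<_) rows
    interlacing : Linked Interlaces rows

-- For d = 0 no row is removed, so that a monotone (0,m)-trapezoid is a
-- monotone triangle with m rows.
IsMonotoneTrapezoid : ℕ → ℕ → List (List ℤ) → Set
IsMonotoneTrapezoid d m rows =
  ∃ λ triangle → IsMonotoneTriangle m triangle × L.drop (d ∸ 1) triangle ≡ rows

-- For d = 0 the top row is not prescribed.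
HasTopRow : ∀ {n d} → Vec (Fin n) d → List (List ℤ) → Set
HasTopRow []        rows = ⊤
HasTopRow i@(_ ∷ _) rows = L.head rows ≡ just (L.map (λ x → + val x) (V.toList i))

-- {1, …, n} ∖ {s₁, …, s_c} in increasing order
complement : ∀ {n c} → Vec (Fin n) c → List (Fin n)
complement {n} s = L.filter (λ x → ¬? (x ∈? s)) (L.allFin n)
  where open DecMembership (F._≟_ {n}) using (_∈?_)

HasBottomRow : List ℤ → List (List ℤ) → Set
HasBottomRow b rows = L.last rows ≡ just b

{-# OPTIONS --safe #-}
-- Finite differences turn the coefficients A(n; s; i) into values of a multilinear form: let the
-- argument (e , x) stand for p ↦ (Δᵉ p)(x). Since id + E_p E_q - E_p = id + E_p Δ_q, the form Ψ
-- belonging to α is obtained from a determinant (the Vandermonde product in the basis binom q j)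
-- by the operators id + E_p Δ_q, p < q. The identity p(x) = p(x + 1) + (-Δ p)(x) shows that
-- specialising k_{c+1} = c + 1 expresses A(n; s; i) as the sum of all A(n; u; i) with u₀ ≥ 1 and
-- u_j ≥ s_j, increasing or not. As the determinant is antisymmetric, Ψ satisfies an exchange
-- relation in neighbouring arguments; summed over a quadrant, it cancels precisely those u that are
-- not increasing or whose complement does not interlace with the complement of s. This is the
-- recursion of monotone trapezoids along their rows. If c + d = n, expanding the determinant and
-- induction on n show that A(n; s; i) is 1 if s and i are complementary and 0 otherwise.
module Submission where

open import Defs
open import Data.Bool using (Bool; true; false; not; if_then_else_)
open import Data.Empty using (⊥-elim)
open import Data.Fin as F using (Fin; toℕ; opposite)
import Data.Fin.Properties as F
open import Data.Integer as ℤ using (ℤ; +_; -[1+_]; -1ℤ; +≤+; +<+)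
import Data.Integer.Properties as ℤ
open import Data.Irrelevant using ([_])
open import Data.List as L using (List; []; _∷_; _++_; _∷ʳ_; _ʳ++_; map; length)
import Data.List.Membership.DecPropositional as ListDecMembership
open import Data.List.Membership.Propositional using (_∈_)
open import Data.List.Membership.Propositional.Properties
  using (∈-allFin; ∈-cartesianProductWith⁺; ∈-map⁺; ∈-map⁻; ∈-++⁺ˡ; ∈-++⁺ʳ; ∈-++⁻; ∈-concat⁺′; ∈-concat⁻′;
         ∈-filter⁺; ∈-filter⁻; ∈-lookup)
import Data.List.Properties as L
open import Data.List.Relation.Binary.Disjoint.Propositional using (Disjoint)
open import Data.List.Relation.Binary.Pointwise using ([]; _∷_)
open import Data.List.Relation.Unary.All as All using (All; []; _∷_)
import Data.List.Relation.Unary.All.Properties as All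
open import Data.List.Relation.Unary.AllPairs using (AllPairs; []; _∷_)
import Data.List.Relation.Unary.AllPairs.Properties as AllPairs
open import Data.List.Relation.Unary.Any as Any using (here; there)
import Data.List.Relation.Unary.Any.Properties as Any
open import Data.List.Relation.Unary.Linked using (Linked; []; [-]; _∷_)
open import Data.List.Relation.Unary.Unique.Propositional using (Unique)
import Data.List.Relation.Unary.Unique.Propositional.Properties as Unique
open import Data.Maybe using (Maybe; just; nothing)
open import Data.Maybe.Properties using (just-injective)
open import Data.Nat as ℕ using (ℕ; zero; suc; _∸_; s≤s)
open import Data.Nat.Coprimality using (1-coprimeTo)
import Data.Nat.Properties as ℕ
open import Data.Product using (∃; _×_; _,_; proj₁; proj₂; uncurry)
open import Data.Rational using (ℚ)
open import Data.Rational.Literals using (fromℤ)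
import Data.Rational.Properties as ℚ
open import Data.Refinement using (Refinement-syntax; value-injective; _,_)
open import Data.Sum using (inj₁; inj₂)
open import Data.Unit using (tt)
open import Data.Vec as V using (Vec; []; _∷_)
import Data.Vec.Membership.DecPropositional as DecMembership
import Data.Vec.Membership.Propositional.Properties as V
import Data.Vec.Properties as V
import Data.Vec.Relation.Unary.Linked as VL
open import Function using (id; _∘_; mk↔ₛ′)
open import Function.Bundles using (_↔_)
open import Level using (0ℓ)
open import Relation.Binary.Definitions using (DecidableEquality; tri<; tri≈; tri>)
open import Relation.Binary.PropositionalEquality hiding ([_])
open import Relation.Nullary using (¬_; does; yes; no)
open import Relation.Nullary.Decidable using (¬?; recompute)
open import Relation.Unary using (Decidable)

-- Polynomials never appear as algebraic objects. A form is a table of values on lists of arguments;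
-- `Pascal` (the rule E = id + Δ in every place) and `DegreeBelow` carry what is needed of
-- polynomiality. The basis polynomials with indices s and i are dual to Δ^(s-1) at c + 1 and to
-- Δ^(i-1) at n - d - (i - 1); the point on the right falls with the exponent because the upper
-- entry of the right binomials rises with i. The case c + d = n rests on an asymmetry of id + E_p
-- Δ_q. If exactly one argument u has exponent 0, the constant column of the determinant vanishes at
-- all the others. Factors with q = u then act as the identity, since Δ kills constants, and factors
-- with p = u act as id + Δ_q = E_q. So removing u lowers every other exponent by one, leaves the
-- arguments on its left in place and moves those on its right by one. Fixed points on the left and
-- points y - e on the right are what this step preserves.

module _ where

  open import Data.Rational using (mkℚ; 0ℚ; 1ℚ; ½; _+_; _*_; _-_; -_; _/_)
  open import Tactic.RingSolver using (solve-∀)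
  open import Tactic.RingSolver.Core.AlmostCommutativeRing using (AlmostCommutativeRing; fromCommutativeRing)

  -- Contractions and the determinant

  0≟ : ∀ x → Maybe (0ℚ ≡ x)
  0≟ x with 0ℚ ℚ.≟ x
  ... | yes p = just p
  ... | no _  = nothing

  ring : AlmostCommutativeRing 0ℓ 0ℓ
  ring = fromCommutativeRing ℚ.+-*-commutativeRing 0≟

  -- The pair (e , x) stands for the linear functional p ↦ (Δᵉ p)(x), where Δ p = E p − p.
  Argument : Set
  Argument = ℕ × ℤ

  Form : Set
  Form = List Argument → ℚ

  Δ shift : Argument → Argument
  Δ     (e , x) = suc e , x
  shift (e , x) = e , ℤ.suc x

  -- The exterior product of the covector `f` with `Φ`: each entry in turn goes to `f`, with
  -- alternating sign, and the rest to `Φ`. For a determinant this is expansion along one column.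
  ι : ∀ {A : Set} → (A → ℚ) → (List A → ℚ) → List A → ℚ
  ι f Φ []      = 0ℚ
  ι f Φ (u ∷ l) = f u * Φ l - ι f (λ l′ → Φ (u ∷ l′)) l

  ι-cong : ∀ {A : Set} {f g : A → ℚ} {Φ Ψ} → (∀ u → f u ≡ g u) → (∀ l → Φ l ≡ Ψ l) → ∀ l → ι f Φ l ≡ ι g Ψ l
  ι-cong f≡g Φ≡Ψ []      = refl
  ι-cong f≡g Φ≡Ψ (u ∷ l) =
    cong₂ _-_ (cong₂ _*_ (f≡g u) (Φ≡Ψ l)) (ι-cong f≡g (λ l′ → Φ≡Ψ (u ∷ l′)) l)

  ι-congʳ : ∀ {A : Set} {f : A → ℚ} {Φ Ψ} → (∀ l → Φ l ≡ Ψ l) → ∀ l → ι f Φ l ≡ ι f Ψ l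
  ι-congʳ = ι-cong λ _ → refl

  ι-linear : ∀ {A : Set} (f : A → ℚ) a b Φ Ψ l → ι f (λ l′ → a * Φ l′ + b * Ψ l′) l ≡ a * ι f Φ l + b * ι f Ψ l
  ι-linear f a b Φ Ψ []      = identity a b
    where
    identity : ∀ a b → 0ℚ ≡ a * 0ℚ + b * 0ℚ
    identity = solve-∀ ring
  ι-linear f a b Φ Ψ (u ∷ l) =
    trans (cong₂ _-_ {f u * (a * Φ l + b * Ψ l)} refl (ι-linear f a b (λ l′ → Φ (u ∷ l′)) (λ l′ → Ψ (u ∷ l′)) l))
          (identity a b (f u) (Φ l) (Ψ l) _ _)
    where
    identity : ∀ a b c p q r s →
      c * (a * p + b * q) - (a * r + b * s) ≡ a * (c * p - r) + b * (c * q - s)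
    identity = solve-∀ ring

  ι-scale : ∀ {A : Set} (f : A → ℚ) a Φ l → ι f (λ l′ → a * Φ l′) l ≡ a * ι f Φ l
  ι-scale f a Φ l = trans (ι-congʳ (λ l′ → pad a (Φ l′)) l)
    (trans (ι-linear f a 0ℚ Φ Φ l) (sym (pad a (ι f Φ l))))
    where
    pad : ∀ a p → a * p ≡ a * p + 0ℚ * p
    pad = solve-∀ ring

  ι-+ : ∀ {A : Set} (f : A → ℚ) Φ Ψ l → ι f (λ l′ → Φ l′ + Ψ l′) l ≡ ι f Φ l + ι f Ψ l
  ι-+ f Φ Ψ l = trans (ι-congʳ (λ l′ → pad (Φ l′) (Ψ l′)) l)
    (trans (ι-linear f 1ℚ 1ℚ Φ Ψ l) (sym (pad (ι f Φ l) (ι f Ψ l))))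
    where
    pad : ∀ p q → p + q ≡ 1ℚ * p + 1ℚ * q
    pad = solve-∀ ring

  ι-neg : ∀ {A : Set} (f : A → ℚ) Φ l → ι f (λ l′ → - Φ l′) l ≡ - ι f Φ l
  ι-neg f Φ l = trans (ι-congʳ (λ l′ → pad (Φ l′)) l)
    (trans (ι-scale f (- 1ℚ) Φ l) (sym (pad (ι f Φ l))))
    where
    pad : ∀ p → - p ≡ - 1ℚ * p
    pad = solve-∀ ring

  ι-+ˡ : ∀ {A : Set} (f g : A → ℚ) Φ l → ι (λ u → f u + g u) Φ l ≡ ι f Φ l + ι g Φ l
  ι-+ˡ f g Φ []      = refl
  ι-+ˡ f g Φ (u ∷ l) =
    trans (cong₂ _-_ {(f u + g u) * Φ l} refl (ι-+ˡ f g (λ l′ → Φ (u ∷ l′)) l)) (identity (f u) (g u) (Φ l) _ _)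
    where
    identity : ∀ a b c d e → (a + b) * c - (d + e) ≡ (a * c - d) + (b * c - e)
    identity = solve-∀ ring

  ι-zero : ∀ {A : Set} (f : A → ℚ) {Φ} → (∀ l → Φ l ≡ 0ℚ) → ∀ l → ι f Φ l ≡ 0ℚ
  ι-zero f {Φ} Φ≡0 l = trans (ι-congʳ (λ l′ → trans (Φ≡0 l′) (sym (ℚ.*-zeroˡ (Φ l′)))) l)
    (trans (ι-scale f 0ℚ Φ l) (ℚ.*-zeroˡ (ι f Φ l)))

  ι-zeroˡ : ∀ {A : Set} {f : A → ℚ} → (∀ u → f u ≡ 0ℚ) → ∀ Φ l → ι f Φ l ≡ 0ℚ
  ι-zeroˡ f≡0 Φ []      = refl
  ι-zeroˡ f≡0 Φ (u ∷ l) rewrite f≡0 u | ι-zeroˡ f≡0 (λ l′ → Φ (u ∷ l′)) l = identity (Φ l)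
    where
    identity : ∀ a → 0ℚ * a - 0ℚ ≡ 0ℚ
    identity = solve-∀ ring

  ι-map : ∀ {A B : Set} (f : B → ℚ) Φ (h : A → B) l →
          ι f Φ (map h l) ≡ ι (λ u → f (h u)) (λ l′ → Φ (map h l′)) l
  ι-map f Φ h []      = refl
  ι-map f Φ h (u ∷ l) = cong₂ _-_ {f (h u) * Φ (map h l)} refl (ι-map f (λ l′ → Φ (h u ∷ l′)) h l)

  -- Any two entries go to the two copies of `f` in both orders, with opposite signs, while `Φ` sees
  -- the same remaining list.
  ι-ι : ∀ {A : Set} (f : A → ℚ) Φ l → ι f (ι f Φ) l ≡ 0ℚ
  ι-ι f Φ []      = refl
  ι-ι f Φ (u ∷ l) = trans
    (cong₂ _-_ {f u * ι f Φ l} refl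
      (trans (ι-congʳ (λ l′ → pad (f u) (Φ l′) (ι f (λ l″ → Φ (u ∷ l″)) l′)) l)
      (trans (ι-linear f (f u) (- 1ℚ) Φ (ι f (λ l″ → Φ (u ∷ l″))) l)
             (cong (λ z → f u * ι f Φ l + - 1ℚ * z) (ι-ι f (λ l″ → Φ (u ∷ l″)) l)))))
    (identity (f u * ι f Φ l))
    where
    pad : ∀ a p q → a * p - q ≡ a * p + - 1ℚ * q
    pad = solve-∀ ring
    identity : ∀ a → a - (a + - 1ℚ * 0ℚ) ≡ 0ℚ
    identity = solve-∀ ring

  -- A form is an arbitrary function on lists; `Pascal` is what gives the exponents their meaning as
  -- finite differences.
  Pascal Antisymmetric : Form → Set
  Pascal Φ = ∀ pre u suf →
    Φ (pre ++ shift u ∷ suf) ≡ Φ (pre ++ u ∷ suf) + Φ (pre ++ Δ u ∷ suf)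
  Antisymmetric Φ = ∀ pre u v suf → Φ (pre ++ u ∷ v ∷ suf) ≡ - Φ (pre ++ v ∷ u ∷ suf)

  DegreeBelow : ℕ → Form → Set
  DegreeBelow n Φ = ∀ pre e x suf → n ℕ.≤ e → Φ (pre ++ (e , x) ∷ suf) ≡ 0ℚ

  PascalCovector : (Argument → ℚ) → Set
  PascalCovector f = ∀ u → f (shift u) ≡ f u + f (Δ u)

  ι-pascal : ∀ {f Φ} → PascalCovector f → Pascal Φ → Pascal (ι f Φ)
  ι-pascal {f} {Φ} fp Φp [] u suf = trans
    (cong₂ (λ a b → a * Φ suf - b) (fp u)
      (trans (ι-congʳ (Φp [] u) suf) (ι-+ f (λ l → Φ (u ∷ l)) (λ l → Φ (Δ u ∷ l)) suf)))
    (identity (f u) (f (Δ u)) (Φ suf) _ _)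
    where
    identity : ∀ a b c d e → (a + b) * c - (d + e) ≡ (a * c - d) + (b * c - e)
    identity = solve-∀ ring
  ι-pascal {f} {Φ} fp Φp (w ∷ pre) u suf = trans
    (cong₂ (λ a b → f w * a - b) (Φp pre u suf)
      (ι-pascal {f} {λ l → Φ (w ∷ l)} fp (λ pre′ → Φp (w ∷ pre′)) pre u suf))
    (identity (f w) _ _ _ _)
    where
    identity : ∀ a b c d e → a * (b + c) - (d + e) ≡ (a * b - d) + (a * c - e)
    identity = solve-∀ ring

  ι-antisymmetric : ∀ {f Φ} → Antisymmetric Φ → Antisymmetric (ι f Φ)
  ι-antisymmetric {f} {Φ} Φa [] u v suf = trans
    (cong (λ z → f u * Φ (v ∷ suf) - (f v * Φ (u ∷ suf) - z))
      (trans (ι-congʳ (Φa [] u v) suf) (ι-neg f (λ l → Φ (v ∷ u ∷ l)) suf)))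
    (identity (f u * Φ (v ∷ suf)) (f v * Φ (u ∷ suf)) _)
    where
    identity : ∀ a b c → a - (b - - c) ≡ - (b - (a - c))
    identity = solve-∀ ring
  ι-antisymmetric {f} {Φ} Φa (w ∷ pre) u v suf = trans
    (cong₂ (λ a b → f w * a - b) (Φa pre u v suf)
      (ι-antisymmetric {f} {λ l → Φ (w ∷ l)} (λ pre′ → Φa (w ∷ pre′)) pre u v suf))
    (identity (f w) _ _)
    where
    identity : ∀ a b c → a * (- b) - (- c) ≡ - (a * b - c)
    identity = solve-∀ ring

  ι-degreeBelow : ∀ {n f Φ} → (∀ e x → n ℕ.≤ e → f (e , x) ≡ 0ℚ) →
                  DegreeBelow n Φ → DegreeBelow n (ι f Φ)
  ι-degreeBelow {n} {f} {Φ} fd Φd [] e x suf n≤e =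
    trans (cong₂ (λ a b → a * Φ suf - b) (fd e x n≤e) (ι-zero f (λ l → Φd [] e x l n≤e) suf))
          (identity (Φ suf))
    where
    identity : ∀ a → 0ℚ * a - 0ℚ ≡ 0ℚ
    identity = solve-∀ ring
  ι-degreeBelow {n} {f} {Φ} fd Φd (w ∷ pre) e x suf n≤e = trans
    (cong₂ (λ a b → f w * a - b) (Φd pre e x suf n≤e)
      (ι-degreeBelow {n} {f} {λ l → Φ (w ∷ l)} fd (λ pre′ → Φd (w ∷ pre′)) pre e x suf n≤e))
    (identity (f w))
    where
    identity : ∀ a → a * 0ℚ - 0ℚ ≡ 0ℚ
    identity = solve-∀ ring

  -- Rational binomial coefficients and their finite differences

  n/1≡fromℤ : ∀ z → z / 1 ≡ fromℤ z
  n/1≡fromℤ z = ℚ.↥p/↧p≡p (fromℤ z)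

  fromℤ-+ : ∀ a b → fromℤ (a ℤ.+ b) ≡ fromℤ a + fromℤ b
  fromℤ-+ a b = trans (sym (n/1≡fromℤ (a ℤ.+ b)))
    (cong (_/ 1) (sym (cong₂ ℤ._+_ (ℤ.*-identityʳ a) (ℤ.*-identityʳ b))))

  fromℤ-suc : ∀ z → fromℤ (ℤ.suc z) ≡ fromℤ z + 1ℚ
  fromℤ-suc z = trans (fromℤ-+ ℤ.1ℤ z) (ℚ.+-comm (fromℤ ℤ.1ℤ) (fromℤ z))

  fromℤ-neg : ∀ z → fromℤ (ℤ.- z) ≡ - fromℤ z
  fromℤ-neg z = trans (trans (identity (fromℤ (ℤ.- z)) (fromℤ z))
    (cong (_- fromℤ z) (trans (sym (fromℤ-+ (ℤ.- z) z)) (cong fromℤ (ℤ.+-inverseˡ z)))))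
    (ℚ.+-identityˡ (- fromℤ z))
    where
    identity : ∀ a b → a ≡ (a + b) - b
    identity = solve-∀ ring

  reciprocal : ℕ → ℚ
  reciprocal m = (+ 1) / suc m

  reciprocal-inverse : ∀ m → reciprocal m * fromℕ (suc m) ≡ 1ℚ
  reciprocal-inverse m = trans
    (cong (_* fromℕ (suc m)) (ℚ.↥p/↧p≡p (mkℚ (+ 1) m (1-coprimeTo (suc m)))))
    (ℚ.*-inverseˡ (fromℕ (suc m)))

  -- `binom` grows at the low end of the falling product, whereas here the top factor x + 1 is split
  -- off. Pascal's rule and the evaluation of the determinant both rest on it.
  binom-absorb : ∀ x m → binom (x + 1ℚ) (suc m) ≡ reciprocal m * ((x + 1ℚ) * binom x m)
  binom-absorb x zero = identity x (reciprocal 0)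
    where
    identity : ∀ x r → 1ℚ * ((x + 1ℚ) - 0ℚ) * r ≡ r * ((x + 1ℚ) * 1ℚ)
    identity = solve-∀ ring
  binom-absorb x (suc m) = trans
    (cong₂ (λ a b → a * ((x + 1ℚ) - b) * reciprocal (suc m)) (binom-absorb x m)
      (trans (fromℤ-suc (+ m)) refl))
    (identity x (binom x m) (fromℕ m) (reciprocal m) (reciprocal (suc m)))
    where
    identity : ∀ x b n r r′ → r * ((x + 1ℚ) * b) * ((x + 1ℚ) - (n + 1ℚ)) * r′
      ≡ r′ * ((x + 1ℚ) * (b * (x - n) * r))
    identity = solve-∀ ring

  binom-pascal : ∀ x m → binom (x + 1ℚ) (suc m) ≡ binom x (suc m) + binom x m
  binom-pascal x m = trans (binom-absorb x m) (trans (identity x (binom x m) (fromℕ m) (reciprocal m))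
    (cong₂ _+_ {binom x (suc m)} refl
      (trans (cong (_* binom x m)
        (trans (cong (reciprocal m *_) (sym (fromℤ-suc (+ m)))) (reciprocal-inverse m)))
      (ℚ.*-identityˡ (binom x m)))))
    where
    identity : ∀ x b n r → r * ((x + 1ℚ) * b) ≡ b * (x - n) * r + r * (n + 1ℚ) * b
    identity = solve-∀ ring

  -- The e-th finite difference of q ↦ binom q j.
  coefficient : ℕ → ℕ → ℚ → ℚ
  coefficient j       zero    q = binom q j
  coefficient zero    (suc e) q = 0ℚ
  coefficient (suc j) (suc e) q = coefficient j e q

  φ : ℕ → Argument → ℚ
  φ j (e , x) = coefficient j e (fromℤ x)

  coefficient-pascal : ∀ j e q → coefficient j e (q + 1ℚ) ≡ coefficient j e q + coefficient j (suc e) q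
  coefficient-pascal zero    zero    q = refl
  coefficient-pascal (suc j) zero    q = binom-pascal q j
  coefficient-pascal zero    (suc e) q = refl
  coefficient-pascal (suc j) (suc e) q = coefficient-pascal j e q

  φ-pascal : ∀ j → PascalCovector (φ j)
  φ-pascal j (e , x) = trans (cong (coefficient j e) (fromℤ-suc x)) (coefficient-pascal j e (fromℤ x))

  coefficient-below : ∀ {j e} → j ℕ.< e → ∀ q → coefficient j e q ≡ 0ℚ
  coefficient-below {zero}  (s≤s j<e) q = refl
  coefficient-below {suc j} (s≤s j<e) q = coefficient-below j<e q

  -- Laplace expansion along the columns φ j, …, φ (j + m - 1); it is 0 on lists of length ≠ m.
  det : ℕ → ℕ → Form
  det j zero    []      = 1ℚ
  det j zero    (_ ∷ _) = 0ℚ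
  det j (suc m) l       = ι (φ j) (det (suc j) m) l

  det-empty : ∀ j pre u suf → det j zero (pre ++ u ∷ suf) ≡ 0ℚ
  det-empty j []      u suf = refl
  det-empty j (_ ∷ _) u suf = refl

  det-pascal : ∀ j m → Pascal (det j m)
  det-pascal j zero pre u suf = trans (det-empty j pre (shift u) suf)
    (sym (cong₂ _+_ (det-empty j pre u suf) (det-empty j pre (Δ u) suf)))
  det-pascal j (suc m) = ι-pascal {Φ = det (suc j) m} (φ-pascal j) (det-pascal (suc j) m)

  det-antisymmetric : ∀ j m → Antisymmetric (det j m)
  det-antisymmetric j zero pre u v suf = trans (det-empty j pre u (v ∷ suf))
    (sym (cong -_ (det-empty j pre v (u ∷ suf))))
  det-antisymmetric j (suc m) = ι-antisymmetric {f = φ j} {det (suc j) m} (det-antisymmetric (suc j) m)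

  det-degreeBelow : ∀ j m n → j ℕ.+ m ℕ.≤ n → DegreeBelow n (det j m)
  det-degreeBelow j zero    n j≤n pre e x suf _ = det-empty j pre (e , x) suf
  det-degreeBelow j (suc m) n j+m<n = ι-degreeBelow {n} {φ j} {det (suc j) m}
    (λ e x n≤e → coefficient-below
      (ℕ.≤-trans (ℕ.≤-trans (s≤s (ℕ.m≤m+n j m)) 1+j+m≤n) n≤e) (fromℤ x))
    (det-degreeBelow (suc j) m n 1+j+m≤n)
    where
    1+j+m≤n : suc (j ℕ.+ m) ℕ.≤ n
    1+j+m≤n = ℕ.≤-trans (ℕ.≤-reflexive (sym (ℕ.+-suc j m))) j+m<n

  det-Δ : ∀ j m l → det (suc j) m (map Δ l) ≡ det j m l
  det-Δ j zero    []      = refl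
  det-Δ j zero    (_ ∷ _) = refl
  det-Δ j (suc m) l = trans (ι-map (φ (suc j)) (det (suc (suc j)) m) Δ l)
    (ι-congʳ (det-Δ (suc j) m) l)

  -- Since ι f (ι f Φ) = 0, adding column j to column j + 1 changes nothing.
  det-shift′ : ∀ j m l →
    ι (φ j) (λ l′ → det (suc j) m (map shift l′)) l ≡ ι (φ j) (det (suc j) m) l
  det-shift′ j zero    l = ι-congʳ (λ { [] → refl ; (_ ∷ _) → refl }) l
  det-shift′ j (suc m) l = trans
    (ι-congʳ (λ l′ → trans (ι-map (φ (suc j)) (det (suc (suc j)) m) shift l′)
      (trans (ι-cong (φ-pascal (suc j)) (λ _ → refl) l′) (ι-+ˡ (φ (suc j)) (φ j) D l′))) l)
    (trans (ι-+ (φ j) (ι (φ (suc j)) D) (ι (φ j) D) l)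
    (trans (cong₂ _+_ (ι-congʳ (det-shift′ (suc j) m) l) (ι-ι (φ j) D l))
           (ℚ.+-identityʳ _)))
    where
    D : Form
    D l′ = det (suc (suc j)) m (map shift l′)

  φ₀-shift : ∀ u → φ 0 (shift u) ≡ φ 0 u
  φ₀-shift (zero  , x) = refl
  φ₀-shift (suc e , x) = refl

  det-shift : ∀ m l → det 0 m (map shift l) ≡ det 0 m l
  det-shift zero    []      = refl
  det-shift zero    (_ ∷ _) = refl
  det-shift (suc m) l = trans (ι-map (φ 0) (det 1 m) shift l)
    (trans (ι-cong φ₀-shift (λ _ → refl) l) (det-shift′ 0 m l))

  -- The determinant at integer points as a Vandermonde product

  at : ℤ → Argument
  at x = 0 , x

  binom-zero : ∀ j → binom 0ℚ (suc j) ≡ 0ℚ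
  binom-zero zero = refl
  binom-zero (suc j) rewrite binom-zero j = identity (0ℚ - fromℕ (suc j)) (reciprocal (suc j))
    where
    identity : ∀ a b → 0ℚ * a * b ≡ 0ℚ
    identity = solve-∀ ring

  det-at-zero : ∀ j m l → det (suc j) m (at (+ 0) ∷ l) ≡ 0ℚ
  det-at-zero j zero    l = refl
  det-at-zero j (suc m) l = trans
    (cong₂ (λ a b → a * det (suc (suc j)) m l - b) (binom-zero j) (ι-zero (φ (suc j)) (det-at-zero (suc j) m) l))
    (identity (det (suc (suc j)) m l))
    where
    identity : ∀ a → 0ℚ * a - 0ℚ ≡ 0ℚ
    identity = solve-∀ ring

  product : (ℤ → ℚ) → List ℤ → ℚ
  product f l = L.foldr _*_ 1ℚ (map f l)

  reciprocals : ℕ → ℕ → ℚ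
  reciprocals j zero    = 1ℚ
  reciprocals j (suc m) = reciprocal j * reciprocals (suc j) m

  -- Pulls the row factors `w` and the column factor `a` out of an expansion. The constant `c` has
  -- to be general: in the recursion it absorbs the factor `w u` of an entry already passed.
  ι-weighted : ∀ {A : Set} {f g w : A → ℚ} {a c} (W : List A → ℚ) → (∀ u l → W (u ∷ l) ≡ w u * W l) →
    ∀ {Φ Ψ : List A → ℚ} → (∀ u → f u ≡ a * (w u * g u)) → (∀ l → Φ l ≡ c * (W l * Ψ l)) →
    ∀ l → ι f Φ l ≡ (a * c) * (W l * ι g Ψ l)
  ι-weighted {a = a} {c} W W∷ f≡ Φ≡ [] = identity a c (W [])
    where
    identity : ∀ a c w → 0ℚ ≡ (a * c) * (w * 0ℚ)
    identity = solve-∀ ring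
  ι-weighted {f = f} {g} {w} {a} {c} W W∷ {Φ} {Ψ} f≡ Φ≡ (u ∷ l) = trans
    (cong₂ _-_ (cong₂ _*_ (f≡ u) (Φ≡ l))
      (ι-weighted {f = f} {g} {w} {a} {c * w u} W W∷ {λ l′ → Φ (u ∷ l′)} {λ l′ → Ψ (u ∷ l′)} f≡
        (λ l′ → trans (Φ≡ (u ∷ l′)) (trans (cong (λ z → c * (z * Ψ (u ∷ l′))) (W∷ u l′))
          (regroup c (w u) (W l′) (Ψ (u ∷ l′))))) l))
    (trans (identity a c (w u) (g u) (W l) (Ψ l) _)
      (cong (λ z → (a * c) * (z * ι g Ψ (u ∷ l))) (sym (W∷ u l))))
    where
    regroup : ∀ c w v p → c * ((w * v) * p) ≡ (c * w) * (v * p)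
    regroup = solve-∀ ring
    identity : ∀ a c w g v p q → (a * (w * g)) * (c * (v * p)) - (a * (c * w)) * (v * q)
      ≡ (a * c) * ((w * v) * (g * p - q))
    identity = solve-∀ ring

  -- By `binom-absorb`, the matrix entry at point x + 1 and column j + 1 is (x + 1) / (j + 1) times
  -- the entry at point x and column j.
  det-absorb : ∀ j m l → det (suc j) m (map at (map ℤ.suc l)) ≡
    reciprocals j m * (product (λ x → fromℤ (ℤ.suc x)) l * det j m (map at l))
  det-absorb j zero    []      = refl
  det-absorb j zero    (x ∷ l) = identity (product (λ x → fromℤ (ℤ.suc x)) (x ∷ l))
    where
    identity : ∀ a → 0ℚ ≡ 1ℚ * (a * 0ℚ)
    identity = solve-∀ ring
  det-absorb j (suc m) l = trans (ι-map (φ (suc j)) (det (suc (suc j)) m) at (map ℤ.suc l))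
    (trans (ι-map (λ x → φ (suc j) (at x)) (λ l′ → det (suc (suc j)) m (map at l′)) ℤ.suc l)
    (trans (ι-weighted {g = λ x → φ j (at x)} {λ x → fromℤ (ℤ.suc x)} {reciprocal j} {reciprocals (suc j) m}
             (product (λ x → fromℤ (ℤ.suc x))) (λ _ _ → refl)
             {Ψ = λ l′ → det (suc j) m (map at l′)}
             (λ x → trans (cong (λ q → binom q (suc j)) (fromℤ-suc x))
               (trans (binom-absorb (fromℤ x) j)
                 (cong (λ q → reciprocal j * (q * binom (fromℤ x) j)) (sym (fromℤ-suc x)))))
             (det-absorb (suc j) m) l)
    (cong (λ z → reciprocals j (suc m) * (product (λ x → fromℤ (ℤ.suc x)) l * z))
      (sym (ι-map (φ j) (det (suc j) m) at l)))))

  det-translate⁺ : ∀ m k l → det 0 m (map at (map (λ x → + k ℤ.+ x) l)) ≡ det 0 m (map at l)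
  det-translate⁺ m zero l = cong (λ l′ → det 0 m (map at l′))
    (trans (L.map-cong ℤ.+-identityˡ l) (L.map-id l))
  det-translate⁺ m (suc k) l = trans
    (cong (det 0 m) (trans (sym (L.map-∘ l))
      (trans (L.map-cong (λ x → cong at (ℤ.+-assoc ℤ.1ℤ (+ k) x)) l)
      (trans (L.map-∘ {g = shift} {f = λ x → at (+ k ℤ.+ x)} l) (cong (map shift) (L.map-∘ l))))))
    (trans (det-shift m (map at (map (λ x → + k ℤ.+ x) l))) (det-translate⁺ m k l))

  det-translate : ∀ m z l → det 0 m (map at (map (λ x → z ℤ.+ x) l)) ≡ det 0 m (map at l)
  det-translate m (+ k)    l = det-translate⁺ m k l
  det-translate m -[1+ k ] l = trans (sym (det-translate⁺ m (suc k) (map (λ x → -[1+ k ] ℤ.+ x) l)))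
    (cong (λ l′ → det 0 m (map at l′)) (trans (sym (L.map-∘ l))
      (trans (L.map-cong (λ x → trans (sym (ℤ.+-assoc (+ suc k) -[1+ k ] x))
        (trans (cong (ℤ._+ x) (ℤ.+-inverseʳ (+ suc k))) (ℤ.+-identityˡ x))) l) (L.map-id l))))

  gaps : ℕ → ℚ → List ℚ → ℚ
  gaps j x []      = 1ℚ
  gaps j x (y ∷ l) = (y - x) * reciprocal j * gaps (suc j) x l

  vandermondeᴸ : List ℚ → ℚ
  vandermondeᴸ []      = 1ℚ
  vandermondeᴸ (x ∷ l) = gaps 0 x l * vandermondeᴸ l

  gaps-product : ∀ j z l → gaps j (fromℤ z) (map fromℤ l) ≡
    reciprocals j (length l) * product (λ x → fromℤ (ℤ.suc x)) (map (λ x → ℤ.pred (ℤ.- z) ℤ.+ x) l)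
  gaps-product j z []      = refl
  gaps-product j z (y ∷ l) = trans
    (cong₂ (λ a b → a * reciprocal j * b) gap (gaps-product (suc j) z l))
    (identity (fromℤ (ℤ.suc (ℤ.pred (ℤ.- z) ℤ.+ y))) (reciprocal j) (reciprocals (suc j) (length l))
      (product (λ x → fromℤ (ℤ.suc x)) (map (λ x → ℤ.pred (ℤ.- z) ℤ.+ x) l)))
    where
    identity : ∀ a b c d → a * b * (c * d) ≡ (b * c) * (a * d)
    identity = solve-∀ ring
    gap : fromℤ y - fromℤ z ≡ fromℤ (ℤ.suc (ℤ.pred (ℤ.- z) ℤ.+ y))
    gap = trans (cong₂ _+_ {fromℤ y} refl (sym (fromℤ-neg z)))
      (trans (sym (fromℤ-+ y (ℤ.- z)))
      (cong fromℤ (trans (ℤ.+-comm y (ℤ.- z)) (trans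
        (cong (ℤ._+ y) (sym (ℤ.suc-pred (ℤ.- z)))) (ℤ.+-assoc ℤ.1ℤ (ℤ.pred (ℤ.- z)) y)))))

  -- Translate the first point z to 0: its row becomes (1, 0, ..., 0), and the minor left over
  -- starts at column 1. `det-absorb` takes y - z out of the row of each later y and lowers all
  -- columns by one, which leaves the smaller determinant.
  det-vandermonde : ∀ l → det 0 (length l) (map at l) ≡ vandermondeᴸ (map fromℤ l)
  det-vandermonde []      = refl
  det-vandermonde (z ∷ l) = trans (sym (det-translate (suc m) (ℤ.- z) (z ∷ l)))
    (trans (cong (λ x → det 0 (suc m) (at x ∷ map at l₀)) (ℤ.+-inverseˡ z))
    (trans (cong₂ _-_ {1ℚ * det 1 m (map at l₀)} refl (ι-zero (φ 0) (det-at-zero 0 m) (map at l₀)))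
    (trans (drop-zero (det 1 m (map at l₀)))
    (trans (cong (λ l′ → det 1 m (map at l′)) l₀≡)
    (trans (det-absorb 0 m l₁)
    (trans (cong (λ d → reciprocals 0 m * (product (λ x → fromℤ (ℤ.suc x)) l₁ * d))
             (trans (det-translate m (ℤ.pred (ℤ.- z)) l) (det-vandermonde l)))
    (trans (sym (ℚ.*-assoc (reciprocals 0 m) (product (λ x → fromℤ (ℤ.suc x)) l₁) (vandermondeᴸ (map fromℤ l))))
           (cong (_* vandermondeᴸ (map fromℤ l)) (sym (gaps-product 0 z l))))))))))
    where
    m = length l
    l₀ = map (λ x → ℤ.- z ℤ.+ x) l
    -- `det-absorb` expects points of the form x + 1, hence the extra `pred`; its row factor is then
    -- y - z itself.
    l₁ = map (λ x → ℤ.pred (ℤ.- z) ℤ.+ x) l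
    drop-zero : ∀ a → 1ℚ * a - 0ℚ ≡ a
    drop-zero = solve-∀ ring
    l₀≡ : l₀ ≡ map ℤ.suc l₁
    l₀≡ = trans (L.map-cong (λ x → trans (cong (ℤ._+ x) (sym (ℤ.suc-pred (ℤ.- z))))
                  (ℤ.+-assoc ℤ.1ℤ (ℤ.pred (ℤ.- z)) x)) l)
                (L.map-∘ l)

  -- The operators of the α-formula

  -- The product over v ∈ l of the operators id + E_u (E_v - id) = id + E_u Δ_v.
  spread : (Argument → Form) → Argument → Form
  spread G u []      = G u []
  spread G u (v ∷ l) =
    spread (λ u′ l′ → G u′ (v ∷ l′)) u l + spread (λ u′ l′ → G u′ (Δ v ∷ l′)) (shift u) l

  cons : Form → Argument → Form
  cons Φ u l = Φ (u ∷ l)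

  -- The product over all pairs p < q of the operators id + E_p (E_q - id).
  twist : Form → Form
  twist Φ []      = Φ []
  twist Φ (u ∷ l) = twist (spread (cons Φ) u) l

  spread-cong : ∀ {G H} → (∀ u l → G u l ≡ H u l) → ∀ u l → spread G u l ≡ spread H u l
  spread-cong G≡H u []      = G≡H u []
  spread-cong G≡H u (v ∷ l) = cong₂ _+_
    (spread-cong (λ u′ l′ → G≡H u′ (v ∷ l′)) u l) (spread-cong (λ u′ l′ → G≡H u′ (Δ v ∷ l′)) (shift u) l)

  spread-linear : ∀ a b G H u l →
    spread (λ u′ l′ → a * G u′ l′ + b * H u′ l′) u l ≡ a * spread G u l + b * spread H u l
  spread-linear a b G H u []      = refl
  spread-linear a b G H u (v ∷ l) = trans
    (cong₂ _+_ (spread-linear a b _ _ u l) (spread-linear a b _ _ (shift u) l))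
    (identity a b (spread (λ u′ l′ → G u′ (v ∷ l′)) u l) (spread (λ u′ l′ → H u′ (v ∷ l′)) u l)
      (spread (λ u′ l′ → G u′ (Δ v ∷ l′)) (shift u) l) (spread (λ u′ l′ → H u′ (Δ v ∷ l′)) (shift u) l))
    where
    identity : ∀ a b p q r s → (a * p + b * q) + (a * r + b * s) ≡ a * (p + r) + b * (q + s)
    identity = solve-∀ ring

  twist-cong : ∀ {Φ Ψ} → (∀ l → Φ l ≡ Ψ l) → ∀ l → twist Φ l ≡ twist Ψ l
  twist-cong Φ≡Ψ []      = Φ≡Ψ []
  twist-cong Φ≡Ψ (u ∷ l) = twist-cong (spread-cong (λ u′ l′ → Φ≡Ψ (u′ ∷ l′)) u) l

  twist-linear : ∀ a b Φ Ψ l → twist (λ l′ → a * Φ l′ + b * Ψ l′) l ≡ a * twist Φ l + b * twist Ψ l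
  twist-linear a b Φ Ψ []      = refl
  twist-linear a b Φ Ψ (u ∷ l) = trans (twist-cong (spread-linear a b (cons Φ) (cons Ψ) u) l)
    (twist-linear a b (spread (cons Φ) u) (spread (cons Ψ) u) l)

  scale-as-linear : ∀ a p → a * p ≡ a * p + 0ℚ * p
  scale-as-linear = solve-∀ ring

  +-as-linear : ∀ p q → p + q ≡ 1ℚ * p + 1ℚ * q
  +-as-linear = solve-∀ ring

  spread-scale : ∀ a G u l → spread (λ u′ l′ → a * G u′ l′) u l ≡ a * spread G u l
  spread-scale a G u l = trans (spread-cong (λ u′ l′ → scale-as-linear a (G u′ l′)) u l)
    (trans (spread-linear a 0ℚ G G u l) (sym (scale-as-linear a (spread G u l))))

  spread-+ : ∀ G H u l → spread (λ u′ l′ → G u′ l′ + H u′ l′) u l ≡ spread G u l + spread H u l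
  spread-+ G H u l = trans (spread-cong (λ u′ l′ → +-as-linear (G u′ l′) (H u′ l′)) u l)
    (trans (spread-linear 1ℚ 1ℚ G H u l) (sym (+-as-linear (spread G u l) (spread H u l))))

  twist-scale : ∀ a Φ l → twist (λ l′ → a * Φ l′) l ≡ a * twist Φ l
  twist-scale a Φ l = trans (twist-cong (λ l′ → scale-as-linear a (Φ l′)) l)
    (trans (twist-linear a 0ℚ Φ Φ l) (sym (scale-as-linear a (twist Φ l))))

  twist-+ : ∀ Φ Ψ l → twist (λ l′ → Φ l′ + Ψ l′) l ≡ twist Φ l + twist Ψ l
  twist-+ Φ Ψ l = trans (twist-cong (λ l′ → +-as-linear (Φ l′) (Ψ l′)) l)
    (trans (twist-linear 1ℚ 1ℚ Φ Ψ l) (sym (+-as-linear (twist Φ l) (twist Ψ l))))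

  twist-zero : ∀ {Φ} → (∀ l → Φ l ≡ 0ℚ) → ∀ l → twist Φ l ≡ 0ℚ
  twist-zero {Φ} Φ≡0 l = trans (twist-cong (λ l′ → trans (Φ≡0 l′) (sym (ℚ.*-zeroˡ (Φ l′)))) l)
    (trans (twist-scale 0ℚ Φ l) (ℚ.*-zeroˡ (twist Φ l)))

  neg-as-scale : ∀ p → - p ≡ - 1ℚ * p
  neg-as-scale = solve-∀ ring

  spread-neg : ∀ G u l → spread (λ u′ l′ → - G u′ l′) u l ≡ - spread G u l
  spread-neg G u l = trans (spread-cong (λ u′ l′ → neg-as-scale (G u′ l′)) u l)
    (trans (spread-scale (- 1ℚ) G u l) (sym (neg-as-scale (spread G u l))))

  +-interchange : ∀ a b c d → (a + b) + (c + d) ≡ (a + c) + (b + d)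
  +-interchange = solve-∀ ring

  spread-head-pascal : ∀ {G} → (∀ u l → G (shift u) l ≡ G u l + G (Δ u) l) →
    ∀ u l → spread G (shift u) l ≡ spread G u l + spread G (Δ u) l
  spread-head-pascal Gp u []      = Gp u []
  spread-head-pascal {G} Gp u (v ∷ l) = trans
    (cong₂ _+_ (spread-head-pascal (λ u′ l′ → Gp u′ (v ∷ l′)) u l)
               (spread-head-pascal (λ u′ l′ → Gp u′ (Δ v ∷ l′)) (shift u) l))
    (+-interchange (spread (λ u′ l′ → G u′ (v ∷ l′)) u l) (spread (λ u′ l′ → G u′ (v ∷ l′)) (Δ u) l)
                   (spread (λ u′ l′ → G u′ (Δ v ∷ l′)) (shift u) l) (spread (λ u′ l′ → G u′ (Δ v ∷ l′)) (Δ (shift u)) l))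

  spread-pascal : ∀ {G} → (∀ u → Pascal (G u)) → ∀ u → Pascal (spread G u)
  spread-pascal {G} Gp w [] u suf = trans
    (cong₂ _+_ (trans (spread-cong (λ w′ → Gp w′ [] u) w suf)
                      (spread-+ (λ w′ l → G w′ (u ∷ l)) (λ w′ l → G w′ (Δ u ∷ l)) w suf))
               (trans (spread-cong (λ w′ → Gp w′ [] (Δ u)) (shift w) suf)
                      (spread-+ (λ w′ l → G w′ (Δ u ∷ l)) (λ w′ l → G w′ (Δ (Δ u) ∷ l)) (shift w) suf)))
    (+-interchange (spread (λ w′ l → G w′ (u ∷ l)) w suf) (spread (λ w′ l → G w′ (Δ u ∷ l)) w suf)
                   (spread (λ w′ l → G w′ (Δ u ∷ l)) (shift w) suf) (spread (λ w′ l → G w′ (Δ (Δ u) ∷ l)) (shift w) suf))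
  spread-pascal {G} Gp w (v ∷ pre) u suf = trans
    (cong₂ _+_ (spread-pascal (λ w′ pre′ → Gp w′ (v ∷ pre′)) w pre u suf)
               (spread-pascal (λ w′ pre′ → Gp w′ (Δ v ∷ pre′)) (shift w) pre u suf))
    (+-interchange (spread (λ w′ l → G w′ (v ∷ l)) w (pre ++ u ∷ suf)) (spread (λ w′ l → G w′ (v ∷ l)) w (pre ++ Δ u ∷ suf))
                   (spread (λ w′ l → G w′ (Δ v ∷ l)) (shift w) (pre ++ u ∷ suf)) (spread (λ w′ l → G w′ (Δ v ∷ l)) (shift w) (pre ++ Δ u ∷ suf)))

  twist-pascal : ∀ {Φ} → Pascal Φ → Pascal (twist Φ)
  twist-pascal {Φ} Φp [] u suf = trans
    (twist-cong (spread-head-pascal (Φp []) u) suf)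
    (twist-+ (spread (cons Φ) u) (spread (cons Φ) (Δ u)) suf)
  twist-pascal Φp (w ∷ pre) = twist-pascal (spread-pascal (λ w′ pre′ → Φp (w′ ∷ pre′)) w) pre

  spread-degreeBelow : ∀ {n G} → (∀ u → DegreeBelow n (G u)) → ∀ u → DegreeBelow n (spread G u)
  spread-degreeBelow Gd w [] e x suf n≤e = cong₂ _+_
    (spread-zero (λ w′ l → Gd w′ [] e x l n≤e) w suf)
    (spread-zero (λ w′ l → Gd w′ [] (suc e) x l (ℕ.m≤n⇒m≤1+n n≤e)) (shift w) suf)
    where
    spread-zero : ∀ {G} → (∀ u l → G u l ≡ 0ℚ) → ∀ u l → spread G u l ≡ 0ℚ
    spread-zero G≡0 u []      = G≡0 u []
    spread-zero G≡0 u (v ∷ l) = cong₂ _+_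
      (spread-zero (λ u′ l′ → G≡0 u′ (v ∷ l′)) u l) (spread-zero (λ u′ l′ → G≡0 u′ (Δ v ∷ l′)) (shift u) l)
  spread-degreeBelow Gd w (v ∷ pre) e x suf n≤e = cong₂ _+_
    (spread-degreeBelow (λ w′ pre′ → Gd w′ (v ∷ pre′)) w pre e x suf n≤e)
    (spread-degreeBelow (λ w′ pre′ → Gd w′ (Δ v ∷ pre′)) (shift w) pre e x suf n≤e)

  twist-degreeBelow : ∀ {n Φ} → DegreeBelow n Φ → DegreeBelow n (twist Φ)
  twist-degreeBelow {n} {Φ} Φd [] e x suf n≤e = twist-zero (λ l → spread-head l) suf
    where
    vanish : ∀ {Φ : Argument → Form} → (∀ e x l → n ℕ.≤ e → Φ (e , x) l ≡ 0ℚ) →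
             ∀ x l → spread Φ (e , x) l ≡ 0ℚ
    vanish Φ≡0 x []      = Φ≡0 e x [] n≤e
    vanish Φ≡0 x (v ∷ l) = cong₂ _+_
      (vanish (λ e′ x′ l′ → Φ≡0 e′ x′ (v ∷ l′)) x l) (vanish (λ e′ x′ l′ → Φ≡0 e′ x′ (Δ v ∷ l′)) (ℤ.suc x) l)
    spread-head : ∀ l → spread (cons Φ) (e , x) l ≡ 0ℚ
    spread-head = vanish (Φd []) x
  twist-degreeBelow Φd (w ∷ pre) = twist-degreeBelow (spread-degreeBelow (λ w′ pre′ → Φd (w′ ∷ pre′)) w) pre

  -- The product over the entries of the list is symmetric in them, so swapping two neighbours
  -- passes through it.
  spread-antisymmetric : ∀ {G} → (∀ u → Antisymmetric (G u)) → ∀ u → Antisymmetric (spread G u)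
  spread-antisymmetric {G} Ga w [] u v suf = trans
    (cong₂ _+_ (cong₂ _+_ (flip w u v) (flip (shift w) u (Δ v)))
               (cong₂ _+_ (flip (shift w) (Δ u) v) (flip (shift (shift w)) (Δ u) (Δ v))))
    (identity (s w v u) (s (shift w) (Δ v) u) (s (shift w) v (Δ u)) (s (shift (shift w)) (Δ v) (Δ u)))
    where
    s : Argument → Argument → Argument → ℚ
    s w u v = spread (λ w′ l → G w′ (u ∷ v ∷ l)) w suf
    flip : ∀ w u v → s w u v ≡ - s w v u
    flip w u v = trans (spread-cong (λ w′ → Ga w′ [] u v) w suf) (spread-neg (λ w′ l → G w′ (v ∷ u ∷ l)) w suf)
    identity : ∀ a b c d → (- a + - b) + (- c + - d) ≡ - ((a + c) + (b + d))
    identity = solve-∀ ring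
  spread-antisymmetric {G} Ga w (x ∷ pre) u v suf = trans
    (cong₂ _+_ (spread-antisymmetric (λ w′ pre′ → Ga w′ (x ∷ pre′)) w pre u v suf)
               (spread-antisymmetric (λ w′ pre′ → Ga w′ (Δ x ∷ pre′)) (shift w) pre u v suf))
    (sym (ℚ.neg-distrib-+ (spread (λ w′ l → G w′ (x ∷ l)) w (pre ++ v ∷ u ∷ suf))
                          (spread (λ w′ l → G w′ (Δ x ∷ l)) (shift w) (pre ++ v ∷ u ∷ suf))))

  -- Commuting operators and the exchange relation

  spread-Δ : ∀ G u l → spread (λ u′ → G (Δ u′)) u l ≡ spread G (Δ u) l
  spread-Δ G u []      = refl
  spread-Δ G u (v ∷ l) = cong₂ _+_ (spread-Δ (λ u′ l′ → G u′ (v ∷ l′)) u l) (spread-Δ (λ u′ l′ → G u′ (Δ v ∷ l′)) (shift u) l)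

  spread₂ : (Argument → Argument → Form) → Argument → Argument → Form
  spread₂ G u v l = spread (λ u′ → spread (G u′) v) u l

  -- The factors of two heads commute: for each `w` in the list both sides expand into the same four
  -- terms in another order.
  spread₂-flip : ∀ G u v l → spread₂ G u v l ≡ spread₂ (λ v′ u′ → G u′ v′) v u l
  spread₂-flip G u v []      = refl
  spread₂-flip G u v (w ∷ l) = trans
    (cong₂ _+_ (split u (w)) (split (shift u) (Δ w)))
    (trans (cong₂ _+_ (cong₂ _+_ (step w u v) (step (Δ w) u (shift v)))
                      (cong₂ _+_ (step (Δ w) (shift u) v) (step (Δ (Δ w)) (shift u) (shift v))))
    (trans (+-interchange (t w v u) (t (Δ w) (shift v) u) (t (Δ w) v (shift u)) (t (Δ (Δ w)) (shift v) (shift u)))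
           (sym (cong₂ _+_ (split′ v w) (split′ (shift v) (Δ w))))))
    where
    s t : Argument → Argument → Argument → ℚ
    s w u v = spread₂ (λ u′ v′ l′ → G u′ v′ (w ∷ l′)) u v l
    t w v u = spread₂ (λ v′ u′ l′ → G u′ v′ (w ∷ l′)) v u l
    step : ∀ w u v → s w u v ≡ t w v u
    step w u v = spread₂-flip (λ u′ v′ l′ → G u′ v′ (w ∷ l′)) u v l
    split : ∀ u w → spread (λ u′ l′ → spread (G u′) v (w ∷ l′)) u l ≡ s w u v + s (Δ w) u (shift v)
    split u w = spread-+ (λ u′ → spread (λ v′ l′ → G u′ v′ (w ∷ l′)) v) (λ u′ → spread (λ v′ l′ → G u′ v′ (Δ w ∷ l′)) (shift v)) u l
    split′ : ∀ v w → spread (λ v′ l′ → spread (λ u′ → G u′ v′) u (w ∷ l′)) v l ≡ t w v u + t (Δ w) v (shift u)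
    split′ v w = spread-+ (λ v′ → spread (λ u′ l′ → G u′ v′ (w ∷ l′)) u) (λ v′ → spread (λ u′ l′ → G u′ v′ (Δ w ∷ l′)) (shift u)) v l

  -- (id + S_{u,v}) (id + E_v E_u - E_v) Φ = 0 for neighbouring arguments u, v, where S swaps u and v.
  Exchange : Form → Set
  Exchange Φ = ∀ pre u v suf →
    (Φ (pre ++ u ∷ v ∷ suf) + Φ (pre ++ Δ u ∷ shift v ∷ suf)) +
    (Φ (pre ++ v ∷ u ∷ suf) + Φ (pre ++ Δ v ∷ shift u ∷ suf)) ≡ 0ℚ

  -- Let K be the value without the factor of the pair (u, v) itself. The product of all other
  -- factors is symmetric in u and v, so K inherits antisymmetry from `Φ`, and `twist Φ` is (id +
  -- E_u Δ_v) K. `Exchange` applies id + E_v Δ_u as well; the two together are symmetric in u and v,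
  -- so the swapped copy cancels.
  twist-exchange : ∀ {Φ} → Antisymmetric Φ → Exchange (twist Φ)
  twist-exchange {Φ} Φa [] u v suf = trans
    (cong₂ _+_ (cong₂ _+_ (split u v) (split (Δ u) (shift v))) (cong₂ _+_ (split v u) (split (Δ v) (shift u))))
    (trans (cong₂ _+_ {(K u v + K (shift u) (Δ v)) + (K (Δ u) (shift v) + K (shift (Δ u)) (Δ (shift v)))} refl
      (cong₂ _+_ (cong₂ _+_ (flip v u) (flip (shift v) (Δ u))) (cong₂ _+_ (flip (Δ v) (shift u)) (flip (shift (Δ v)) (Δ (shift u))))))
           (identity (K u v) (K (shift u) (Δ v)) (K (Δ u) (shift v)) (K (shift (Δ u)) (Δ (shift v)))))
    where
    K : Argument → Argument → ℚ
    K u v = twist (spread₂ (λ v′ u′ l → Φ (u′ ∷ v′ ∷ l)) v u) suf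
    split : ∀ u v → twist Φ (u ∷ v ∷ suf) ≡ K u v + K (shift u) (Δ v)
    split u v = trans
      (twist-cong (λ l → trans
        (spread-+ (λ v′ → spread (λ u′ l′ → Φ (u′ ∷ v′ ∷ l′)) u) (λ v′ → spread (λ u′ l′ → Φ (u′ ∷ Δ v′ ∷ l′)) (shift u)) v l)
        (cong₂ _+_ {spread₂ (λ v′ u′ l′ → Φ (u′ ∷ v′ ∷ l′)) v u l} refl (spread-Δ (λ v′ → spread (λ u′ l′ → Φ (u′ ∷ v′ ∷ l′)) (shift u)) v l))) suf)
      (twist-+ (spread₂ (λ v′ u′ l → Φ (u′ ∷ v′ ∷ l)) v u) (spread₂ (λ v′ u′ l → Φ (u′ ∷ v′ ∷ l)) (Δ v) (shift u)) suf)
    flip : ∀ u v → K u v ≡ - K v u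
    flip u v = trans
      (twist-cong (λ l → trans (spread₂-flip (λ v′ u′ l′ → Φ (u′ ∷ v′ ∷ l′)) v u l)
        (trans (spread-cong (λ u′ l′ → trans (spread-cong (λ v′ → Φa [] u′ v′) v l′)
                                            (spread-neg (λ v′ l″ → Φ (v′ ∷ u′ ∷ l″)) v l′)) u l)
               (spread-neg (λ u′ → spread (λ v′ l″ → Φ (v′ ∷ u′ ∷ l″)) v) u l))) suf)
      (trans (twist-cong (λ l → neg-as-scale (spread₂ (λ u′ v′ l″ → Φ (v′ ∷ u′ ∷ l″)) u v l)) suf)
      (trans (twist-scale (- 1ℚ) (spread₂ (λ u′ v′ l″ → Φ (v′ ∷ u′ ∷ l″)) u v) suf) (sym (neg-as-scale (K v u)))))
    identity : ∀ a b c d → ((a + b) + (c + d)) + ((- a + - c) + (- b + - d)) ≡ 0ℚ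
    identity = solve-∀ ring
  twist-exchange Φa (w ∷ pre) = twist-exchange (spread-antisymmetric (λ w′ pre′ → Φa (w′ ∷ pre′)) w) pre

  spread-map : ∀ h → (∀ u → h (Δ u) ≡ Δ (h u)) → (∀ u → h (shift u) ≡ shift (h u)) →
    ∀ G u l → spread G (h u) (map h l) ≡ spread (λ u′ l′ → G (h u′) (map h l′)) u l
  spread-map h hΔ hs G u []      = refl
  spread-map h hΔ hs G u (v ∷ l) = cong₂ _+_
    (spread-map h hΔ hs (λ u′ l′ → G u′ (h v ∷ l′)) u l)
    (trans (cong₂ (λ w x → spread (λ u′ l′ → G u′ (w ∷ l′)) x (map h l)) (sym (hΔ v)) (sym (hs u)))
           (spread-map h hΔ hs (λ u′ l′ → G u′ (h (Δ v) ∷ l′)) (shift u) l))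

  twist-map : ∀ h → (∀ u → h (Δ u) ≡ Δ (h u)) → (∀ u → h (shift u) ≡ shift (h u)) →
    ∀ Φ l → twist Φ (map h l) ≡ twist (λ l′ → Φ (map h l′)) l
  twist-map h hΔ hs Φ []      = refl
  twist-map h hΔ hs Φ (u ∷ l) = trans (twist-map h hΔ hs (spread (cons Φ) (h u)) l)
    (twist-cong (spread-map h hΔ hs (cons Φ) u) l)

  -- Removing the only argument with exponent 0

  sgn : ℕ → ℚ
  sgn zero    = 1ℚ
  sgn (suc n) = - sgn n

  -- φ 0 (e , x) is 1 if e = 0 and 0 otherwise.
  Reduces : Form → Form → Set
  Reduces Φ Φ′ = ∀ pre u suf →
    Φ (map Δ pre ++ u ∷ map Δ suf) ≡ sgn (length pre) * (φ 0 u * Φ′ (pre ++ suf))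

  -- The constant column vanishes on arguments with positive exponent, so its expansion keeps only
  -- the term of `u`; on the others `Δ` turns each column into the previous one.
  det-reduces : ∀ m → Reduces (det 0 (suc m)) (det 0 m)
  det-reduces m pre u suf = trans (ι-reduces (det 1 m) pre u suf)
    (cong (λ d → sgn (length pre) * (φ 0 u * d)) (det-Δ 0 m (pre ++ suf)))
    where
    ι-reduces : ∀ Φ pre u suf → ι (φ 0) Φ (map Δ pre ++ u ∷ map Δ suf) ≡
                sgn (length pre) * (φ 0 u * Φ (map Δ (pre ++ suf)))
    ι-reduces Φ [] u suf = trans
      (cong₂ _-_ {φ 0 u * Φ (map Δ suf)} refl (trans (ι-map (φ 0) (cons Φ u) Δ suf)
                                              (ι-zeroˡ (λ _ → refl) (λ l → Φ (u ∷ map Δ l)) suf)))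
      (identity (φ 0 u * Φ (map Δ suf)))
      where
      identity : ∀ a → a - 0ℚ ≡ 1ℚ * a
      identity = solve-∀ ring
    ι-reduces Φ (w ∷ pre) u suf = trans
      (cong (λ a → 0ℚ * Φ (map Δ pre ++ u ∷ map Δ suf) - a) (ι-reduces (cons Φ (Δ w)) pre u suf))
      (identity (Φ (map Δ pre ++ u ∷ map Δ suf)) (sgn (length pre)) _)
      where
      identity : ∀ a b c → 0ℚ * a - b * c ≡ (- b) * c
      identity = solve-∀ ring

  -- Shifting `u` does not change `φ 0 u`, so the factor id + E_u Δ_v becomes id + Δ_v, that is E_v.
  -- This is the source of the shift of `suf` in `twist-reduces`.
  spread-head-reduces : ∀ {G H} → Pascal H → (∀ u l → G u (map Δ l) ≡ φ 0 u * H l) →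
    ∀ u l → spread G u (map Δ l) ≡ φ 0 u * H (map shift l)
  spread-head-reduces Hp G≡ u []      = G≡ u []
  spread-head-reduces {G} {H} Hp G≡ u (v ∷ l) = trans
    (cong₂ _+_
      (spread-head-reduces (λ pre → Hp (v ∷ pre)) (λ u′ l′ → G≡ u′ (v ∷ l′)) u l)
      (trans (spread-head-reduces (λ pre → Hp (Δ v ∷ pre)) (λ u′ l′ → G≡ u′ (Δ v ∷ l′)) (shift u) l)
             (cong (_* H (Δ v ∷ map shift l)) (φ₀-shift u))))
    (trans (sym (ℚ.*-distribˡ-+ (φ 0 u) (H (v ∷ map shift l)) (H (Δ v ∷ map shift l))))
           (cong (φ 0 u *_) (sym (Hp [] v (map shift l)))))

  spread-map-Δ : ∀ {a G H} → (∀ w l → G (Δ w) (map Δ l) ≡ a * H w l) →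
    ∀ w l → spread G (Δ w) (map Δ l) ≡ a * spread H w l
  spread-map-Δ {a} {G} {H} G≡ w l = trans
    (spread-map Δ (λ _ → refl) (λ _ → refl) G w l)
    (trans (spread-cong G≡ w l) (spread-scale a H w l))

  -- For a head `w` to the left of `u` the term E_w Δ_u contributes 0, because `φ 0` vanishes on
  -- `Δ u`. Hence `w` meets only the remaining arguments, and nothing to the left of `u` is shifted.
  -- The fixed length `k` keeps the sign the same in all terms.
  spread-reduces : ∀ {a u k G H} →
    (∀ u′ w pre suf → φ 0 u′ ≡ φ 0 u → length pre ≡ k → G (Δ w) (map Δ pre ++ u′ ∷ map Δ suf) ≡ a * H w (pre ++ suf)) →
    (∀ u′ w pre suf → length pre ≡ k → G (Δ w) (map Δ pre ++ Δ u′ ∷ map Δ suf) ≡ 0ℚ) →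
    ∀ w pre suf → length pre ≡ k →
    spread G (Δ w) (map Δ pre ++ u ∷ map Δ suf) ≡ a * spread H w (pre ++ suf)
  spread-reduces {a} {u} {k} {G} {H} G≡ G≡0 w [] suf refl = trans
    (cong₂ _+_ (spread-map-Δ {a} (λ w′ l → G≡ u w′ [] l refl refl) w suf)
               (spread-map-Δ {0ℚ} {H = H} (λ w′ l → trans (G≡0 u w′ [] l refl) (sym (ℚ.*-zeroˡ (H w′ l)))) (shift w) suf))
    (identity (a * spread H w suf) (spread H (shift w) suf))
    where
    identity : ∀ a b → a + 0ℚ * b ≡ a
    identity = solve-∀ ring
  spread-reduces {a} {u} {suc k} {G} {H} G≡ G≡0 w (v ∷ pre) suf refl = trans
    (cong₂ _+_
      (spread-reduces {a} {u} {H = λ w′ l → H w′ (v ∷ l)} (λ u′ w′ pre′ suf′ p q → G≡ u′ w′ (v ∷ pre′) suf′ p (cong suc q))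
        (λ u′ w′ pre′ suf′ q → G≡0 u′ w′ (v ∷ pre′) suf′ (cong suc q)) w pre suf refl)
      (spread-reduces {a} {u} {H = λ w′ l → H w′ (Δ v ∷ l)} (λ u′ w′ pre′ suf′ p q → G≡ u′ w′ (Δ v ∷ pre′) suf′ p (cong suc q))
        (λ u′ w′ pre′ suf′ q → G≡0 u′ w′ (Δ v ∷ pre′) suf′ (cong suc q)) (shift w) pre suf refl))
    (sym (ℚ.*-distribˡ-+ a (spread (λ w′ l → H w′ (v ∷ l)) w (pre ++ suf)) (spread (λ w′ l → H w′ (Δ v ∷ l)) (shift w) (pre ++ suf))))

  twist-reduces : ∀ {Φ Φ′} → Pascal Φ′ → Reduces Φ Φ′ → ∀ pre u suf →
    twist Φ (map Δ pre ++ u ∷ map Δ suf) ≡ sgn (length pre) * (φ 0 u * twist Φ′ (pre ++ map shift suf))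
  twist-reduces {Φ} {Φ′} Φ′p Φr [] u suf = trans
    (twist-map Δ (λ _ → refl) (λ _ → refl) (spread (cons Φ) u) suf)
    (trans (twist-cong (spread-head-reduces Φ′p (λ u′ l → trans (Φr [] u′ l) (ℚ.*-identityˡ _)) u) suf)
    (trans (twist-scale (φ 0 u) (λ l → Φ′ (map shift l)) suf)
    (trans (cong (φ 0 u *_) (sym (twist-map shift (λ _ → refl) (λ _ → refl) Φ′ suf)))
           (sym (ℚ.*-identityˡ (φ 0 u * twist Φ′ (map shift suf)))))))
  twist-reduces {Φ} {Φ′} Φ′p Φr (w ∷ pre) u suf = trans
    -- Each entry to the left of `u` costs one sign, kept inside the smaller form as the factor - 1.
    (twist-reduces {spread (cons Φ) (Δ w)} {λ l → - 1ℚ * spread (cons Φ′) w l} pascal′ reduces′ pre u suf)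
    (trans (cong (λ z → sgn (length pre) * (φ 0 u * z)) (twist-scale (- 1ℚ) (spread (cons Φ′) w) (pre ++ map shift suf)))
           (identity (sgn (length pre)) (φ 0 u) (twist Φ′ (w ∷ pre ++ map shift suf))))
    where
    pascal′ : Pascal (λ l → - 1ℚ * spread (cons Φ′) w l)
    pascal′ p v s = trans (cong (- 1ℚ *_) (spread-pascal (λ w′ p′ → Φ′p (w′ ∷ p′)) w p v s))
      (ℚ.*-distribˡ-+ (- 1ℚ) (spread (cons Φ′) w (p ++ v ∷ s)) (spread (cons Φ′) w (p ++ Δ v ∷ s)))
    regroup : ∀ s f x → (- s) * (f * x) ≡ (s * (- 1ℚ * f)) * x
    regroup = solve-∀ ring
    zero-factor : ∀ s x → s * (0ℚ * x) ≡ 0ℚ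
    zero-factor = solve-∀ ring
    identity : ∀ s f x → s * (f * (- 1ℚ * x)) ≡ (- s) * (f * x)
    identity = solve-∀ ring
    identity′ : ∀ s f x → (s * (- 1ℚ * f)) * x ≡ s * (f * (- 1ℚ * x))
    identity′ = solve-∀ ring
    reduces′ : Reduces (spread (cons Φ) (Δ w)) (λ l → - 1ℚ * spread (cons Φ′) w l)
    reduces′ p v s = trans
      (spread-reduces {sgn (length p) * (- 1ℚ * φ 0 v)} {v} {length p} {cons Φ} {cons Φ′}
        (λ v′ w′ p′ s′ φ≡ len → trans (Φr (w′ ∷ p′) v′ s′)
          (trans (cong₂ (λ k f → (- sgn k) * (f * Φ′ (w′ ∷ p′ ++ s′))) len φ≡)
                 (regroup (sgn (length p)) (φ 0 v) (Φ′ (w′ ∷ p′ ++ s′)))))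
        (λ v′ w′ p′ s′ len → trans (Φr (w′ ∷ p′) (Δ v′) s′) (zero-factor (- sgn (length p′)) (Φ′ (w′ ∷ p′ ++ s′))))
        w p s refl)
      (identity′ (sgn (length p)) (φ 0 v) (spread (cons Φ′) w (p ++ s)))

  -- `twist` applies the factors of the head before those of the tail, while `orderedPairs` lists
  -- the pairs containing the first index first and so applies them last. The orders agree since the
  -- factors commute.
  spread-twist : ∀ G u l → spread (λ u′ → twist (G u′)) u l ≡ twist (spread G u) l
  spread-twist G u []      = refl
  spread-twist G u (v ∷ l) = trans
    (cong₂ _+_ (step u v) (step (shift u) (Δ v)))
    (trans (sym (twist-+ (s u v) (s (shift u) (Δ v)) l))
           (twist-cong (λ l′ → sym (trans
             (spread-+ (λ v′ → spread (λ u′ l″ → G u′ (v′ ∷ l″)) u) (λ v′ → spread (λ u′ l″ → G u′ (Δ v′ ∷ l″)) (shift u)) v l′)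
             (cong₂ _+_ {s u v l′} refl (spread-Δ (λ v′ → spread (λ u′ l″ → G u′ (v′ ∷ l″)) (shift u)) v l′)))) l))
    where
    s : Argument → Argument → Form
    s u v = spread₂ (λ v′ u′ l → G u′ (v′ ∷ l)) v u
    step : ∀ u v → spread (λ u′ l′ → twist (G u′) (v ∷ l′)) u l ≡ twist (s u v) l
    step u v = trans (spread-twist (λ u′ → spread (cons (G u′)) v) u l)
      (twist-cong (spread₂-flip (λ u′ v′ l′ → G u′ (v′ ∷ l′)) u v) l)

  -- Agreement with `α` at integer points

  sucs : ∀ {n} → Fin n × Fin n → Fin (suc n) × Fin (suc n)
  sucs (i , j) = F.suc i , F.suc j

  orderedPairs-suc : ∀ n → orderedPairs (suc n) ≡
    map (λ j → F.zero , F.suc j) (L.allFin n) ++ map sucs (orderedPairs n)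
  orderedPairs-suc n = trans
    (cong (λ js → select (L.cartesianProduct (F.zero ∷ js) (F.zero ∷ js))) (sym (L.map-tabulate id F.suc)))
    (trans (L.filter-++ (uncurry F._<?_) (map (F.zero ,_) (map F.suc (L.allFin n))) _)
           (cong₂ _++_ (first-row (L.allFin n)) (other-rows (L.allFin n) (L.allFin n))))
    where
    select : List (Fin (suc n) × Fin (suc n)) → List (Fin (suc n) × Fin (suc n))
    select = L.filter (uncurry F._<?_)
    first-row : ∀ js → select (map (F.zero ,_) (map F.suc js)) ≡ map (λ j → F.zero , F.suc j) js
    first-row []       = refl
    first-row (j ∷ js) = cong (_ ∷_) (first-row js)
    row : ∀ i js → select (map (F.suc i ,_) (map F.suc js)) ≡ map sucs (L.filter (uncurry F._<?_) (map (i ,_) js))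
    row i []       = refl
    row i (j ∷ js) with does (i F.<? j)
    ... | true  = cong (_ ∷_) (row i js)
    ... | false = row i js
    other-rows : ∀ is js → select (L.cartesianProduct (map F.suc is) (F.zero ∷ map F.suc js)) ≡
      map sucs (L.filter (uncurry F._<?_) (L.cartesianProduct is js))
    other-rows []       js = refl
    other-rows (i ∷ is) js = trans (L.filter-++ (uncurry F._<?_) (map (F.suc i ,_) (map F.suc js)) _)
      (trans (cong₂ _++_ (row i js) (other-rows is js))
      (trans (sym (L.map-++ sucs (L.filter (uncurry F._<?_) (map (i ,_) js)) _))
             (cong (map sucs) (sym (L.filter-++ (uncurry F._<?_) (map (i ,_) js) _)))))

  Π-++ : ∀ {a} {A : Set a} (xs ys : List A) f → Π[ xs ++ ys ] f ≡ Π[ xs ] f * Π[ ys ] f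
  Π-++ []       ys f = sym (ℚ.*-identityˡ _)
  Π-++ (x ∷ xs) ys f = trans (cong (f x *_) (Π-++ xs ys f)) (sym (ℚ.*-assoc (f x) (Π[ xs ] f) (Π[ ys ] f)))

  Π-map : ∀ {a b} {A : Set a} {B : Set b} (h : A → B) xs f → Π[ map h xs ] f ≡ Π[ xs ] λ x → f (h x)
  Π-map h xs f = cong (L.foldr _*_ 1ℚ) (sym (L.map-∘ xs))

  vandermonde-list : ∀ n (k : Vec ℚ n) → vandermonde n k ≡ vandermondeᴸ (V.toList k)
  vandermonde-list zero    []      = refl
  vandermonde-list (suc n) (x ∷ k) = trans
    (cong (λ ps → Π[ ps ] difference) (orderedPairs-suc n))
    (trans (Π-++ (map (λ j → F.zero , F.suc j) (L.allFin n)) (map sucs (orderedPairs n)) difference)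
    (cong₂ _*_
      (trans (Π-map (λ j → F.zero , F.suc j) (L.allFin n) difference) (gaps-Π 0 n k))
      (trans (Π-map sucs (orderedPairs n) difference) (vandermonde-list n k))))
    where
    difference : Fin (suc n) × Fin (suc n) → ℚ
    difference (i , j) = (V.lookup (x ∷ k) j - V.lookup (x ∷ k) i) * ((+ 1) / suc (toℕ j ∸ suc (toℕ i)))
    gaps-Π : ∀ a m (k : Vec ℚ m) → (Π[ L.allFin m ] λ j → (V.lookup k j - x) * reciprocal (a ℕ.+ toℕ j)) ≡ gaps a x (V.toList k)
    gaps-Π a zero    []      = refl
    gaps-Π a (suc m) (y ∷ k) = cong₂ _*_ (cong (λ b → (y - x) * reciprocal b) (ℕ.+-identityʳ a))
      (trans (cong (λ js → Π[ js ] λ j → (V.lookup (y ∷ k) j - x) * reciprocal (a ℕ.+ toℕ j)) (sym (L.map-tabulate id F.suc)))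
      (trans (Π-map F.suc (L.allFin m) (λ j → (V.lookup (y ∷ k) j - x) * reciprocal (a ℕ.+ toℕ j)))
      (trans (cong (L.foldr _*_ 1ℚ) (L.map-cong (λ j → cong (λ b → (V.lookup k j - x) * reciprocal b) (ℕ.+-suc a (toℕ j))) (L.allFin m)))
             (gaps-Π (suc a) m k))))

  factors : ∀ {n} → List (Fin n × Fin n) → Operator n
  factors ps = composeAll (map (uncurry factor) ps)

  factors-++ : ∀ {n} ps qs (f : PolynomialFunction n) k → factors (ps ++ qs) f k ≡ factors ps (factors qs f) k
  factors-++ []       qs f k = refl
  factors-++ (p ∷ ps) qs f k = cong₂ _-_
    (cong₂ _+_ (factors-++ ps qs f k) (factors-++ ps qs f _)) (factors-++ ps qs f _)

  factors-sucs : ∀ {n} ps (f : PolynomialFunction (suc n)) x k →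
    factors (map sucs ps) f (x ∷ k) ≡ factors ps (λ k′ → f (x ∷ k′)) k
  factors-sucs []       f x k = refl
  factors-sucs (p ∷ ps) f x k = cong₂ _-_
    (cong₂ _+_ (factors-sucs ps f x k) (factors-sucs ps f x _)) (factors-sucs ps f x _)

  headFactors : ∀ {n} → List (Fin n) → Operator (suc n)
  headFactors js = composeAll (map (λ j → factor F.zero (F.suc j)) js)

  headFactors-sucs : ∀ {n} js (f : PolynomialFunction (suc (suc n))) x y k →
    headFactors (map F.suc js) f (x ∷ y ∷ k) ≡ headFactors js (λ k′ → f (V.head k′ ∷ y ∷ V.tail k′)) (x ∷ k)
  headFactors-sucs []       f x y k = refl
  headFactors-sucs (j ∷ js) f x y k = cong₂ _-_
    (cong₂ _+_ (headFactors-sucs js f x y k) (headFactors-sucs js f _ y _)) (headFactors-sucs js f _ y k)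

  -- Only integer points are compared: arguments carry integers, and finite differences at such
  -- points already determine the coefficients.
  _agreesWith_ : ∀ {n} → Form → PolynomialFunction n → Set
  _agreesWith_ {n} Φ f = ∀ (k : Vec ℤ n) → Φ (map at (V.toList k)) ≡ f (V.map fromℤ k)

  -- E_p E_q - E_p is E_p Δ_q, and `Pascal` trades the formal Δ for a difference of two values at
  -- integer points.
  spread-headFactors : ∀ n {G f} → (∀ u → Pascal (G u)) →
    (∀ x (k : Vec ℤ n) → G (at x) (map at (V.toList k)) ≡ f (fromℤ x ∷ V.map fromℤ k)) →
    ∀ x (k : Vec ℤ n) → spread G (at x) (map at (V.toList k)) ≡ headFactors (L.allFin n) f (fromℤ x ∷ V.map fromℤ k)
  spread-headFactors zero    Gp G≡f x []      = G≡f x []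
  spread-headFactors (suc n) {G} {f} Gp G≡f x (y ∷ k) = trans
    (cong₂ _+_ (ih x y) (trans
      (spread-cong (λ u l → difference (G u (shift (at y) ∷ l)) (G u (at y ∷ l)) (G u (Δ (at y) ∷ l)) (Gp u [] (at y) l)) (at (ℤ.suc x)) l₀)
      (trans (spread-linear 1ℚ (- 1ℚ) (λ u l → G u (shift (at y) ∷ l)) (λ u l → G u (at y ∷ l)) (at (ℤ.suc x)) l₀)
             (cong₂ (λ a b → 1ℚ * a + - 1ℚ * b) (ih (ℤ.suc x) (ℤ.suc y)) (ih (ℤ.suc x) y)))))
    (trans (identity (h (fromℤ x) (fromℤ y)) (h (fromℤ (ℤ.suc x)) (fromℤ (ℤ.suc y))) (h (fromℤ (ℤ.suc x)) (fromℤ y)))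
    (trans (cong₂ (λ a b → h (fromℤ x) (fromℤ y) + h a b - h a (fromℤ y)) (fromℤ-suc x) (fromℤ-suc y))
    (trans (cong₂ _-_ (cong₂ _+_ (unfold (fromℤ x) (fromℤ y)) (unfold (fromℤ x + 1ℚ) (fromℤ y + 1ℚ))) (unfold (fromℤ x + 1ℚ) (fromℤ y)))
           (cong (λ js → headFactors (F.zero ∷ js) f (fromℤ x ∷ fromℤ y ∷ V.map fromℤ k)) (L.map-tabulate id F.suc)))))
    where
    l₀ = map at (V.toList k)
    h : ℚ → ℚ → ℚ
    h a b = headFactors (L.allFin n) (λ k′ → f (V.head k′ ∷ b ∷ V.tail k′)) (a ∷ V.map fromℤ k)
    unfold : ∀ a b → h a b ≡ headFactors (map F.suc (L.allFin n)) f (a ∷ b ∷ V.map fromℤ k)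
    unfold a b = sym (headFactors-sucs (L.allFin n) f a b (V.map fromℤ k))
    ih : ∀ x y → spread (λ u l → G u (at y ∷ l)) (at x) l₀ ≡ h (fromℤ x) (fromℤ y)
    ih x y = spread-headFactors n (λ u pre → Gp u (at y ∷ pre)) (λ x′ k′ → G≡f x′ (y ∷ k′)) x k
    solve-for : ∀ b c → c ≡ 1ℚ * (b + c) + - 1ℚ * b
    solve-for = solve-∀ ring
    difference : ∀ a b c → a ≡ b + c → c ≡ 1ℚ * a + - 1ℚ * b
    difference a b c a≡b+c = trans (solve-for b c) (cong (λ z → 1ℚ * z + - 1ℚ * b) (sym a≡b+c))
    identity : ∀ a b c → a + (1ℚ * b + - 1ℚ * c) ≡ a + b - c
    identity = solve-∀ ring

  twist-factors : ∀ n {Φ f} → Pascal Φ → Φ agreesWith f → twist Φ agreesWith factors (orderedPairs n) f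
  twist-factors zero    Φp Φ≡f []      = Φ≡f []
  twist-factors (suc n) {Φ} {f} Φp Φ≡f (x ∷ k) = trans
    (sym (spread-twist (cons Φ) (at x) (map at (V.toList k))))
    (trans (spread-headFactors n {f = factors (map sucs (orderedPairs n)) f}
             (λ u → twist-pascal (λ pre → Φp (u ∷ pre)))
             (λ x′ k′ → trans (twist-factors n (λ pre → Φp (at x′ ∷ pre)) (λ k″ → Φ≡f (x′ ∷ k″)) k′)
                              (sym (factors-sucs (orderedPairs n) f (fromℤ x′) (V.map fromℤ k′)))) x k)
    (trans (cong (λ os → composeAll os (factors (map sucs (orderedPairs n)) f) (fromℤ x ∷ V.map fromℤ k)) (L.map-∘ (L.allFin n)))
    (trans (sym (factors-++ (map (λ j → F.zero , F.suc j) (L.allFin n)) (map sucs (orderedPairs n)) f _))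
           (cong (λ ps → factors ps f (fromℤ x ∷ V.map fromℤ k)) (sym (orderedPairs-suc n))))))

  Ψ : ℕ → Form
  Ψ n = twist (det 0 n)

  Ψ-α : ∀ n → Ψ n agreesWith α n
  Ψ-α n = twist-factors n (det-pascal 0 n) λ k → trans
    (cong (λ m → det 0 m (map at (V.toList k))) (sym (V.length-toList k)))
    (trans (det-vandermonde (V.toList k))
    (trans (cong vandermondeᴸ (sym (V.toList-map fromℤ k))) (sym (vandermonde-list n (V.map fromℤ k)))))

  -- From boxes to interlacing rows

  Σ-++ : ∀ {a} {A : Set a} (xs ys : List A) f → Σ[ xs ++ ys ] f ≡ Σ[ xs ] f + Σ[ ys ] f
  Σ-++ []       ys f = sym (ℚ.+-identityˡ (Σ[ ys ] f))
  Σ-++ (x ∷ xs) ys f = trans (cong (λ z → f x + z) (Σ-++ xs ys f)) (sym (ℚ.+-assoc (f x) (Σ[ xs ] f) (Σ[ ys ] f)))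

  Σ-map : ∀ {a b} {A : Set a} {B : Set b} (h : A → B) xs f → Σ[ map h xs ] f ≡ Σ[ xs ] λ x → f (h x)
  Σ-map h xs f = cong (L.foldr _+_ 0ℚ) (sym (L.map-∘ xs))

  Σ-cong : ∀ {a} {A : Set a} {f g : A → ℚ} → (∀ x → f x ≡ g x) → ∀ xs → Σ[ xs ] f ≡ Σ[ xs ] g
  Σ-cong f≡g xs = cong (L.foldr _+_ 0ℚ) (L.map-cong f≡g xs)

  double-zero : ∀ x → x + x ≡ 0ℚ → x ≡ 0ℚ
  double-zero x x+x≡0 = trans (halve x) (cong (½ *_) x+x≡0)
    where
    halve : ∀ x → x ≡ ½ * (x + x)
    halve = solve-∀ ring

  sumFrom : ℕ → ℕ → (ℕ → ℚ) → ℚ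
  sumFrom t zero    f = 0ℚ
  sumFrom t (suc r) f = f t + sumFrom (suc t) r f

  sumFrom-cong : ∀ {f g} → (∀ u → f u ≡ g u) → ∀ t r → sumFrom t r f ≡ sumFrom t r g
  sumFrom-cong f≡g t zero    = refl
  sumFrom-cong f≡g t (suc r) = cong₂ _+_ (f≡g t) (sumFrom-cong f≡g (suc t) r)

  sumFrom-linear : ∀ a b f g t r → sumFrom t r (λ u → a * f u + b * g u) ≡ a * sumFrom t r f + b * sumFrom t r g
  sumFrom-linear a b f g t zero = identity a b
    where
    identity : ∀ a b → 0ℚ ≡ a * 0ℚ + b * 0ℚ
    identity = solve-∀ ring
  sumFrom-linear a b f g t (suc r) = trans
    (cong (λ z → (a * f t + b * g t) + z) (sumFrom-linear a b f g (suc t) r))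
    (identity a b (f t) (g t) (sumFrom (suc t) r f) (sumFrom (suc t) r g))
    where
    identity : ∀ a b p q x y → (a * p + b * q) + (a * x + b * y) ≡ a * (p + x) + b * (q + y)
    identity = solve-∀ ring

  sumFrom-+ : ∀ f g t r → sumFrom t r (λ u → f u + g u) ≡ sumFrom t r f + sumFrom t r g
  sumFrom-+ f g t r = trans (sumFrom-cong (λ u → +-as-linear (f u) (g u)) t r)
    (trans (sumFrom-linear 1ℚ 1ℚ f g t r) (sym (+-as-linear (sumFrom t r f) (sumFrom t r g))))

  sumFrom-zero : ∀ {f} t r → (∀ u → t ℕ.≤ u → f u ≡ 0ℚ) → sumFrom t r f ≡ 0ℚ
  sumFrom-zero t zero    f≡0 = refl
  sumFrom-zero t (suc r) f≡0 = cong₂ _+_ (f≡0 t ℕ.≤-refl)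
    (sumFrom-zero (suc t) r λ u t<u → f≡0 u (ℕ.<⇒≤ t<u))

  sumFrom-suc : ∀ f t r → sumFrom t r (λ u → f (suc u)) ≡ sumFrom (suc t) r f
  sumFrom-suc f t zero    = refl
  sumFrom-suc f t (suc r) = cong (λ z → f (suc t) + z) (sumFrom-suc f (suc t) r)

  sumFrom-last : ∀ f t r → sumFrom t (suc r) f ≡ sumFrom t r f + f (t ℕ.+ r)
  sumFrom-last f t zero    = trans (ℚ.+-comm (f t) 0ℚ) (cong (λ k → 0ℚ + f k) (sym (ℕ.+-identityʳ t)))
  sumFrom-last f t (suc r) = trans
    (cong (λ z → f t + z) (trans (sumFrom-last f (suc t) r) (cong (λ k → sumFrom (suc t) r f + f k) (sym (ℕ.+-suc t r)))))
    (sym (ℚ.+-assoc (f t) (sumFrom (suc t) r f) (f (t ℕ.+ suc r))))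

  sumFrom-comm : ∀ (f : ℕ → ℕ → ℚ) t r t′ r′ →
    sumFrom t r (λ a → sumFrom t′ r′ (λ b → f a b)) ≡ sumFrom t′ r′ (λ b → sumFrom t r (λ a → f a b))
  sumFrom-comm f t zero    t′ r′ = sym (sumFrom-zero t′ r′ (λ _ _ → refl))
  sumFrom-comm f t (suc r) t′ r′ = trans
    (cong (λ z → sumFrom t′ r′ (f t) + z) (sumFrom-comm f (suc t) r t′ r′))
    (sym (sumFrom-+ (f t) (λ b → sumFrom (suc t) r (λ a → f a b)) t′ r′))

  module _ (n : ℕ) where

    -- The sum of f u over all u ≥ t, provided that f u = 0 for u ≥ n.
    sum≥ : ℕ → (ℕ → ℚ) → ℚ
    sum≥ t f = sumFrom t n f

    -- Every sum has the fixed length n. Starting one later adds the term at t + n, which is 0.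
    sum≥-unfold : ∀ t {f} → (∀ u → n ℕ.≤ u → f u ≡ 0ℚ) → sum≥ t f ≡ f t + sum≥ (suc t) f
    sum≥-unfold t {f} f≡0 = trans
      (trans (sym (ℚ.+-identityʳ (sum≥ t f))) (cong (λ z → sum≥ t f + z) (sym (f≡0 (t ℕ.+ n) (ℕ.m≤n+m n t)))))
      (sym (sumFrom-last f t n))

    box : List ℕ → (List ℕ → ℚ) → ℚ
    box []       A = A []
    box (e ∷ es) A = sum≥ e λ u → box es λ l → A (u ∷ l)

    box-cong : ∀ es {A B} → (∀ l → A l ≡ B l) → box es A ≡ box es B
    box-cong []       A≡B = A≡B []
    box-cong (e ∷ es) A≡B = sumFrom-cong (λ u → box-cong es λ l → A≡B (u ∷ l)) e n

    box-linear : ∀ a b es A B → box es (λ l → a * A l + b * B l) ≡ a * box es A + b * box es B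
    box-linear a b []       A B = refl
    box-linear a b (e ∷ es) A B = trans
      (sumFrom-cong (λ u → box-linear a b es (λ l → A (u ∷ l)) (λ l → B (u ∷ l))) e n)
      (sumFrom-linear a b (λ u → box es λ l → A (u ∷ l)) (λ u → box es λ l → B (u ∷ l)) e n)

    box-scale : ∀ a es A → box es (λ l → a * A l) ≡ a * box es A
    box-scale a es A = trans (box-cong es λ l → scale-as-linear a (A l))
      (trans (box-linear a 0ℚ es A A) (sym (scale-as-linear a (box es A))))

    box-zero : ∀ es {A} → (∀ l → A l ≡ 0ℚ) → box es A ≡ 0ℚ
    box-zero []       A≡0 = A≡0 []
    box-zero (e ∷ es) A≡0 = sumFrom-zero e n λ u _ → box-zero es λ l → A≡0 (u ∷ l)

    Supported : (List ℕ → ℚ) → Set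
    Supported A = ∀ pre e suf → n ℕ.≤ e → A (pre ++ e ∷ suf) ≡ 0ℚ

    -- The operator id + E_v Δ_u of the exchange relation, seen from the exponents a and b after
    -- Pascal's rule and the signs (-1)^e have been applied. The factors 1 and - 1 match the shape
    -- of the linearity lemmas.
    defect : (ℕ → ℕ → ℚ) → ℕ → ℕ → ℚ
    defect B a b = 1ℚ * B a b + (- 1ℚ * B a (suc b) + 1ℚ * B (suc a) (suc b))

    Balanced : (List ℕ → ℚ) → Set
    Balanced A = ∀ pre a b suf →
      let B x y = A (pre ++ x ∷ y ∷ suf) in defect B a b + defect B b a ≡ 0ℚ

    -- The only point at which the sum over a box and the sum over interlacing rows differ.
    sum≥-defect : ∀ (B : ℕ → ℕ → ℚ) → (∀ a b → defect B a b + defect B b a ≡ 0ℚ) →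
      (∀ a b → n ℕ.≤ a → B a b ≡ 0ℚ) → (∀ a b → n ℕ.≤ b → B a b ≡ 0ℚ) →
      ∀ t → (sum≥ t λ a → sum≥ t λ b → B a b) ≡ sum≥ (suc t) λ b → B t b
    sum≥-defect B balanced B≡0 B≡0′ t = trans S≡ (trans (cong (λ z → z + r) zero-part) (ℚ.+-identityˡ r))
      where
      S : ℕ → ℕ → (ℕ → ℕ → ℚ) → ℚ
      S t t′ B = sum≥ t λ a → sum≥ t′ λ b → B a b
      -- The quadrant a, b ≥ t is the disjoint union of the column b = t, the quadrant a, b > t and
      -- the rest of the row a = t.
      p q r : ℚ
      p = sum≥ t λ a → B a t
      q = S (suc t) (suc t) B
      r = sum≥ (suc t) λ b → B t b
      S-linear : ∀ a b B C → S t t (λ x y → a * B x y + b * C x y) ≡ a * S t t B + b * S t t C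
      S-linear a b B C = trans (sumFrom-cong (λ x → sumFrom-linear a b (B x) (C x) t n) t n)
        (sumFrom-linear a b (λ x → sum≥ t (B x)) (λ x → sum≥ t (C x)) t n)
      inner : S t t B ≡ p + S t (suc t) B
      inner = trans (sumFrom-cong (λ a → sum≥-unfold t (B≡0′ a)) t n)
        (sumFrom-+ (λ a → B a t) (λ a → sum≥ (suc t) (B a)) t n)
      outer : S t (suc t) B ≡ r + q
      outer = sum≥-unfold t (λ u n≤u → sumFrom-zero (suc t) n (λ b _ → B≡0 u b n≤u))
      S≡ : S t t B ≡ (p + q) + r
      S≡ = trans inner (trans (cong (λ z → p + z) outer) (identity p q r))
        where
        identity : ∀ p q r → p + (r + q) ≡ (p + q) + r
        identity = solve-∀ ring
      -- The defect sums to S t t - S t (t + 1) + S (t + 1) (t + 1), and the first two terms differ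
      -- by `p`.
      defect-sum : S t t (defect B) ≡ p + q
      defect-sum = trans
        (sumFrom-cong (λ a → sumFrom-cong (λ b → regroup (B a b) (B a (suc b)) (B (suc a) (suc b))) t n) t n)
        (trans (S-linear 1ℚ 1ℚ B (λ a b → - 1ℚ * B a (suc b) + 1ℚ * B (suc a) (suc b)))
        (trans (cong (λ z → 1ℚ * S t t B + 1ℚ * z) (trans
                 (S-linear (- 1ℚ) 1ℚ (λ a b → B a (suc b)) (λ a b → B (suc a) (suc b)))
                 (cong₂ (λ x y → - 1ℚ * x + 1ℚ * y)
                   (sumFrom-cong (λ a → sumFrom-suc (B a) t n) t n)
                   (trans (sumFrom-cong (λ a → sumFrom-suc (B (suc a)) t n) t n) (sumFrom-suc (λ a → sum≥ (suc t) (B a)) t n)))))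
        (trans (cong (λ z → 1ℚ * z + 1ℚ * (- 1ℚ * S t (suc t) B + 1ℚ * q)) inner)
               (identity p (S t (suc t) B) q))))
        where
        regroup : ∀ x y z → 1ℚ * x + (- 1ℚ * y + 1ℚ * z) ≡ 1ℚ * x + 1ℚ * (- 1ℚ * y + 1ℚ * z)
        regroup = solve-∀ ring
        identity : ∀ p s q → 1ℚ * (p + s) + 1ℚ * (- 1ℚ * s + 1ℚ * q) ≡ p + q
        identity = solve-∀ ring
      -- Interchanging the summations exchanges `defect B a b` and `defect B b a`, so twice the sum
      -- of the defects is a sum of zeros.
      zero-part : p + q ≡ 0ℚ
      zero-part = trans (sym defect-sum) (double-zero (S t t (defect B)) (trans
        (cong (λ z → S t t (defect B) + z) (sumFrom-comm (defect B) t n t n))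
        (trans (sym (sumFrom-+ (λ a → sum≥ t (defect B a)) (λ a → sum≥ t (λ b → defect B b a)) t n))
               (sumFrom-zero t n λ a _ → trans (sym (sumFrom-+ (defect B a) (λ b → defect B b a) t n))
                                              (sumFrom-zero t n λ b _ → balanced a b)))))

  -- Rows with entries in {t, …, t + n - 1} are encoded by their characteristic vectors.
  holes marks : ∀ {n} → ℕ → Vec Bool n → List ℕ
  holes t []           = []
  holes t (true  ∷ bs) = holes (suc t) bs
  holes t (false ∷ bs) = t ∷ holes (suc t) bs
  marks t []           = []
  marks t (true  ∷ bs) = t ∷ marks (suc t) bs
  marks t (false ∷ bs) = marks (suc t) bs

  -- above b lists the rows that can be put on top of the row b in a monotone triangle:
  -- reading from left to right, b has 0 (above) or 1 (above′) entries more than the upper row.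
  above above′ : ∀ {n} → Vec Bool n → List (Vec Bool n)
  above []            = []
  above (true  ∷ bs)  = map (true ∷_) (above bs) ++ map (false ∷_) (above′ bs)
  above (false ∷ bs)  = map (false ∷_) (above bs)
  above′ []           = [] ∷ []
  above′ (true  ∷ bs) = map (true ∷_) (above′ bs)
  above′ (false ∷ bs) = map (true ∷_) (above bs) ++ map (false ∷_) (above′ bs)

  Balanced-∷ : ∀ {n A} → Balanced n A → ∀ u → Balanced n (λ l → A (u ∷ l))
  Balanced-∷ Ab u pre = Ab (u ∷ pre)

  module _ (n : ℕ) where

    box-defect : ∀ es {A : ℕ → ℕ → List ℕ → ℚ} → (∀ a b l → defect n (λ x y → A x y l) a b + defect n (λ x y → A x y l) b a ≡ 0ℚ) →
      ∀ a b → defect n (λ x y → box n es (A x y)) a b + defect n (λ x y → box n es (A x y)) b a ≡ 0ℚ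
    box-defect es {A} balanced a b = trans
      (cong₂ _+_ (unfold a b) (unfold b a))
      (trans (+-as-linear (box n es (λ l → defect n (λ x y → A x y l) a b)) (box n es (λ l → defect n (λ x y → A x y l) b a)))
      (trans (sym (box-linear n 1ℚ 1ℚ es (λ l → defect n (λ x y → A x y l) a b) (λ l → defect n (λ x y → A x y l) b a)))
             (box-zero n es (λ l → trans (sym (+-as-linear (defect n (λ x y → A x y l) a b) (defect n (λ x y → A x y l) b a))) (balanced a b l)))))
      where
      one : ∀ x y → 1ℚ * x + y ≡ 1ℚ * x + 1ℚ * y
      one = solve-∀ ring
      unfold : ∀ a b → defect n (λ x y → box n es (A x y)) a b ≡ box n es (λ l → defect n (λ x y → A x y l) a b)
      unfold a b = sym (trans
        (box-cong n es (λ l → one (A a b l) (- 1ℚ * A a (suc b) l + 1ℚ * A (suc a) (suc b) l)))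
        (trans (box-linear n 1ℚ 1ℚ es (A a b) (λ l → - 1ℚ * A a (suc b) l + 1ℚ * A (suc a) (suc b) l))
        (trans (cong (λ z → 1ℚ * box n es (A a b) + 1ℚ * z) (box-linear n (- 1ℚ) 1ℚ es (A a (suc b)) (A (suc a) (suc b))))
               (sym (one (box n es (A a b)) (- 1ℚ * box n es (A a (suc b)) + 1ℚ * box n es (A (suc a) (suc b))))))))

    -- At position t, `above` means that one lower bound, now equal to t, is still pending, and
    -- `above′` that none is. A pending bound splits into u = t (a hole of the upper row) and u > t
    -- (still pending). A new bound t arriving while one is pending is the only case in which the
    -- box contains index lists that come from no interlacing row; `sum≥-defect` removes them.
    box-above : ∀ {m} t (bs : Vec Bool m) A → n ℕ.≤ t ℕ.+ m → Supported n A → Balanced n A →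
      box n (t ∷ holes t bs) A ≡ Σ[ above bs ] λ u → A (holes t u)
    box-above′ : ∀ {m} t (bs : Vec Bool m) A → n ℕ.≤ t ℕ.+ m → Supported n A → Balanced n A →
      box n (holes t bs) A ≡ Σ[ above′ bs ] λ u → A (holes t u)

    split-above : ∀ {m} t (bs : Vec Bool m) A → n ℕ.≤ suc t ℕ.+ m → Supported n A → Balanced n A →
      (sum≥ n t λ u → box n (holes (suc t) bs) λ l → A (u ∷ l)) ≡
      Σ[ map (true ∷_) (above bs) ++ map (false ∷_) (above′ bs) ] λ u → A (holes t u)

    -- With no positions left, t ≥ n, so a bound that is still pending sums only zeros.
    box-above t [] A n≤t As Ab = sumFrom-zero t n λ u t≤u →
      As [] u [] (ℕ.≤-trans n≤t (ℕ.≤-trans (ℕ.≤-reflexive (ℕ.+-identityʳ t)) t≤u))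
    box-above {suc m} t (true  ∷ bs) A n≤t+m As Ab =
      split-above t bs A (ℕ.≤-trans n≤t+m (ℕ.≤-reflexive (ℕ.+-suc t m))) As Ab
    box-above {suc m} t (false ∷ bs) A n≤t+m As Ab = trans
      (sum≥-defect n (λ u v → box n (holes (suc t) bs) λ l → A (u ∷ v ∷ l))
        (box-defect (holes (suc t) bs) {λ u v l → A (u ∷ v ∷ l)} (λ a b l → Ab [] a b l))
        (λ a b n≤a → box-zero n (holes (suc t) bs) (λ l → As [] a (b ∷ l) n≤a))
        (λ a b n≤b → box-zero n (holes (suc t) bs) (λ l → As (a ∷ []) b l n≤b)) t)
      (trans (box-above (suc t) bs (λ l → A (t ∷ l)) (ℕ.≤-trans n≤t+m (ℕ.≤-reflexive (ℕ.+-suc t m)))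
               (λ pre → As (t ∷ pre)) (Balanced-∷ {n} {A} Ab t))
             (sym (Σ-map (false ∷_) (above bs) (λ u → A (holes t u)))))

    box-above′ t [] A n≤t As Ab = sym (ℚ.+-identityʳ (A []))
    box-above′ {suc m} t (true  ∷ bs) A n≤t+m As Ab = trans
      (box-above′ (suc t) bs A (ℕ.≤-trans n≤t+m (ℕ.≤-reflexive (ℕ.+-suc t m))) As Ab)
      (sym (Σ-map (true ∷_) (above′ bs) (λ u → A (holes t u))))
    box-above′ {suc m} t (false ∷ bs) A n≤t+m As Ab =
      split-above t bs A (ℕ.≤-trans n≤t+m (ℕ.≤-reflexive (ℕ.+-suc t m))) As Ab

    split-above t bs A n≤t+m As Ab = trans
      (sum≥-unfold n t (λ u n≤u → box-zero n (holes (suc t) bs) (λ l → As [] u l n≤u)))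
      (trans (cong₂ _+_
               (box-above′ (suc t) bs (λ l → A (t ∷ l)) n≤t+m (λ pre → As (t ∷ pre)) (Balanced-∷ {n} {A} Ab t))
               (box-above (suc t) bs A n≤t+m As Ab))
      (trans (ℚ.+-comm (Σ[ above′ bs ] λ u → A (t ∷ holes (suc t) u)) (Σ[ above bs ] λ u → A (holes (suc t) u)))
      (trans (cong₂ _+_ (sym (Σ-map (true ∷_) (above bs) (λ u → A (holes t u))))
                        (sym (Σ-map (false ∷_) (above′ bs) (λ u → A (holes t u)))))
             (sym (Σ-++ (map (true ∷_) (above bs)) (map (false ∷_) (above′ bs)) (λ u → A (holes t u)))))))

  -- The coefficients as values of the form Ψ

  -- (-1)^(e₁ + ⋯ + e_c) Φ((e_c , x), …, (e₁ , x), suf)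
  signed : Form → ℤ → List ℕ → Form
  signed Φ x []      suf = Φ suf
  signed Φ x (e ∷ l) suf = sgn e * signed Φ x l ((e , x) ∷ suf)

  signed-pascal : ∀ {Φ} → Pascal Φ → ∀ x l → Pascal (signed Φ x l)
  signed-pascal Φp x []      pre u suf = Φp pre u suf
  signed-pascal {Φ} Φp x (e ∷ l) pre u suf = trans
    (cong (sgn e *_) (signed-pascal Φp x l ((e , x) ∷ pre) u suf))
    (ℚ.*-distribˡ-+ (sgn e) (signed Φ x l ((e , x) ∷ pre ++ u ∷ suf)) (signed Φ x l ((e , x) ∷ pre ++ Δ u ∷ suf)))

  signed-degreeBelow : ∀ {n Φ} → DegreeBelow n Φ → ∀ x l → DegreeBelow n (signed Φ x l)
  signed-degreeBelow Φd x []      pre e y suf n≤e = Φd pre e y suf n≤e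
  signed-degreeBelow Φd x (e ∷ l) pre e′ y suf n≤e′ = trans
    (cong (sgn e *_) (signed-degreeBelow Φd x l ((e , x) ∷ pre) e′ y suf n≤e′)) (ℚ.*-zeroʳ (sgn e))

  signed-exchange : ∀ {Φ} → Exchange Φ → ∀ x l → Exchange (signed Φ x l)
  signed-exchange Φx x []      pre u v suf = Φx pre u v suf
  signed-exchange {Φ} Φx x (e ∷ l) pre u v suf = trans
    (factor-out (sgn e) (s (u ∷ v ∷ suf)) (s (Δ u ∷ shift v ∷ suf)) (s (v ∷ u ∷ suf)) (s (Δ v ∷ shift u ∷ suf)))
    (trans (cong (sgn e *_) (signed-exchange Φx x l ((e , x) ∷ pre) u v suf)) (ℚ.*-zeroʳ (sgn e)))
    where
    s : Form
    s l′ = signed Φ x l ((e , x) ∷ pre ++ l′)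
    factor-out : ∀ k a b c d → (k * a + k * b) + (k * c + k * d) ≡ k * ((a + b) + (c + d))
    factor-out = solve-∀ ring

  signed-supported : ∀ {n Φ} → DegreeBelow n Φ → ∀ x suf → Supported n (λ l → signed Φ x l suf)
  signed-supported Φd x suf []        e l n≤e = trans
    (cong (sgn e *_) (signed-degreeBelow Φd x l [] e x suf n≤e)) (ℚ.*-zeroʳ (sgn e))
  signed-supported Φd x suf (u ∷ pre) e l n≤e = trans
    (cong (sgn u *_) (signed-supported Φd x ((u , x) ∷ suf) pre e l n≤e)) (ℚ.*-zeroʳ (sgn u))

  -- `signed` reverses the list, so neighbouring exponents a, b become the arguments (b , x), (a ,
  -- x). Pascal's rule splits the shifted argument in `Exchange`, and the signs turn the resulting
  -- three terms into the defect.
  signed-balanced : ∀ {n Φ} → Pascal Φ → Exchange Φ → ∀ x suf → Balanced n (λ l → signed Φ x l suf)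
  signed-balanced {n} {Φ} Φp Φx x suf [] a b l = trans
    (identity (sgn a) (sgn b) (Θ b a) (Θ (suc b) a) (Θ (suc b) (suc a)) (Θ a b) (Θ (suc a) b) (Θ (suc a) (suc b)))
    (trans (cong (λ z → sgn a * sgn b * z) (trans
             (cong₂ (λ y z → (Θ b a + y) + (Θ a b + z)) (sym (Θp (suc b) a)) (sym (Θp (suc a) b)))
             (signed-exchange Φx x l [] (b , x) (a , x) suf)))
           (ℚ.*-zeroʳ (sgn a * sgn b)))
    where
    Θ : ℕ → ℕ → ℚ
    Θ b a = signed Φ x l ((b , x) ∷ (a , x) ∷ suf)
    Θp : ∀ b a → signed Φ x l ((b , x) ∷ shift (a , x) ∷ suf) ≡ Θ b a + Θ b (suc a)
    Θp b a = signed-pascal Φp x l ((b , x) ∷ []) (a , x) suf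
    identity : ∀ s t p q r p′ q′ r′ →
      (1ℚ * (s * (t * p)) + (- 1ℚ * (s * (- t * q)) + 1ℚ * (- s * (- t * r)))) +
      (1ℚ * (t * (s * p′)) + (- 1ℚ * (t * (- s * q′)) + 1ℚ * (- t * (- s * r′)))) ≡
      s * t * ((p + (q + r)) + (p′ + (q′ + r′)))
    identity = solve-∀ ring
  signed-balanced {n} {Φ} Φp Φx x suf (u ∷ pre) a b l = trans
    (identity (sgn u) (A a b) (A a (suc b)) (A (suc a) (suc b)) (A b a) (A b (suc a)) (A (suc b) (suc a)))
    (trans (cong (sgn u *_) (signed-balanced {n} Φp Φx x ((u , x) ∷ suf) pre a b l)) (ℚ.*-zeroʳ (sgn u)))
    where
    A : ℕ → ℕ → ℚ
    A a b = signed Φ x (pre ++ a ∷ b ∷ l) ((u , x) ∷ suf)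
    identity : ∀ k p q r p′ q′ r′ →
      (1ℚ * (k * p) + (- 1ℚ * (k * q) + 1ℚ * (k * r))) + (1ℚ * (k * p′) + (- 1ℚ * (k * q′) + 1ℚ * (k * r′))) ≡
      k * ((1ℚ * p + (- 1ℚ * q + 1ℚ * r)) + (1ℚ * p′ + (- 1ℚ * q′ + 1ℚ * r′)))
    identity = solve-∀ ring

  telescope : ∀ (f g : ℕ → ℚ) → (∀ e → f e ≡ g e + f (suc e)) → ∀ e r → f e ≡ sumFrom e r g + f (e ℕ.+ r)
  telescope f g f≡ e zero    = trans (cong f (sym (ℕ.+-identityʳ e))) (sym (ℚ.+-identityˡ (f (e ℕ.+ 0))))
  telescope f g f≡ e (suc r) = trans (f≡ e)
    (trans (cong (λ z → g e + z) (telescope f g f≡ (suc e) r))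
    (trans (sym (ℚ.+-assoc (g e) (sumFrom (suc e) r g) (f (suc e ℕ.+ r))))
           (cong (λ k → g e + sumFrom (suc e) r g + f k) (sym (ℕ.+-suc e r)))))

  -- (-Δ)^e p (x) = Σ_{e′ ≥ e} (-Δ)^e′ p (x + 1) for every polynomial p.
  signed-box : ∀ {n Φ} → Pascal Φ → DegreeBelow n Φ → ∀ x l suf →
    signed Φ x l suf ≡ box n l (λ l′ → signed Φ (ℤ.suc x) l′ suf)
  signed-box Φp Φd x []      suf = refl
  signed-box {n} {Φ} Φp Φd x (e ∷ l) suf = trans
    (telescope (λ e → sgn e * s e x) (λ e → sgn e * s e (ℤ.suc x))
      (λ e → trans (identity (sgn e) (s e x) (s (suc e) x))
        (cong (λ z → sgn e * z + - sgn e * s (suc e) x) (sym (signed-pascal Φp x l [] (e , x) suf)))) e n)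
    (trans (cong (λ z → sum≥ n e (λ e′ → sgn e′ * s e′ (ℤ.suc x)) + z)
             (trans (cong (sgn (e ℕ.+ n) *_) (signed-degreeBelow Φd x l [] (e ℕ.+ n) x suf (ℕ.m≤n+m n e)))
                    (ℚ.*-zeroʳ (sgn (e ℕ.+ n)))))
    (trans (ℚ.+-identityʳ (sum≥ n e (λ e′ → sgn e′ * s e′ (ℤ.suc x))))
    (sumFrom-cong (λ e′ → trans
       (cong (sgn e′ *_) (signed-box Φp Φd x l ((e′ , ℤ.suc x) ∷ suf)))
       (sym (box-scale n (sgn e′) l (λ l′ → signed Φ (ℤ.suc x) l′ ((e′ , ℤ.suc x) ∷ suf))))) e n)))
    where
    s : ℕ → ℤ → ℚ
    s e y = signed Φ x l ((e , y) ∷ suf)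
    identity : ∀ k a b → k * a ≡ k * (a + b) + - k * b
    identity = solve-∀ ring

  Ψ-pascal : ∀ n → Pascal (Ψ n)
  Ψ-pascal n = twist-pascal (det-pascal 0 n)

  Ψ-degreeBelow : ∀ n → DegreeBelow n (Ψ n)
  Ψ-degreeBelow n = twist-degreeBelow (det-degreeBelow 0 n n ℕ.≤-refl)

  Ψ-exchange : ∀ n → Exchange (Ψ n)
  Ψ-exchange n = twist-exchange (det-antisymmetric 0 n)

  Ψ-reduces : ∀ n pre u suf → Ψ (suc n) (map Δ pre ++ u ∷ map Δ suf) ≡
    sgn (length pre) * (φ 0 u * Ψ n (pre ++ map shift suf))
  Ψ-reduces n = twist-reduces (det-pascal 0 n) (det-reduces n)

  Ψ-shift : ∀ n l → Ψ n (map shift l) ≡ Ψ n l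
  Ψ-shift n l = trans (twist-map shift (λ _ → refl) (λ _ → refl) (det 0 n) l) (twist-cong (det-shift n) l)

  -- The number x put in for the next variable is one more left argument with exponent 0; this is
  -- the additional bound 0 with which `above` starts. The base point advances to x + 1, the next
  -- number to be put in.
  signed-above : ∀ {n m} Φ → Pascal Φ → DegreeBelow n Φ → Exchange Φ → ∀ x (bs : Vec Bool m) suf → n ℕ.≤ m →
    signed Φ x (holes 0 bs) (at x ∷ suf) ≡ Σ[ above bs ] λ u → signed Φ (ℤ.suc x) (holes 0 u) suf
  signed-above {n} Φ Φp Φd Φx x bs suf n≤m = trans (sym (ℚ.*-identityˡ (signed Φ x (holes 0 bs) (at x ∷ suf))))
    (trans (signed-box {n} Φp Φd x (0 ∷ holes 0 bs) suf)
           (box-above n 0 bs (λ l → signed Φ (ℤ.suc x) l suf) n≤m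
             (signed-supported Φd (ℤ.suc x) suf) (signed-balanced {n} Φp Φx (ℤ.suc x) suf)))

  -- The case c + d = n

  _==_ : ∀ {n} → Vec Bool n → Vec Bool n → Bool
  []           == []           = true
  (true  ∷ as) == (true  ∷ bs) = as == bs
  (false ∷ as) == (false ∷ bs) = as == bs
  (true  ∷ as) == (false ∷ bs) = false
  (false ∷ as) == (true  ∷ bs) = false

  indicator : Bool → ℚ
  indicator b = if b then 1ℚ else 0ℚ

  holes-suc : ∀ {n} t (bs : Vec Bool n) → holes (suc t) bs ≡ map suc (holes t bs)
  holes-suc t []           = refl
  holes-suc t (true  ∷ bs) = holes-suc (suc t) bs
  holes-suc t (false ∷ bs) = cong (suc t ∷_) (holes-suc (suc t) bs)

  marks-suc : ∀ {n} t (bs : Vec Bool n) → marks (suc t) bs ≡ map suc (marks t bs)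
  marks-suc t []           = refl
  marks-suc t (true  ∷ bs) = cong (suc t ∷_) (marks-suc (suc t) bs)
  marks-suc t (false ∷ bs) = marks-suc (suc t) bs

  signs : List ℕ → ℚ
  signs []      = 1ℚ
  signs (e ∷ l) = sgn e * signs l

  lefts : ℤ → List ℕ → List Argument
  lefts x l = map (_, x) l

  rights : ℤ → List ℕ → List Argument
  rights y = map λ t → t , y ℤ.- + t

  signed-ʳ++ : ∀ Φ x l suf → signed Φ x l suf ≡ signs l * Φ (lefts x l ʳ++ suf)
  signed-ʳ++ Φ x []      suf = sym (ℚ.*-identityˡ (Φ suf))
  signed-ʳ++ Φ x (e ∷ l) suf = trans (cong (sgn e *_) (signed-ʳ++ Φ x l ((e , x) ∷ suf)))
    (sym (ℚ.*-assoc (sgn e) (signs l) (Φ (lefts x l ʳ++ (e , x) ∷ suf))))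

  sgn-square : ∀ n → sgn n * sgn n ≡ 1ℚ
  sgn-square zero    = refl
  sgn-square (suc n) = trans (identity (sgn n)) (sgn-square n)
    where
    identity : ∀ a → (- a) * (- a) ≡ a * a
    identity = solve-∀ ring

  signs-suc : ∀ l → signs (map suc l) ≡ sgn (length l) * signs l
  signs-suc []      = refl
  signs-suc (e ∷ l) = trans (cong ((- sgn e) *_) (signs-suc l)) (identity (sgn e) (sgn (length l)) (signs l))
    where
    identity : ∀ a b c → (- a) * (b * c) ≡ (- b) * (a * c)
    identity = solve-∀ ring

  lefts-Δ : ∀ x l suf → lefts x (map suc l) ʳ++ suf ≡ map Δ (L.reverse (lefts x l)) ++ suf
  lefts-Δ x l suf = trans (cong (_ʳ++ suf) (trans (sym (L.map-∘ l)) (L.map-∘ l)))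
    (trans (L.ʳ++-defn (map Δ (lefts x l))) (cong (_++ suf) (sym (L.reverse-map Δ (lefts x l)))))

  length-lefts : ∀ x l → length (L.reverse (lefts x l)) ≡ length l
  length-lefts x l = trans (L.length-reverse (lefts x l)) (L.length-map (_, x) l)

  pred-rights : List ℕ → List Argument
  pred-rights = map λ t → t , -[1+ t ]

  rights-Δ : ∀ l → rights (+ 0) (map suc l) ≡ map Δ (pred-rights l)
  rights-Δ l = trans (sym (L.map-∘ l)) (L.map-∘ l)

  shift-pred-rights : ∀ l → map shift (pred-rights l) ≡ rights (+ 0) l
  shift-pred-rights l = trans (sym (L.map-∘ l)) (L.map-cong (λ t → cong (t ,_) (lemma t)) l)
    where
    lemma : ∀ t → ℤ.suc -[1+ t ] ≡ + 0 ℤ.- + t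
    lemma zero    = refl
    lemma (suc t) = refl

  base-value : ∀ {n} → Vec Bool n → Vec Bool n → ℚ
  base-value {n} bs cs = signed (Ψ n) (+ 1) (holes 0 bs) (rights (+ 0) (marks 0 cs))

  -- The first position decides which arguments have exponent 0. A single one is removed by
  -- `base-step`; if there is none, the constant column vanishes; two of them give 0 by the exchange
  -- relation.
  base-indicator : ∀ {n} (bs cs : Vec Bool n) → base-value bs cs ≡ indicator (bs == cs)
  -- The argument with exponent 0 sits at 0 if it comes from the right and at 1 if it comes from the
  -- left. The constant column does not tell these apart, hence the arbitrary point `x`.
  base-step : ∀ n (bs cs : Vec Bool n) x →
    signed (Ψ (suc n)) (+ 1) (map suc (holes 0 bs)) ((0 , x) ∷ rights (+ 0) (map suc (marks 0 cs))) ≡ indicator (bs == cs)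

  base-indicator [] [] = refl
  base-indicator (true ∷ bs) (true ∷ cs) rewrite holes-suc 0 bs | marks-suc 0 cs = base-step _ bs cs (+ 0)
  base-indicator {suc n} (false ∷ bs) (false ∷ cs) rewrite holes-suc 0 bs | marks-suc 0 cs = trans
    (ℚ.*-identityˡ (signed (Ψ (suc n)) (+ 1) (map suc (holes 0 bs)) ((0 , + 1) ∷ rights (+ 0) (map suc (marks 0 cs)))))
    (base-step n bs cs (+ 1))
  base-indicator {suc n} (true ∷ bs) (false ∷ cs) rewrite holes-suc 0 bs | marks-suc 0 cs = trans
    (signed-ʳ++ (Ψ (suc n)) (+ 1) (map suc (holes 0 bs)) (rights (+ 0) (map suc (marks 0 cs))))
    (trans (cong (λ l → signs (map suc (holes 0 bs)) * Ψ (suc n) l) all-Δ)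
    (trans (cong (signs (map suc (holes 0 bs)) *_) (vanish (L.reverse (lefts (+ 1) (holes 0 bs)) ++ pred-rights (marks 0 cs))))
           (ℚ.*-zeroʳ (signs (map suc (holes 0 bs))))))
    where
    all-Δ : lefts (+ 1) (map suc (holes 0 bs)) ʳ++ rights (+ 0) (map suc (marks 0 cs)) ≡
            map Δ (L.reverse (lefts (+ 1) (holes 0 bs)) ++ pred-rights (marks 0 cs))
    all-Δ = trans (lefts-Δ (+ 1) (holes 0 bs) (rights (+ 0) (map suc (marks 0 cs))))
      (trans (cong (map Δ (L.reverse (lefts (+ 1) (holes 0 bs))) ++_) (rights-Δ (marks 0 cs)))
             (sym (L.map-++ Δ (L.reverse (lefts (+ 1) (holes 0 bs))) (pred-rights (marks 0 cs)))))
    vanish : ∀ l → Ψ (suc n) (map Δ l) ≡ 0ℚ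
    vanish []      = refl
    vanish (u ∷ l) = trans (Ψ-reduces n [] (Δ u) l) (identity (Ψ n (map shift l)))
      where
      identity : ∀ a → 1ℚ * (0ℚ * a) ≡ 0ℚ
      identity = solve-∀ ring
  -- Here 1 belongs to both s and i: apply the exchange relation to two equal arguments (0 , 0).
  base-indicator {suc n} (false ∷ bs) (true ∷ cs) rewrite holes-suc 0 bs | marks-suc 0 cs = trans
    (ℚ.*-identityˡ (signed (Ψ (suc n)) (+ 1) (map suc (holes 0 bs)) ((0 , + 1) ∷ r)))
    (trans (signed-ʳ++ (Ψ (suc n)) (+ 1) (map suc (holes 0 bs)) ((0 , + 1) ∷ r))
    (trans (cong (λ l → signs (map suc (holes 0 bs)) * Ψ (suc n) l)
             (trans (lefts-Δ (+ 1) (holes 0 bs) ((0 , + 1) ∷ r))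
                    (cong (λ l → p ++ (0 , + 1) ∷ (0 , + 0) ∷ l) (rights-Δ (marks 0 cs)))))
    (trans (cong (signs (map suc (holes 0 bs)) *_) (trans (Ψ-pascal (suc n) p w (w ∷ q)) zero-sum))
           (ℚ.*-zeroʳ (signs (map suc (holes 0 bs)))))))
    where
    w : Argument
    w = 0 , + 0
    r p q p₀ : List Argument
    r = w ∷ rights (+ 0) (map suc (marks 0 cs))
    p₀ = L.reverse (lefts (+ 1) (holes 0 bs))
    p = map Δ p₀
    q = map Δ (pred-rights (marks 0 cs))
    Δ-Δ : Ψ (suc n) (p ++ Δ w ∷ Δ w ∷ q) ≡ 0ℚ
    Δ-Δ = trans (Ψ-reduces n p₀ (Δ w) (w ∷ pred-rights (marks 0 cs)))
      (identity (sgn (length p₀)) (Ψ n (p₀ ++ map shift (w ∷ pred-rights (marks 0 cs)))))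
      where
      identity : ∀ a b → a * (0ℚ * b) ≡ 0ℚ
      identity = solve-∀ ring
    Δ-shift : Ψ (suc n) (p ++ Δ w ∷ shift w ∷ q) ≡ Ψ (suc n) (p ++ Δ w ∷ w ∷ q)
    Δ-shift = trans (cong (Ψ (suc n)) (sym (L.++-assoc p (Δ w ∷ []) (shift w ∷ q))))
      (trans (Ψ-pascal (suc n) (p ++ Δ w ∷ []) w q)
      (trans (cong₂ (λ a b → Ψ (suc n) a + Ψ (suc n) b) (L.++-assoc p (Δ w ∷ []) (w ∷ q)) (L.++-assoc p (Δ w ∷ []) (Δ w ∷ q)))
      (trans (cong (λ z → Ψ (suc n) (p ++ Δ w ∷ w ∷ q) + z) Δ-Δ) (ℚ.+-identityʳ (Ψ (suc n) (p ++ Δ w ∷ w ∷ q))))))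
    zero-sum : Ψ (suc n) (p ++ w ∷ w ∷ q) + Ψ (suc n) (p ++ Δ w ∷ w ∷ q) ≡ 0ℚ
    zero-sum = trans (cong (λ z → Ψ (suc n) (p ++ w ∷ w ∷ q) + z) (sym Δ-shift))
      (double-zero (Ψ (suc n) (p ++ w ∷ w ∷ q) + Ψ (suc n) (p ++ Δ w ∷ shift w ∷ q)) (Ψ-exchange (suc n) p w w q))

  base-step n bs cs x = trans
    (signed-ʳ++ (Ψ (suc n)) (+ 1) (map suc (holes 0 bs)) ((0 , x) ∷ rights (+ 0) (map suc (marks 0 cs))))
    (trans (cong₂ _*_ (signs-suc (holes 0 bs)) (trans
             (cong (Ψ (suc n)) (trans (lefts-Δ (+ 1) (holes 0 bs) ((0 , x) ∷ rights (+ 0) (map suc (marks 0 cs))))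
               (cong (λ l → map Δ p₀ ++ (0 , x) ∷ l) (rights-Δ (marks 0 cs)))))
             (trans (Ψ-reduces n p₀ (0 , x) (pred-rights (marks 0 cs)))
               (cong₂ (λ k l → sgn k * (1ℚ * Ψ n l)) (length-lefts (+ 1) (holes 0 bs))
                 (trans (cong (p₀ ++_) (shift-pred-rights (marks 0 cs))) (sym (L.ʳ++-defn (lefts (+ 1) (holes 0 bs)))))))))
    -- Lowering the left exponents costs one sign each, and so does moving past them in the
    -- expansion.
    (trans (identity (sgn (length (holes 0 bs))) (signs (holes 0 bs)) _)
    (trans (cong (_* (signs (holes 0 bs) * Ψ n (lefts (+ 1) (holes 0 bs) ʳ++ rights (+ 0) (marks 0 cs)))) (sgn-square (length (holes 0 bs))))
    (trans (ℚ.*-identityˡ (signs (holes 0 bs) * Ψ n (lefts (+ 1) (holes 0 bs) ʳ++ rights (+ 0) (marks 0 cs))))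
    (trans (sym (signed-ʳ++ (Ψ n) (+ 1) (holes 0 bs) (rights (+ 0) (marks 0 cs))))
           (base-indicator bs cs))))))
    where
    p₀ = L.reverse (lefts (+ 1) (holes 0 bs))
    identity : ∀ a b c → (a * b) * (a * (1ℚ * c)) ≡ (a * a) * (b * c)
    identity = solve-∀ ring

  signed-shift : ∀ {Φ} → (∀ l → Φ (map shift l) ≡ Φ l) → ∀ x l suf →
    signed Φ (ℤ.suc x) l (map shift suf) ≡ signed Φ x l suf
  signed-shift Φs x []      suf = Φs suf
  signed-shift Φs x (e ∷ l) suf = cong (sgn e *_) (signed-shift Φs x l ((e , x) ∷ suf))

  rights-shift : ∀ y l → rights (ℤ.suc y) l ≡ map shift (rights y l)
  rights-shift y l = trans (L.map-cong (λ t → cong (t ,_) (ℤ.+-assoc ℤ.1ℤ y (ℤ.- + t))) l) (L.map-∘ l)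

  signed-translate : ∀ {n} k (bs cs : Vec Bool n) →
    signed (Ψ n) (+ suc k) (holes 0 bs) (rights (+ k) (marks 0 cs)) ≡ base-value bs cs
  signed-translate zero        bs cs = refl
  signed-translate {n} (suc k) bs cs = trans
    (cong (signed (Ψ n) (+ suc (suc k)) (holes 0 bs)) (rights-shift (+ k) (marks 0 cs)))
    (trans (signed-shift (Ψ-shift n) (+ suc k) (holes 0 bs) (rights (+ k) (marks 0 cs))) (signed-translate k bs cs))

  -- Counting trapezoids row by row

  middles : ℕ → ℕ → List Argument
  middles c zero    = []
  middles c (suc m) = at (+ suc c) ∷ middles (suc c) m

  row : ∀ {n} → Vec Bool n → List ℤ
  row b = map +_ (marks 1 b)

  -- The list top stands for the rows (just one, or none if d = 0) above the first step.
  trapezoids : ∀ {n} → List (List ℤ) → Vec Bool n → ℕ → Vec Bool n → List (List (List ℤ))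
  trapezoids top cs zero    b = if b == cs then top ∷ [] else []
  trapezoids top cs (suc m) b = L.concatMap (λ u → map (_∷ʳ row b) (trapezoids top cs m u)) (above b)

  fromℕ-+ : ∀ a b → fromℕ (a ℕ.+ b) ≡ fromℕ a + fromℕ b
  fromℕ-+ a b = fromℤ-+ (+ a) (+ b)

  length-concatMap : ∀ {a b} {A : Set a} {B : Set b} (f : A → List B) xs →
    fromℕ (length (L.concatMap f xs)) ≡ Σ[ xs ] λ x → fromℕ (length (f x))
  length-concatMap f []       = refl
  length-concatMap f (x ∷ xs) = trans (cong fromℕ (L.length-++ (f x)))
    (trans (fromℕ-+ (length (f x)) (length (L.concatMap f xs))) (cong (λ z → fromℕ (length (f x)) + z) (length-concatMap f xs)))

  -- Each middle value is consumed by one use of `signed-above`: c grows while m shrinks, so c + m,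
  -- the point of the right arguments, stays fixed. The rows are produced from the bottom up, and
  -- after the last step the row reached must be `cs`, which is the empty row if d = 0.
  signed-count : ∀ {n} top (cs : Vec Bool n) c m (bs : Vec Bool n) →
    signed (Ψ n) (+ suc c) (holes 0 bs) (middles c m ++ rights (+ (c ℕ.+ m)) (marks 0 cs)) ≡
    fromℕ (length (trapezoids top cs m bs))
  signed-count {n} top cs c zero bs = trans
    (trans (cong (λ k → signed (Ψ n) (+ suc c) (holes 0 bs) (rights (+ k) (marks 0 cs))) (ℕ.+-identityʳ c))
           (signed-translate c bs cs))
    (trans (base-indicator bs cs) (length-if (bs == cs)))
    where
    length-if : ∀ b → indicator b ≡ fromℕ (length (if b then top ∷ [] else []))
    length-if true  = refl
    length-if false = refl
  signed-count {n} top cs c (suc m) bs = trans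
    (signed-above {n} (Ψ n) (Ψ-pascal n) (Ψ-degreeBelow n) (Ψ-exchange n) (+ suc c) bs
      (middles (suc c) m ++ rights (+ (c ℕ.+ suc m)) (marks 0 cs)) ℕ.≤-refl)
    (trans (Σ-cong (λ u → trans
      (cong (λ k → signed (Ψ n) (+ suc (suc c)) (holes 0 u) (middles (suc c) m ++ rights (+ k) (marks 0 cs))) (ℕ.+-suc c m))
      (trans (signed-count top cs (suc c) m u)
             (cong fromℕ (sym (L.length-map (_∷ʳ row bs) (trapezoids top cs m u)))))) (above bs))
    (sym (length-concatMap (λ u → map (_∷ʳ row bs) (trapezoids top cs m u)) (above bs))))

  -- Uniqueness of the coefficients

  difference : ℕ → ℤ → (ℤ → ℚ) → ℚ
  difference zero    x g = g x
  difference (suc e) x g = difference e (ℤ.suc x) g - difference e x g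

  difference-cong : ∀ e x {f g} → (∀ y → f y ≡ g y) → difference e x f ≡ difference e x g
  difference-cong zero    x f≡g = f≡g x
  difference-cong (suc e) x f≡g = cong₂ _-_ (difference-cong e (ℤ.suc x) f≡g) (difference-cong e x f≡g)

  difference-+ : ∀ e x f g → difference e x (λ y → f y + g y) ≡ difference e x f + difference e x g
  difference-+ zero    x f g = refl
  difference-+ (suc e) x f g = trans (cong₂ _-_ (difference-+ e (ℤ.suc x) f g) (difference-+ e x f g))
    (identity (difference e (ℤ.suc x) f) (difference e (ℤ.suc x) g) (difference e x f) (difference e x g))
    where
    identity : ∀ a b c d → (a + b) - (c + d) ≡ (a - c) + (b - d)
    identity = solve-∀ ring

  difference-scale : ∀ e x a f → difference e x (λ y → a * f y) ≡ a * difference e x f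
  difference-scale zero    x a f = refl
  difference-scale (suc e) x a f = trans (cong₂ _-_ (difference-scale e (ℤ.suc x) a f) (difference-scale e x a f))
    (identity a (difference e (ℤ.suc x) f) (difference e x f))
    where
    identity : ∀ a b c → a * b - a * c ≡ a * (b - c)
    identity = solve-∀ ring

  difference-zero : ∀ e x → difference e x (λ _ → 0ℚ) ≡ 0ℚ
  difference-zero zero    x = refl
  difference-zero (suc e) x = cong₂ _-_ (difference-zero e (ℤ.suc x)) (difference-zero e x)

  difference-Σ : ∀ {a} {A : Set a} e x (xs : List A) (f : A → ℤ → ℚ) →
    difference e x (λ y → Σ[ xs ] λ z → f z y) ≡ Σ[ xs ] λ z → difference e x (f z)
  difference-Σ e x []       f = difference-zero e x
  difference-Σ e x (z ∷ xs) f = trans (difference-+ e x (f z) (λ y → Σ[ xs ] λ z → f z y))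
    (cong (λ w → difference e x (f z) + w) (difference-Σ e x xs f))

  -- Pascal's rule says that each member of the family is the difference of the previous one. This
  -- serves both for the basis polynomials and for the places of a form.
  difference-pascal : ∀ (h : ℕ → ℤ → ℚ) → (∀ e x → h e (ℤ.suc x) ≡ h e x + h (suc e) x) →
    ∀ e x → difference e x (h 0) ≡ h e x
  difference-pascal h hp zero    x = refl
  difference-pascal h hp (suc e) x = trans
    (cong₂ _-_ (trans (difference-pascal h hp e (ℤ.suc x)) (hp e x)) (difference-pascal h hp e x))
    (identity (h e x) (h (suc e) x))
    where
    identity : ∀ a b → (a + b) - a ≡ b
    identity = solve-∀ ring

  difference-binom : ∀ j q e x →
    difference e x (λ y → binom (fromℤ y + q) j) ≡ coefficient j e (fromℤ x + q)
  difference-binom j q = difference-pascal (λ e x → coefficient j e (fromℤ x + q))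
    (λ e x → trans (cong (coefficient j e) (trans (cong (_+ q) (fromℤ-suc x)) (identity (fromℤ x) q)))
                   (coefficient-pascal j e (fromℤ x + q)))
    where
    identity : ∀ x q → (x + 1ℚ) + q ≡ (x + q) + 1ℚ
    identity = solve-∀ ring

  differences : ∀ {c} → Vec Argument c → (Vec ℤ c → ℚ) → ℚ
  differences []             f = f []
  differences ((e , x) ∷ as) f = difference e x λ y → differences as λ k → f (y ∷ k)

  differences-cong : ∀ {c} (as : Vec Argument c) {f g} → (∀ k → f k ≡ g k) → differences as f ≡ differences as g
  differences-cong []             f≡g = f≡g []
  differences-cong ((e , x) ∷ as) f≡g = difference-cong e x λ y → differences-cong as λ k → f≡g (y ∷ k)

  differences-scale : ∀ {c} (as : Vec Argument c) a f → differences as (λ k → a * f k) ≡ a * differences as f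
  differences-scale []             a f = refl
  differences-scale ((e , x) ∷ as) a f = trans
    (difference-cong e x λ y → differences-scale as a (λ k → f (y ∷ k)))
    (difference-scale e x a (λ y → differences as λ k → f (y ∷ k)))

  differences-Σ : ∀ {a} {A : Set a} {c} (as : Vec Argument c) (xs : List A) (f : A → Vec ℤ c → ℚ) →
    differences as (λ k → Σ[ xs ] λ z → f z k) ≡ Σ[ xs ] λ z → differences as (f z)
  differences-Σ []             xs f = refl
  differences-Σ ((e , x) ∷ as) xs f = trans
    (difference-cong e x λ y → differences-Σ as xs (λ z k → f z (y ∷ k)))
    (difference-Σ e x xs (λ z y → differences as λ k → f z (y ∷ k)))

  Π-allFin-suc : ∀ c (f : Fin (suc c) → ℚ) → Π[ L.allFin (suc c) ] f ≡ f F.zero * Π[ L.allFin c ] λ l → f (F.suc l)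
  Π-allFin-suc c f = cong (f F.zero *_) (trans
    (cong (λ ls → Π[ ls ] f) (sym (L.map-tabulate id F.suc))) (Π-map F.suc (L.allFin c) f))

  differences-Π : ∀ {c} (as : Vec Argument c) (g : Fin c → ℤ → ℚ) →
    differences as (λ k → Π[ L.allFin c ] λ l → g l (V.lookup k l)) ≡
    Π[ L.allFin c ] λ l → uncurry difference (V.lookup as l) (g l)
  differences-Π []             g = refl
  differences-Π {suc c} ((e , x) ∷ as) g = trans
    (difference-cong e x (λ y → trans
      (differences-cong as (λ k → Π-allFin-suc c (λ l → g l (V.lookup (y ∷ k) l))))
      (trans (differences-scale as (g F.zero y) (λ k → Π[ L.allFin c ] λ l → g (F.suc l) (V.lookup k l)))
      (trans (cong (g F.zero y *_) (differences-Π as (λ l → g (F.suc l))))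
             (ℚ.*-comm (g F.zero y) P)))))
    (trans (difference-scale e x P (g F.zero))
    (trans (ℚ.*-comm P (difference e x (g F.zero)))
           (sym (Π-allFin-suc c (λ l → uncurry difference (V.lookup ((e , x) ∷ as) l) (g l))))))
    where
    P : ℚ
    P = Π[ L.allFin c ] λ l → uncurry difference (V.lookup as l) (g (F.suc l))

  differences-form : ∀ {Φ c} (as : Vec Argument c) pre suf → Pascal Φ →
    differences as (λ k → Φ (pre ++ map at (V.toList k) ++ suf)) ≡ Φ (pre ++ V.toList as ++ suf)
  differences-form []             pre suf Φp = refl
  differences-form {Φ} ((e , x) ∷ as) pre suf Φp = trans
    (difference-cong e x (λ y → trans
      (differences-cong as (λ k → cong Φ (sym (L.++-assoc pre (at y ∷ []) (map at (V.toList k) ++ suf)))))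
      (trans (differences-form {Φ} as (pre ++ at y ∷ []) suf Φp)
             (cong Φ (L.++-assoc pre (at y ∷ []) (V.toList as ++ suf))))))
    (difference-pascal (λ e x → Φ (pre ++ (e , x) ∷ V.toList as ++ suf))
      (λ e x → Φp pre (e , x) (V.toList as ++ suf)) e x)

  -- The bases and the finite differences as dual systems

  Σ-zero : ∀ {a} {A : Set a} {f : A → ℚ} xs → All (λ x → f x ≡ 0ℚ) xs → Σ[ xs ] f ≡ 0ℚ
  Σ-zero []       []       = refl
  Σ-zero (x ∷ xs) (p ∷ ps) = cong₂ _+_ p (Σ-zero xs ps)

  Σ-single : ∀ {a} {A : Set a} {f : A → ℚ} {x₀ xs} → Unique xs → x₀ ∈ xs →
    (∀ x → x ≢ x₀ → f x ≡ 0ℚ) → Σ[ xs ] f ≡ f x₀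
  Σ-single {f = f} {x₀} {x ∷ xs} (x∉xs ∷ _) (here refl) f≡0 = trans
    (cong (λ z → f x + z) (Σ-zero xs (All.map (λ x≢y → f≡0 _ (λ y≡x → x≢y (sym y≡x))) x∉xs))) (ℚ.+-identityʳ (f x))
  Σ-single {f = f} {x₀} {x ∷ xs} (x∉xs ∷ xs!) (there x₀∈xs) f≡0 = trans
    (cong₂ _+_ (f≡0 x (All.lookup x∉xs x₀∈xs)) (Σ-single xs! x₀∈xs f≡0)) (ℚ.+-identityˡ (f x₀))

  tuples-unique : ∀ n c → Unique (tuples n c)
  tuples-unique n zero    = [] ∷ []
  tuples-unique n (suc c) = Unique.cartesianProductWith⁺ _∷_ V.∷-injective (Unique.allFin⁺ n) (tuples-unique n c)

  ∈-tuples : ∀ {n c} (s : Vec (Fin n) c) → s ∈ tuples n c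
  ∈-tuples []      = here refl
  ∈-tuples (x ∷ s) = ∈-cartesianProductWith⁺ _∷_ (∈-allFin x) (∈-tuples s)

  Π-one : ∀ {a} {A : Set a} {f : A → ℚ} xs → (∀ x → f x ≡ 1ℚ) → Π[ xs ] f ≡ 1ℚ
  Π-one []       f≡1 = refl
  Π-one (x ∷ xs) f≡1 = cong₂ _*_ (f≡1 x) (Π-one xs f≡1)

  Π-zero : ∀ {a} {A : Set a} {f : A → ℚ} {x₀ xs} → x₀ ∈ xs → f x₀ ≡ 0ℚ → Π[ xs ] f ≡ 0ℚ
  Π-zero {f = f} {x₀} {x ∷ xs} (here refl) f≡0 = trans (cong (_* Π[ xs ] f) f≡0) (ℚ.*-zeroˡ (Π[ xs ] f))
  Π-zero {f = f} {x₀} {x ∷ xs} (there x₀∈xs) f≡0 = trans (cong (f x *_) (Π-zero x₀∈xs f≡0)) (ℚ.*-zeroʳ (f x))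

  differ : ∀ {n c} (s t : Vec (Fin n) c) → s ≢ t → ∃ λ l → V.lookup s l ≢ V.lookup t l
  differ []      []      s≢t = ⊥-elim (s≢t refl)
  differ (x ∷ s) (y ∷ t) s≢t with x F.≟ y
  ... | no x≢y   = F.zero , x≢y
  ... | yes refl with differ s t (λ s≡t → s≢t (cong (x ∷_) s≡t))
  ...   | l , sₗ≢tₗ = F.suc l , sₗ≢tₗ

  binom-vanish : ∀ j → binom (fromℕ j) (suc j) ≡ 0ℚ
  binom-vanish j = identity (binom (fromℕ j) j) (fromℕ j) (reciprocal j)
    where
    identity : ∀ b x r → b * (x - x) * r ≡ 0ℚ
    identity = solve-∀ ring

  coefficient-diagonal : ∀ e q → coefficient e e q ≡ 1ℚ
  coefficient-diagonal zero    q = refl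
  coefficient-diagonal (suc e) q = coefficient-diagonal e q

  coefficient-+ : ∀ e j q → coefficient (e ℕ.+ j) e q ≡ binom q j
  coefficient-+ zero    j q = refl
  coefficient-+ (suc e) j q = coefficient-+ e j q

  -- The e-th difference of binom q e′ is binom q (e′ - e) if e ≤ e′ and 0 otherwise; for e < e′ it
  -- vanishes at q = 0.
  left-orthogonal : ∀ e′ e → e′ ≢ e → coefficient e′ e 0ℚ ≡ 0ℚ
  left-orthogonal e′ e e′≢e with ℕ.<-cmp e′ e
  ... | tri< e′<e _ _ = coefficient-below e′<e 0ℚ
  ... | tri≈ _ e′≡e _ = ⊥-elim (e′≢e e′≡e)
  ... | tri> _ _ e<e′ with ℕ.m≤n⇒∃[o]m+o≡n e<e′
  ...   | o , refl = trans (cong (λ k → coefficient k e 0ℚ) (sym (ℕ.+-suc e o)))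
                           (trans (coefficient-+ e (suc o) 0ℚ) (binom-zero o))

  -- Here binom q (e′ - e) is taken at q = e′ - e - 1, one less than its lower entry. This q arises
  -- because the point of the functional falls with e while the shift in the basis polynomial rises
  -- with e′.
  right-orthogonal : ∀ e′ e → e′ ≢ e → coefficient e′ e (fromℕ e′ - fromℕ e - 1ℚ) ≡ 0ℚ
  right-orthogonal e′ e e′≢e with ℕ.<-cmp e′ e
  ... | tri< e′<e _ _ = coefficient-below e′<e (fromℕ e′ - fromℕ e - 1ℚ)
  ... | tri≈ _ e′≡e _ = ⊥-elim (e′≢e e′≡e)
  ... | tri> _ _ e<e′ with ℕ.m≤n⇒∃[o]m+o≡n e<e′
  ...   | o , refl = trans (cong (λ k → coefficient k e (fromℕ (suc (e ℕ.+ o)) - fromℕ e - 1ℚ)) (sym (ℕ.+-suc e o)))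
      (trans (coefficient-+ e (suc o) (fromℕ (suc (e ℕ.+ o)) - fromℕ e - 1ℚ))
      (trans (cong (λ q → binom q (suc o)) (trans
         (cong (λ q → q - fromℕ e - 1ℚ) (trans (fromℤ-suc (+ (e ℕ.+ o))) (cong (_+ 1ℚ) (fromℕ-+ e o))))
         (identity (fromℕ e) (fromℕ o)))) (binom-vanish o)))
    where
    identity : ∀ a b → ((a + b) + 1ℚ) - a - 1ℚ ≡ b
    identity = solve-∀ ring

  lookup-∷ʳ-last : ∀ {a} {A : Set a} {c} (xs : Vec A c) x → V.lookup (xs V.∷ʳ x) (F.fromℕ c) ≡ x
  lookup-∷ʳ-last []       x = refl
  lookup-∷ʳ-last (_ ∷ xs) x = lookup-∷ʳ-last xs x

  lookup-∷ʳ-inject₁ : ∀ {a} {A : Set a} {c} (xs : Vec A c) x l → V.lookup (xs V.∷ʳ x) (F.inject₁ l) ≡ V.lookup xs l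
  lookup-∷ʳ-inject₁ (y ∷ xs) x F.zero    = refl
  lookup-∷ʳ-inject₁ (y ∷ xs) x (F.suc l) = lookup-∷ʳ-inject₁ xs x l

  lookup-reverse-opposite : ∀ {a} {A : Set a} {c} (xs : Vec A c) l → V.lookup (V.reverse xs) (opposite l) ≡ V.lookup xs l
  lookup-reverse-opposite {c = suc c} (x ∷ xs) F.zero = trans
    (cong (λ v → V.lookup v (F.fromℕ c)) (V.reverse-∷ x xs)) (lookup-∷ʳ-last (V.reverse xs) x)
  lookup-reverse-opposite (x ∷ xs) (F.suc l) = trans
    (cong (λ v → V.lookup v (F.inject₁ (opposite l))) (V.reverse-∷ x xs))
    (trans (lookup-∷ʳ-inject₁ (V.reverse xs) x (opposite l)) (lookup-reverse-opposite xs l))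

  lookup-reverse : ∀ {a} {A : Set a} {c} (xs : Vec A c) l → V.lookup (V.reverse xs) l ≡ V.lookup xs (opposite l)
  lookup-reverse xs l = trans (cong (V.lookup (V.reverse xs)) (sym (F.opposite-involutive l)))
    (lookup-reverse-opposite xs (opposite l))

  toList-cast : ∀ {a} {A : Set a} {m n} .(eq : m ≡ n) (xs : Vec A m) → V.toList (V.cast eq xs) ≡ V.toList xs
  toList-cast {n = zero}  eq []       = refl
  toList-cast {n = suc n} eq (x ∷ xs) = cong (x ∷_) (toList-cast (ℕ.suc-injective eq) xs)

  sgn-+ : ∀ a b → sgn (a ℕ.+ b) ≡ sgn a * sgn b
  sgn-+ zero    b = sym (ℚ.*-identityˡ (sgn b))
  sgn-+ (suc a) b = trans (cong -_ (sgn-+ a b)) (ℚ.neg-distribˡ-* (sgn a) (sgn b))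

  fromℤ-power : ∀ k → fromℤ (-1ℤ ℤ.^ k) ≡ sgn k
  fromℤ-power zero    = refl
  fromℤ-power (suc k) = trans (cong fromℤ (ℤ.-1*i≡-i (-1ℤ ℤ.^ k)))
    (trans (fromℤ-neg (-1ℤ ℤ.^ k)) (cong -_ (fromℤ-power k)))

  exponents : ∀ {n c} → Vec (Fin n) c → List ℕ
  exponents s = map toℕ (V.toList s)

  sign-signs : ∀ {n c} (s : Vec (Fin n) c) → sign s ≡ signs (exponents s)
  sign-signs {c = c} s = trans (fromℤ-power (V.sum (V.map val s) ℕ.+ c)) (go s)
    where
    go : ∀ {n c} (s : Vec (Fin n) c) → sgn (V.sum (V.map val s) ℕ.+ c) ≡ signs (exponents s)
    go []              = refl
    go {c = suc c} (a ∷ s) = trans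
      (trans (cong sgn (trans (cong suc (ℕ.+-assoc (toℕ a) (V.sum (V.map val s)) (suc c)))
               (cong (λ k → suc (toℕ a ℕ.+ k)) (ℕ.+-suc (V.sum (V.map val s)) c))))
             (cong -_ (sgn-+ (toℕ a) (suc (V.sum (V.map val s) ℕ.+ c)))))
      (trans (identity (sgn (toℕ a)) (sgn (V.sum (V.map val s) ℕ.+ c))) (cong (sgn (toℕ a) *_) (go s)))
      where
      identity : ∀ a b → - (a * (- b)) ≡ a * b
      identity = solve-∀ ring

  signs-square : ∀ l → signs l * signs l ≡ 1ℚ
  signs-square []      = refl
  signs-square (e ∷ l) = trans (identity (sgn e) (signs l)) (cong₂ _*_ (sgn-square e) (signs-square l))
    where
    identity : ∀ a b → (a * b) * (a * b) ≡ (a * a) * (b * b)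
    identity = solve-∀ ring

  -- `π` is the order in which coordinates enter the product: reversed on the left, direct on the
  -- right. `ρ` locates the zero factor belonging to a coordinate at which the tuples differ.
  Π-dual : ∀ {n c} (κ : Fin n → Fin n → ℚ) → (∀ a → κ a a ≡ 1ℚ) → (∀ a b → a ≢ b → κ a b ≡ 0ℚ) →
    (π ρ : Fin c → Fin c) → (∀ l → π (ρ l) ≡ l) → ∀ (s t : Vec (Fin n) c) →
    (s ≡ t → (Π[ L.allFin c ] λ l → κ (V.lookup s (π l)) (V.lookup t (π l))) ≡ 1ℚ) ×
    (s ≢ t → (Π[ L.allFin c ] λ l → κ (V.lookup s (π l)) (V.lookup t (π l))) ≡ 0ℚ)
  Π-dual {c = c} κ κ≡1 κ≡0 π ρ πρ s t =
    (λ { refl → Π-one (L.allFin c) (λ l → κ≡1 (V.lookup s (π l))) }) ,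
    (λ s≢t → let l , sₗ≢tₗ = differ s t s≢t in
      Π-zero (∈-allFin (ρ l)) (κ≡0 (V.lookup s (π (ρ l))) (V.lookup t (π (ρ l)))
        (subst (λ l → V.lookup s l ≢ V.lookup t l) (sym (πρ l)) sₗ≢tₗ)))

  module _ (n c d : ℕ) (c+d≤n : c ℕ.+ d ℕ.≤ n) where

    middleCount : ℕ
    middleCount = n ∸ (c ℕ.+ d)

    n≡c+m+d : (c ℕ.+ middleCount) ℕ.+ d ≡ n
    n≡c+m+d = trans (ℕ.+-assoc c middleCount d) (arguments-length c d c+d≤n)

    -- Reversed because `leftBasis` pairs the l-th variable with the entry of `s` at `opposite l`;
    -- `signed` lays out its exponents in the same order.
    leftArguments : Vec (Fin n) c → Vec Argument c
    leftArguments s = V.map (λ a → toℕ a , + suc c) (V.reverse s)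

    rightArguments : Vec (Fin n) d → Vec Argument d
    rightArguments i = V.map (λ a → toℕ a , + (c ℕ.+ middleCount) ℤ.- + toℕ a) i

    α-middles : ∀ (k : Vec ℤ c) (k′ : Vec ℤ d) → α n (arguments c+d≤n (V.map fromℤ k) (V.map fromℤ k′)) ≡
      Ψ n ((map at (V.toList k) ++ middles c middleCount) ++ map at (V.toList k′) ++ [])
    α-middles k k′ = trans (cong (α n) arguments≡) (trans (sym (Ψ-α n (V.cast (arguments-length c d c+d≤n) K)))
      (cong (Ψ n) list≡))
      where
      mid : Vec ℤ middleCount
      mid = V.tabulate (λ j → + (c ℕ.+ val j))
      K : Vec ℤ (c ℕ.+ (middleCount ℕ.+ d))
      K = k V.++ (mid V.++ k′)
      arguments≡ : arguments c+d≤n (V.map fromℤ k) (V.map fromℤ k′) ≡ V.map fromℤ (V.cast (arguments-length c d c+d≤n) K)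
      arguments≡ = sym (trans (V.map-cast fromℤ (arguments-length c d c+d≤n) K)
        (cong (V.cast (arguments-length c d c+d≤n)) (trans (V.map-++ fromℤ k (mid V.++ k′))
          (cong (V.map fromℤ k V.++_) (trans (V.map-++ fromℤ mid k′)
            (cong (V._++ V.map fromℤ k′) (sym (V.tabulate-∘ fromℤ (λ j → + (c ℕ.+ val j))))))))))
      tabulate-middles : ∀ c m → map at (V.toList (V.tabulate {n = m} (λ j → + (c ℕ.+ val j)))) ≡ middles c m
      tabulate-middles c zero    = refl
      tabulate-middles c (suc m) = cong₂ _∷_
        (cong (λ k → at (+ k)) (trans (ℕ.+-suc c 0) (cong suc (ℕ.+-identityʳ c))))
        (trans (cong (λ v → map at (V.toList v)) (V.tabulate-cong (λ j → cong +_ (ℕ.+-suc c (val j)))))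
               (tabulate-middles (suc c) m))
      list≡ : map at (V.toList (V.cast (arguments-length c d c+d≤n) K)) ≡
              (map at (V.toList k) ++ middles c middleCount) ++ map at (V.toList k′) ++ []
      list≡ = trans (cong (map at) (trans (toList-cast (arguments-length c d c+d≤n) K)
          (trans (V.toList-++ k (mid V.++ k′)) (cong (V.toList k ++_) (V.toList-++ mid k′)))))
        (trans (L.map-++ at (V.toList k) (V.toList mid ++ V.toList k′))
        (trans (cong (map at (V.toList k) ++_) (trans (L.map-++ at (V.toList mid) (V.toList k′))
                 (cong₂ _++_ (tabulate-middles c middleCount) (sym (L.++-identityʳ (map at (V.toList k′)))))))
               (sym (L.++-assoc (map at (V.toList k)) (middles c middleCount) (map at (V.toList k′) ++ [])))))

    left-dual : ∀ (s t : Vec (Fin n) c) →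
      differences (leftArguments t) (λ k → leftBasis s (V.map fromℤ k)) ≡
      Π[ L.allFin c ] λ l → coefficient (toℕ (V.lookup s (opposite l))) (toℕ (V.lookup t (opposite l))) 0ℚ
    left-dual s t = trans
      (differences-cong (leftArguments t) (λ k → cong (L.foldr _*_ 1ℚ) (L.map-cong
        (λ l → cong (λ y → binom y (toℕ (V.lookup s (opposite l))))
          (trans (cong (λ y → y - fromℕ c - 1ℚ) (V.lookup-map l fromℤ k)) (regroup (fromℤ (V.lookup k l)) (fromℕ c)))) (L.allFin c))))
      (trans (differences-Π (leftArguments t) (λ l y → binom (fromℤ y + (- fromℕ c - 1ℚ)) (toℕ (V.lookup s (opposite l)))))
             (cong (L.foldr _*_ 1ℚ) (L.map-cong (λ l → trans
               (cong (λ u → uncurry difference u (λ y → binom (fromℤ y + (- fromℕ c - 1ℚ)) (toℕ (V.lookup s (opposite l)))))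
                 (trans (V.lookup-map l _ (V.reverse t)) (cong (λ a → toℕ a , + suc c) (lookup-reverse t l))))
               (trans (difference-binom (toℕ (V.lookup s (opposite l))) (- fromℕ c - 1ℚ) (toℕ (V.lookup t (opposite l))) (+ suc c))
                      (cong (coefficient (toℕ (V.lookup s (opposite l))) (toℕ (V.lookup t (opposite l))))
                        (trans (cong (λ x → x + (- fromℕ c - 1ℚ)) (fromℤ-suc (+ c))) (cancel (fromℕ c)))))) (L.allFin c))))
      where
      regroup : ∀ y c → y - c - 1ℚ ≡ y + (- c - 1ℚ)
      regroup = solve-∀ ring
      cancel : ∀ c → (c + 1ℚ) + (- c - 1ℚ) ≡ 0ℚ
      cancel = solve-∀ ring

    right-dual : ∀ (i j : Vec (Fin n) d) →
      differences (rightArguments j) (λ k → rightBasis i (V.map fromℤ k)) ≡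
      Π[ L.allFin d ] λ l → coefficient (toℕ (V.lookup i l)) (toℕ (V.lookup j l))
        (fromℕ (toℕ (V.lookup i l)) - fromℕ (toℕ (V.lookup j l)) - 1ℚ)
    right-dual i j = trans
      (differences-cong (rightArguments j) (λ k → cong (L.foldr _*_ 1ℚ) (L.map-cong
        (λ l → cong (λ y → binom y (toℕ (V.lookup i l)))
          (trans (cong (λ y → y - fromℕ n + fromℕ d - fromℕ 2 + fromℕ (val (V.lookup i l))) (V.lookup-map l fromℤ k))
                 (regroup (fromℤ (V.lookup k l)) (fromℕ n) (fromℕ d) (fromℕ 2) (fromℕ (val (V.lookup i l)))))) (L.allFin d))))
      (trans (differences-Π (rightArguments j) (λ l y → binom (fromℤ y + q l) (toℕ (V.lookup i l))))
             (cong (L.foldr _*_ 1ℚ) (L.map-cong (λ l → trans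
               (cong (λ u → uncurry difference u (λ y → binom (fromℤ y + q l) (toℕ (V.lookup i l)))) (V.lookup-map l _ j))
               (trans (difference-binom (toℕ (V.lookup i l)) (q l) (toℕ (V.lookup j l)) (+ (c ℕ.+ middleCount) ℤ.- + toℕ (V.lookup j l)))
                      (cong (coefficient (toℕ (V.lookup i l)) (toℕ (V.lookup j l))) (point l)))) (L.allFin d))))
      where
      q : Fin d → ℚ
      q l = - fromℕ n + fromℕ d - fromℕ 2 + fromℕ (val (V.lookup i l))
      regroup : ∀ y n d t v → y - n + d - t + v ≡ y + (- n + d - t + v)
      regroup = solve-∀ ring
      cancel : ∀ x t d t′ → (x + - t) + (- (x + d) + d - (1ℚ + 1ℚ) + (t′ + 1ℚ)) ≡ t′ - t - 1ℚ
      cancel = solve-∀ ring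
      point : ∀ l → fromℤ (+ (c ℕ.+ middleCount) ℤ.- + toℕ (V.lookup j l)) + q l ≡
                    fromℕ (toℕ (V.lookup i l)) - fromℕ (toℕ (V.lookup j l)) - 1ℚ
      point l = trans
        (cong₂ _+_ (trans (fromℤ-+ (+ (c ℕ.+ middleCount)) (ℤ.- + toℕ (V.lookup j l)))
                          (cong (λ z → fromℕ (c ℕ.+ middleCount) + z) (fromℤ-neg (+ toℕ (V.lookup j l)))))
                   (cong₂ (λ x y → - x + fromℕ d - (1ℚ + 1ℚ) + y)
                     (trans (cong fromℕ (sym n≡c+m+d)) (fromℕ-+ (c ℕ.+ middleCount) d)) (fromℤ-suc (+ toℕ (V.lookup i l)))))
        (cancel (fromℕ (c ℕ.+ middleCount)) (fromℕ (toℕ (V.lookup j l))) (fromℕ d) (fromℕ (toℕ (V.lookup i l))))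

    left-orthonormal : ∀ (s t : Vec (Fin n) c) → let D = differences (leftArguments t) (λ k → leftBasis s (V.map fromℤ k)) in
      (s ≡ t → D ≡ 1ℚ) × (s ≢ t → D ≡ 0ℚ)
    left-orthonormal s t =
      let one , none = Π-dual (λ a b → coefficient (toℕ a) (toℕ b) 0ℚ) (λ a → coefficient-diagonal (toℕ a) 0ℚ)
                         (λ a b a≢b → left-orthogonal (toℕ a) (toℕ b) (λ p → a≢b (F.toℕ-injective p)))
                         opposite opposite F.opposite-involutive s t
      in (λ p → trans (left-dual s t) (one p)) , (λ p → trans (left-dual s t) (none p))

    right-orthonormal : ∀ (i j : Vec (Fin n) d) → let D = differences (rightArguments j) (λ k → rightBasis i (V.map fromℤ k)) in
      (i ≡ j → D ≡ 1ℚ) × (i ≢ j → D ≡ 0ℚ)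
    right-orthonormal i j =
      let one , none = Π-dual (λ a b → coefficient (toℕ a) (toℕ b) (fromℕ (toℕ a) - fromℕ (toℕ b) - 1ℚ))
                         (λ a → coefficient-diagonal (toℕ a) (fromℕ (toℕ a) - fromℕ (toℕ a) - 1ℚ))
                         (λ a b a≢b → right-orthogonal (toℕ a) (toℕ b) (λ p → a≢b (F.toℕ-injective p)))
                         (λ l → l) (λ l → l) (λ _ → refl) i j
      in (λ p → trans (right-dual i j) (one p)) , (λ p → trans (right-dual i j) (none p))

    -- Both bases are dual to finite differences at suitable integer points.
    coefficient-value : ∀ A → IsCoefficients n c d c+d≤n A → ∀ s i →
      A s i ≡ signed (Ψ n) (+ suc c) (exponents s) (middles c middleCount ++ rights (+ (c ℕ.+ middleCount)) (exponents i))
    coefficient-value A coefficients s i = trans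
      -- The sign in the defining identity is its own inverse and equals the one built into
      -- `signed`.
      (trans (sym (ℚ.*-identityʳ (A s i))) (trans (cong (A s i *_) (sym (signs-square (exponents s)))) (regroup (A s i) (signs (exponents s)))))
      (trans (cong (signs (exponents s) *_) (trans (cong (A s i *_) (sym (sign-signs s))) (trans (sym right-side) left-side)))
             (sym (signed-ʳ++ (Ψ n) (+ suc c) (exponents s) (middles c middleCount ++ rights (+ (c ℕ.+ middleCount)) (exponents i)))))
      where
      regroup : ∀ a b → a * (b * b) ≡ b * (a * b)
      regroup = solve-∀ ring
      la = leftArguments s
      ra = rightArguments i
      -- Applied to both sides of the defining identity: on `α` it replaces points by the arguments
      -- of `s` and `i`, on the expansion it selects one coefficient.
      D : (Vec ℤ c → Vec ℤ d → ℚ) → ℚ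
      D f = differences la λ k → differences ra λ k′ → f k k′
      left-list : V.toList la ++ middles c middleCount ++ V.toList ra ++ [] ≡
                  lefts (+ suc c) (exponents s) ʳ++ (middles c middleCount ++ rights (+ (c ℕ.+ middleCount)) (exponents i))
      left-list = trans
        (cong₂ (λ x y → x ++ middles c middleCount ++ y)
          (trans (V.toList-map (λ a → toℕ a , + suc c) (V.reverse s))
          (trans (cong (map (λ a → toℕ a , + suc c)) (V.toList-reverse s))
          (trans (L.reverse-map (λ a → toℕ a , + suc c) (V.toList s)) (cong L.reverse (L.map-∘ (V.toList s))))))
          (trans (L.++-identityʳ (V.toList ra)) (trans (V.toList-map (λ a → toℕ a , + (c ℕ.+ middleCount) ℤ.- + toℕ a) i) (L.map-∘ (V.toList i)))))
        (sym (L.ʳ++-defn (lefts (+ suc c) (exponents s))))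
      left-side : D (λ k k′ → α n (arguments c+d≤n (V.map fromℤ k) (V.map fromℤ k′))) ≡
                  Ψ n (lefts (+ suc c) (exponents s) ʳ++ (middles c middleCount ++ rights (+ (c ℕ.+ middleCount)) (exponents i)))
      left-side = trans
        (differences-cong la (λ k → trans (differences-cong ra (α-middles k))
          (trans (differences-form {Ψ n} ra (map at (V.toList k) ++ middles c middleCount) [] (Ψ-pascal n))
                 (cong (Ψ n) (L.++-assoc (map at (V.toList k)) (middles c middleCount) (V.toList ra ++ []))))))
        (trans (differences-form {Ψ n} la [] (middles c middleCount ++ V.toList ra ++ []) (Ψ-pascal n)) (cong (Ψ n) left-list))
      DL : Vec (Fin n) c → ℚ
      DL s′ = differences la λ k → leftBasis s′ (V.map fromℤ k)
      DR : Vec (Fin n) d → ℚ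
      DR i′ = differences ra λ k′ → rightBasis i′ (V.map fromℤ k′)
      term : Vec (Fin n) c → Vec (Fin n) d → ℚ
      term s′ i′ = (A s′ i′ * sign s′ * DR i′) * DL s′
      expand : D (λ k k′ → α n (arguments c+d≤n (V.map fromℤ k) (V.map fromℤ k′))) ≡
               Σ[ tuples n c ] λ s′ → Σ[ tuples n d ] λ i′ → term s′ i′
      expand = trans
        (differences-cong la (λ k → trans
          (differences-cong ra (λ k′ → coefficients (V.map fromℤ k) (V.map fromℤ k′)))
          (trans (differences-Σ ra (tuples n c) (λ s′ k′ → Σ[ tuples n d ] λ i′ →
                   A s′ i′ * sign s′ * leftBasis s′ (V.map fromℤ k) * rightBasis i′ (V.map fromℤ k′)))
          (Σ-cong (λ s′ → trans
            (differences-Σ ra (tuples n d) (λ i′ k′ → A s′ i′ * sign s′ * leftBasis s′ (V.map fromℤ k) * rightBasis i′ (V.map fromℤ k′)))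
            (Σ-cong (λ i′ → trans
              (differences-scale ra (A s′ i′ * sign s′ * leftBasis s′ (V.map fromℤ k)) (λ k′ → rightBasis i′ (V.map fromℤ k′)))
              (swap (A s′ i′ * sign s′) (leftBasis s′ (V.map fromℤ k)) (DR i′))) (tuples n d))) (tuples n c)))))
        (trans (differences-Σ la (tuples n c) (λ s′ k → Σ[ tuples n d ] λ i′ → (A s′ i′ * sign s′ * DR i′) * leftBasis s′ (V.map fromℤ k)))
        (Σ-cong (λ s′ → trans
          (differences-Σ la (tuples n d) (λ i′ k → (A s′ i′ * sign s′ * DR i′) * leftBasis s′ (V.map fromℤ k)))
          (Σ-cong (λ i′ → differences-scale la (A s′ i′ * sign s′ * DR i′) (λ k → leftBasis s′ (V.map fromℤ k))) (tuples n d))) (tuples n c)))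
        where
        swap : ∀ a b c → a * b * c ≡ (a * c) * b
        swap = solve-∀ ring
      right-side : D (λ k k′ → α n (arguments c+d≤n (V.map fromℤ k) (V.map fromℤ k′))) ≡ A s i * sign s
      right-side = trans expand (trans
        (Σ-single (tuples-unique n c) (∈-tuples s) (λ s′ s′≢s → Σ-zero (tuples n d) (All.universal
          (λ i′ → trans (cong (λ z → A s′ i′ * sign s′ * DR i′ * z) (proj₂ (left-orthonormal s′ s) s′≢s))
                        (ℚ.*-zeroʳ (A s′ i′ * sign s′ * DR i′))) (tuples n d))))
        (trans (Σ-single (tuples-unique n d) (∈-tuples i) (λ i′ i′≢i →
                 trans (cong (λ z → A s i′ * sign s * z * DL s) (proj₂ (right-orthonormal i′ i) i′≢i))
                       (vanish (A s i′ * sign s) (DL s))))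
               (trans (cong₂ (λ x y → A s i * sign s * x * y) (proj₁ (right-orthonormal i i) refl) (proj₁ (left-orthonormal s s) refl))
                      (unit (A s i * sign s)))))
        where
        vanish : ∀ a b → a * 0ℚ * b ≡ 0ℚ
        vanish = solve-∀ ring
        unit : ∀ a → a * 1ℚ * 1ℚ ≡ a
        unit = solve-∀ ring

-- Monotone triangles and trapezoids

lookup-injective : ∀ {a} {A : Set a} {xs : List A} → Unique xs → ∀ i j → L.lookup xs i ≡ L.lookup xs j → i ≡ j
lookup-injective {xs = x ∷ xs} (x∉xs ∷ xs!) F.zero    F.zero    _ = refl
lookup-injective {xs = x ∷ xs} (x∉xs ∷ xs!) F.zero    (F.suc j) p = ⊥-elim (All.lookup x∉xs (∈-lookup j) p)
lookup-injective {xs = x ∷ xs} (x∉xs ∷ xs!) (F.suc i) F.zero    p = ⊥-elim (All.lookup x∉xs (∈-lookup i) (sym p))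
lookup-injective {xs = x ∷ xs} (x∉xs ∷ xs!) (F.suc i) (F.suc j) p = cong F.suc (lookup-injective xs! i j p)

-- The proof inside a refinement is irrelevant, so a position in the list cannot be read off from
-- it; membership is recomputed by decision. As the list has no repetitions, the position found is
-- the only one.
refinement↔Fin : ∀ {A : Set} {P : A → Set} → DecidableEquality A → (xs : List A) → Unique xs →
  (∀ {x} → P x → x ∈ xs) → (∀ {x} → x ∈ xs → P x) → [ x ∈ A ∣ P x ] ↔ Fin (length xs)
refinement↔Fin {A} {P} _≟_ xs xs! complete sound = mk↔ₛ′ to from to-from from-to
  where
  open ListDecMembership _≟_ using (_∈?_)
  member : (x : A) → .(P x) → x ∈ xs
  member x p = recompute (x ∈? xs) (complete p)
  to : [ x ∈ A ∣ P x ] → Fin (length xs)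
  to (x , [ p ]) = Any.index (member x p)
  from : Fin (length xs) → [ x ∈ A ∣ P x ]
  from k = L.lookup xs k , [ sound (∈-lookup k) ]
  to-from : ∀ k → to (from k) ≡ k
  to-from k = lookup-injective xs! _ k (sym (Any.lookup-index (member (L.lookup xs k) (sound (∈-lookup k)))))
  from-to : ∀ r → from (to r) ≡ r
  from-to (x , [ p ]) = value-injective (sym (Any.lookup-index (member x p)))

Unique-concatMap : ∀ {A B : Set} {f : A → List B} {xs} → Unique xs → (∀ x → Unique (f x)) →
  (∀ {x y z} → z ∈ f x → z ∈ f y → x ≡ y) → Unique (L.concatMap f xs)
Unique-concatMap [] f! f-inj = []
Unique-concatMap {f = f} {x ∷ xs} (x∉xs ∷ xs!) f! f-inj = Unique.++⁺ (f! x) (Unique-concatMap xs! f! f-inj)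
  λ { (z∈fx , z∈rest) → let ys , z∈ys , ys∈ = ∈-concat⁻′ (map f xs) z∈rest
                            y , y∈xs , ys≡fy = ∈-map⁻ f ys∈
                        in All.lookup x∉xs y∈xs (f-inj z∈fx (subst (_ ∈_) ys≡fy z∈ys)) }

module _ {n : ℕ} where

  sorted-ext : ∀ {xs ys : List (Fin n)} → AllPairs F._<_ xs → AllPairs F._<_ ys →
    (∀ {z} → z ∈ xs → z ∈ ys) → (∀ {z} → z ∈ ys → z ∈ xs) → xs ≡ ys
  sorted-ext {[]}     {[]}     _ _ _ _ = refl
  sorted-ext {[]}     {y ∷ ys} _ _ _ ⊇ with () ← ⊇ (here refl)
  sorted-ext {x ∷ xs} {[]}     _ _ ⊆ _ with () ← ⊆ (here refl)
  sorted-ext {x ∷ xs} {y ∷ ys} (x<xs ∷ xs↗) (y<ys ∷ ys↗) ⊆ ⊇ =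
    cong₂ _∷_ x≡y (sorted-ext xs↗ ys↗ ⊆′ ⊇′)
    where
    x≡y : x ≡ y
    x≡y with ⊆ (here refl) | ⊇ (here refl)
    ... | here x≡y   | _          = x≡y
    ... | there _    | here y≡x   = sym y≡x
    ... | there x∈ys | there y∈xs = ⊥-elim (F.<-asym (All.lookup y<ys x∈ys) (All.lookup x<xs y∈xs))
    ⊆′ : ∀ {z} → z ∈ xs → z ∈ ys
    ⊆′ z∈xs with ⊆ (there z∈xs)
    ... | here z≡y   = ⊥-elim (F.<-irrefl (trans x≡y (sym z≡y)) (All.lookup x<xs z∈xs))
    ... | there z∈ys = z∈ys
    ⊇′ : ∀ {z} → z ∈ ys → z ∈ xs
    ⊇′ z∈ys with ⊇ (there z∈ys)
    ... | here z≡x   = ⊥-elim (F.<-irrefl (trans (sym x≡y) (sym z≡x)) (All.lookup y<ys z∈ys))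
    ... | there z∈xs = z∈xs

  strictly-sorted : ∀ {c} {s : Vec (Fin n) c} → StrictlyIncreasing s → AllPairs F._<_ (V.toList s)
  strictly-sorted VL.[]  = []
  strictly-sorted VL.[-] = [] ∷ []
  strictly-sorted {s = x ∷ y ∷ s} (x<y VL.∷ ys↗) with strictly-sorted ys↗
  ... | y<s ∷ s↗ = (x<y ∷ All.map (F.<-trans x<y) y<s) ∷ y<s ∷ s↗

  open DecMembership (F._≟_ {n}) using (_∈?_)

  filter-members : ∀ {c} {s : Vec (Fin n) c} → StrictlyIncreasing s → L.filter (_∈? s) (L.allFin n) ≡ V.toList s
  filter-members {s = s} s↗ = sorted-ext
    (AllPairs.filter⁺ (_∈? s) (AllPairs.tabulate⁺-< (λ i<j → i<j))) (strictly-sorted s↗)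
    (λ z∈ → V.∈-toList⁺ (proj₂ (∈-filter⁻ (_∈? s) {xs = L.allFin n} z∈)))
    (λ z∈ → ∈-filter⁺ (_∈? s) (∈-allFin _) (V.∈-toList⁻ z∈))

  members nonmembers : ∀ {c} → Vec (Fin n) c → Vec Bool n
  members    s = V.tabulate (λ x → does (x ∈? s))
  nonmembers s = V.tabulate (λ x → does (¬? (x ∈? s)))

marks-filter : ∀ {n} {P : Fin n → Set} (P? : Decidable P) t →
  marks t (V.tabulate (λ x → does (P? x))) ≡ map (λ x → t ℕ.+ toℕ x) (L.filter P? (L.allFin n))
marks-filter {zero}  P? t = refl
marks-filter {suc n} {P} P? t = head-case (does (P? F.zero)) refl
  where
  filter-suc : ∀ xs → map (λ x → t ℕ.+ toℕ x) (L.filter P? (map F.suc xs)) ≡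
                      map (λ x → suc t ℕ.+ toℕ x) (L.filter (P? ∘ F.suc) xs)
  filter-suc []       = refl
  filter-suc (x ∷ xs) with does (P? (F.suc x))
  ... | true  = cong₂ _∷_ (ℕ.+-suc t (toℕ x)) (filter-suc xs)
  ... | false = filter-suc xs
  rest : marks (suc t) (V.tabulate (λ x → does (P? (F.suc x)))) ≡
         map (λ x → t ℕ.+ toℕ x) (L.filter P? (L.tabulate F.suc))
  rest = trans (marks-filter (P? ∘ F.suc) (suc t))
    (trans (sym (filter-suc (L.allFin n))) (cong (λ xs → map (λ x → t ℕ.+ toℕ x) (L.filter P? xs)) (L.map-tabulate (λ x → x) F.suc)))
  head-case : ∀ b → does (P? F.zero) ≡ b → marks t (V.tabulate (λ x → does (P? x))) ≡
    map (λ x → t ℕ.+ toℕ x) (L.filter P? (L.allFin (suc n)))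
  head-case b eq with does (P? F.zero)
  ... | true  = cong₂ _∷_ (sym (ℕ.+-identityʳ t)) rest
  ... | false = rest

holes-not : ∀ {n} t (bs : Vec Bool n) → holes t (V.map not bs) ≡ marks t bs
holes-not t []           = refl
holes-not t (true  ∷ bs) = cong (t ∷_) (holes-not (suc t) bs)
holes-not t (false ∷ bs) = holes-not (suc t) bs

marks-members : ∀ {n c} {s : Vec (Fin n) c} → StrictlyIncreasing s → ∀ t →
  marks t (members s) ≡ map (λ x → t ℕ.+ toℕ x) (V.toList s)
marks-members {n} {s = s} s↗ t = trans (marks-filter (_∈? s) t)
  (cong (map (λ x → t ℕ.+ toℕ x)) (filter-members s↗))
  where open DecMembership (F._≟_ {n}) using (_∈?_)

holes-nonmembers : ∀ {n c} {s : Vec (Fin n) c} → StrictlyIncreasing s → holes 0 (nonmembers s) ≡ exponents s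
holes-nonmembers {n} {s = s} s↗ = trans (cong (holes 0) (V.tabulate-∘ not (λ x → does (x ∈? s))))
  (trans (holes-not 0 (members s)) (marks-members s↗ 0))
  where open DecMembership (F._≟_ {n}) using (_∈?_)

row-nonmembers : ∀ {n c} (s : Vec (Fin n) c) → row (nonmembers s) ≡ map (λ x → + val x) (complement s)
row-nonmembers {n} s = trans (cong (map +_) (marks-filter (λ x → ¬? (x ∈? s)) 1)) (sym (L.map-∘ (complement s)))
  where open DecMembership (F._≟_ {n}) using (_∈?_)

row-members : ∀ {n d} {i : Vec (Fin n) d} → StrictlyIncreasing i → row (members i) ≡ map (λ x → + val x) (V.toList i)
row-members {i = i} i↗ = trans (cong (map +_) (marks-members i↗ 1)) (sym (L.map-∘ (V.toList i)))

==⇒≡ : ∀ {n} {as bs : Vec Bool n} → (as == bs) ≡ true → as ≡ bs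
==⇒≡ {as = []}         {[]}         _ = refl
==⇒≡ {as = true  ∷ as} {true  ∷ bs} p = cong (true ∷_) (==⇒≡ p)
==⇒≡ {as = false ∷ as} {false ∷ bs} p = cong (false ∷_) (==⇒≡ p)

==-refl : ∀ {n} (bs : Vec Bool n) → (bs == bs) ≡ true
==-refl []           = refl
==-refl (true  ∷ bs) = ==-refl bs
==-refl (false ∷ bs) = ==-refl bs

-- Interlacing rows and their characteristic vectors

rowFrom : ∀ {n} → ℕ → Vec Bool n → List ℤ
rowFrom t bs = map +_ (marks t bs)

rowFrom-≥ : ∀ {n} t (bs : Vec Bool n) → All (λ z → + t ℤ.≤ z) (rowFrom t bs)
rowFrom-≥ t []           = []
rowFrom-≥ t (true  ∷ bs) = ℤ.≤-refl ∷ All.map (ℤ.≤-trans (+≤+ (ℕ.n≤1+n t))) (rowFrom-≥ (suc t) bs)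
rowFrom-≥ t (false ∷ bs) = All.map (ℤ.≤-trans (+≤+ (ℕ.n≤1+n t))) (rowFrom-≥ (suc t) bs)

rowFrom-increasing : ∀ {n} t (bs : Vec Bool n) → Linked ℤ._<_ (rowFrom t bs)
rowFrom-increasing t []           = []
rowFrom-increasing t (true  ∷ bs) = prepend (rowFrom-≥ (suc t) bs) (rowFrom-increasing (suc t) bs)
  where
  prepend : ∀ {l} → All (λ z → + suc t ℤ.≤ z) l → Linked ℤ._<_ l → Linked ℤ._<_ (+ t ∷ l)
  prepend []        []  = [-]
  prepend (p ∷ _)   l↗  = ℤ.<-≤-trans (+<+ (ℕ.n<1+n t)) p ∷ l↗
rowFrom-increasing t (false ∷ bs) = rowFrom-increasing (suc t) bs

rowFrom-injective : ∀ {n} t (as bs : Vec Bool n) → rowFrom t as ≡ rowFrom t bs → as ≡ bs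
rowFrom-injective t []           []           _ = refl
rowFrom-injective t (true  ∷ as) (true  ∷ bs) p = cong (true ∷_) (rowFrom-injective (suc t) as bs (L.∷-injectiveʳ p))
rowFrom-injective t (false ∷ as) (false ∷ bs) p = cong (false ∷_) (rowFrom-injective (suc t) as bs p)
rowFrom-injective t (true  ∷ as) (false ∷ bs) p with rowFrom (suc t) bs | rowFrom-≥ (suc t) bs
rowFrom-injective t (true  ∷ as) (false ∷ bs) refl | _ | +≤+ 1+t≤t ∷ _ = ⊥-elim (ℕ.1+n≰n 1+t≤t)
rowFrom-injective t (false ∷ as) (true  ∷ bs) p with rowFrom (suc t) as | rowFrom-≥ (suc t) as
rowFrom-injective t (false ∷ as) (true  ∷ bs) refl | _ | +≤+ 1+t≤t ∷ _ = ⊥-elim (ℕ.1+n≰n 1+t≤t)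

infix 4 _⊰_

-- The inductive form of `Interlaces`. It forces the lower row to be longer by one, whereas
-- `Interlaces` also relates two empty rows; for a nonempty lower row the two coincide.
data _⊰_ : List ℤ → List ℤ → Set where
  one  : ∀ {a} → [] ⊰ a ∷ []
  more : ∀ {a b r rs bs} → a ℤ.≤ r → r ℤ.≤ b → rs ⊰ b ∷ bs → r ∷ rs ⊰ a ∷ b ∷ bs

⊰-length : ∀ {r l} → r ⊰ l → length l ≡ suc (length r)
⊰-length one          = refl
⊰-length (more _ _ p) = cong suc (⊰-length p)

interlaces⇒⊰ : ∀ {r a l} → Interlaces r (a ∷ l) → r ⊰ a ∷ l
interlaces⇒⊰ {[]}     ([] , [])               = one
interlaces⇒⊰ {r ∷ rs} (a≤r ∷ ps , r≤b ∷ qs)   = more a≤r r≤b (interlaces⇒⊰ (ps , qs))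

⊰⇒interlaces : ∀ {r l} → r ⊰ l → Interlaces r l
⊰⇒interlaces one = [] , []
⊰⇒interlaces (more a≤r r≤b p) = let ps , qs = ⊰⇒interlaces p in a≤r ∷ ps , r≤b ∷ qs

⊰-prepend : ∀ {a x r l} → a ℤ.≤ x → All (x ℤ.≤_) l → r ⊰ l → x ∷ r ⊰ a ∷ l
⊰-prepend a≤x (x≤b ∷ _) one               = more a≤x x≤b one
⊰-prepend a≤x (x≤b ∷ _) (more a≤r r≤b p)  = more a≤x x≤b (more a≤r r≤b p)

rowFrom-≥′ : ∀ {n} t (bs : Vec Bool n) → All (λ z → + t ℤ.≤ z) (rowFrom (suc t) bs)
rowFrom-≥′ t bs = All.map (ℤ.≤-trans (+≤+ (ℕ.n≤1+n t))) (rowFrom-≥ (suc t) bs)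

above-sound : ∀ {n} t (bs : Vec Bool n) {u} → u ∈ above bs → rowFrom t u ⊰ rowFrom t bs
-- Here `a` is the entry by which the lower row is ahead; the next entry of the upper row must be at
-- least `a`.
above-sound′ : ∀ {n} t (bs : Vec Bool n) {u a} → a ℤ.≤ + t → u ∈ above′ bs → rowFrom t u ⊰ a ∷ rowFrom t bs
above-sound t (true ∷ bs) u∈ with ∈-++⁻ (map (true ∷_) (above bs)) u∈
... | inj₁ u∈₁ with ∈-map⁻ (true ∷_) u∈₁
...   | u′ , u′∈ , refl = ⊰-prepend ℤ.≤-refl (rowFrom-≥′ t bs) (above-sound (suc t) bs u′∈)
above-sound t (true ∷ bs) u∈ | inj₂ u∈₂ with ∈-map⁻ (false ∷_) u∈₂
...   | u′ , u′∈ , refl = above-sound′ (suc t) bs (+≤+ (ℕ.n≤1+n t)) u′∈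
above-sound t (false ∷ bs) u∈ with ∈-map⁻ (false ∷_) u∈
... | u′ , u′∈ , refl = above-sound (suc t) bs u′∈
above-sound′ t [] a≤t (here refl) = one
above-sound′ t (true ∷ bs) a≤t u∈ with ∈-map⁻ (true ∷_) u∈
... | u′ , u′∈ , refl = more a≤t ℤ.≤-refl (above-sound′ (suc t) bs (+≤+ (ℕ.n≤1+n t)) u′∈)
above-sound′ t (false ∷ bs) a≤t u∈ with ∈-++⁻ (map (true ∷_) (above bs)) u∈
... | inj₁ u∈₁ with ∈-map⁻ (true ∷_) u∈₁
...   | u′ , u′∈ , refl = ⊰-prepend a≤t (rowFrom-≥′ t bs) (above-sound (suc t) bs u′∈)
above-sound′ t (false ∷ bs) a≤t u∈ | inj₂ u∈₂ with ∈-map⁻ (false ∷_) u∈₂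
...   | u′ , u′∈ , refl = above-sound′ (suc t) bs (ℤ.≤-trans a≤t (+≤+ (ℕ.n≤1+n t))) u′∈

data IncreasingFrom : ℤ → List ℤ → Set where
  []  : ∀ {z} → IncreasingFrom z []
  _∷_ : ∀ {z x l} → z ℤ.≤ x → IncreasingFrom (ℤ.suc x) l → IncreasingFrom z (x ∷ l)

increasingFrom : ∀ {z x l} → z ℤ.≤ x → Linked ℤ._<_ (x ∷ l) → IncreasingFrom z (x ∷ l)
increasingFrom z≤x [-]        = z≤x ∷ []
increasingFrom z≤x (x<y ∷ l↗) = z≤x ∷ increasingFrom (ℤ.i<j⇒suc[i]≤j x<y) l↗

advance : ∀ {t x l} → x ≢ + t → IncreasingFrom (+ t) (x ∷ l) → IncreasingFrom (+ suc t) (x ∷ l)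
advance x≢t (t≤x ∷ l↗) = ℤ.i<j⇒suc[i]≤j (ℤ.≤∧≢⇒< t≤x (λ t≡x → x≢t (sym t≡x))) ∷ l↗

∈-above-true : ∀ {n} (bs : Vec Bool n) {u} → u ∈ above bs → true ∷ u ∈ map (true ∷_) (above bs) ++ map (false ∷_) (above′ bs)
∈-above-true bs u∈ = ∈-++⁺ˡ (∈-map⁺ (true ∷_) u∈)

∈-above-false : ∀ {n} (bs : Vec Bool n) {u} → u ∈ above′ bs → false ∷ u ∈ map (true ∷_) (above bs) ++ map (false ∷_) (above′ bs)
∈-above-false bs u∈ = ∈-++⁺ʳ (map (true ∷_) (above bs)) (∈-map⁺ (false ∷_) u∈)

⊰-tail : ∀ {x r a l} → x ∷ r ⊰ a ∷ l → r ⊰ l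
⊰-tail (more _ _ p) = p

-- The bit at t records whether the least entry of `r` is t. Interlacing excludes t where no lower
-- entry up to t is unmatched, and forces it where a second unmatched entry would otherwise arise.
above-complete : ∀ {n} t (bs : Vec Bool n) {r} → IncreasingFrom (+ t) r → r ⊰ rowFrom t bs →
  ∃ λ u → u ∈ above bs × r ≡ rowFrom t u
above-complete′ : ∀ {n} t (bs : Vec Bool n) {r a} → IncreasingFrom (+ t) r → r ⊰ a ∷ rowFrom t bs →
  ∃ λ u → u ∈ above′ bs × r ≡ rowFrom t u
above-complete t (true ∷ bs) [] p =
  let u , u∈ , r≡ = above-complete′ (suc t) bs [] p in false ∷ u , ∈-above-false bs u∈ , r≡
above-complete t (true ∷ bs) r↗@(_∷_ {x = x} t≤x l↗) p with x ℤ.≟ + t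
... | yes refl = let u , u∈ , r≡ = above-complete (suc t) bs l↗ (⊰-tail p) in true ∷ u , ∈-above-true bs u∈ , cong (+ t ∷_) r≡
... | no x≢t   = let u , u∈ , r≡ = above-complete′ (suc t) bs (advance x≢t r↗) p in false ∷ u , ∈-above-false bs u∈ , r≡
above-complete t (false ∷ bs) [] p =
  let u , u∈ , r≡ = above-complete (suc t) bs [] p in false ∷ u , ∈-map⁺ (false ∷_) u∈ , r≡
above-complete t (false ∷ bs) r↗@(_∷_ {x = x} t≤x l↗) p with x ℤ.≟ + t
... | no x≢t   = let u , u∈ , r≡ = above-complete (suc t) bs (advance x≢t r↗) p in false ∷ u , ∈-map⁺ (false ∷_) u∈ , r≡
... | yes refl = ⊥-elim (absurd (rowFrom-≥ (suc t) bs) p)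
  where
  absurd : ∀ {l r} → All (λ z → + suc t ℤ.≤ z) l → ¬ (+ t ∷ r ⊰ l)
  absurd (+≤+ 1+t≤a ∷ _) (more (+≤+ a≤t) _ _) = ℕ.1+n≰n (ℕ.≤-trans 1+t≤a a≤t)
above-complete′ t [] [] one = [] , here refl , refl
above-complete′ t (true ∷ bs) (t≤x ∷ l↗) (more a≤x x≤t p) with ℤ.≤-antisym t≤x x≤t
... | refl = let u , u∈ , r≡ = above-complete′ (suc t) bs l↗ p in true ∷ u , ∈-map⁺ (true ∷_) u∈ , cong (+ t ∷_) r≡
above-complete′ t (false ∷ bs) [] p =
  let u , u∈ , r≡ = above-complete′ (suc t) bs [] p in false ∷ u , ∈-above-false bs u∈ , r≡
above-complete′ t (false ∷ bs) r↗@(_∷_ {x = x} t≤x l↗) p with x ℤ.≟ + t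
... | yes refl = let u , u∈ , r≡ = above-complete (suc t) bs l↗ (⊰-tail p) in true ∷ u , ∈-above-true bs u∈ , cong (+ t ∷_) r≡
... | no x≢t   = let u , u∈ , r≡ = above-complete′ (suc t) bs (advance x≢t r↗) p in false ∷ u , ∈-above-false bs u∈ , r≡

disjoint-heads : ∀ {n} (xs ys : List (Vec Bool n)) → Disjoint (map (true ∷_) xs) (map (false ∷_) ys)
disjoint-heads xs ys (v∈₁ , v∈₂) with ∈-map⁻ (true ∷_) v∈₁ | ∈-map⁻ (false ∷_) v∈₂
... | _ , _ , refl | _ , _ , ()

above-unique : ∀ {n} (bs : Vec Bool n) → Unique (above bs)
above-unique′ : ∀ {n} (bs : Vec Bool n) → Unique (above′ bs)
above-unique []           = []
above-unique (true  ∷ bs) = Unique.++⁺ (Unique.map⁺ V.∷-injectiveʳ (above-unique bs))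
  (Unique.map⁺ V.∷-injectiveʳ (above-unique′ bs)) (disjoint-heads (above bs) (above′ bs))
above-unique (false ∷ bs) = Unique.map⁺ V.∷-injectiveʳ (above-unique bs)
above-unique′ []           = [] ∷ []
above-unique′ (true  ∷ bs) = Unique.map⁺ V.∷-injectiveʳ (above-unique′ bs)
above-unique′ (false ∷ bs) = Unique.++⁺ (Unique.map⁺ V.∷-injectiveʳ (above-unique bs))
  (Unique.map⁺ V.∷-injectiveʳ (above-unique′ bs)) (disjoint-heads (above bs) (above′ bs))

open import Data.Nat using (_≤_; _<_; _+_)

private variable
  A : Set
  R : A → A → Set
  n d : ℕ

-- Monotone triangles grown at the bottom

Linked-∷ʳ⁺ : ∀ {x y : A} xs → Linked R (xs ∷ʳ x) → R x y → Linked R (xs ∷ʳ x ∷ʳ y)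
Linked-∷ʳ⁺ []            [-]      xRy = xRy ∷ [-]
Linked-∷ʳ⁺ (_ ∷ [])      (p ∷ ps) xRy = p ∷ Linked-∷ʳ⁺ [] ps xRy
Linked-∷ʳ⁺ (_ ∷ x ∷ xs)  (p ∷ ps) xRy = p ∷ Linked-∷ʳ⁺ (x ∷ xs) ps xRy

Linked-∷ʳ⁻ : ∀ {x : A} xs → Linked R (xs ∷ʳ x) → Linked R xs
Linked-∷ʳ⁻ []           _        = []
Linked-∷ʳ⁻ (_ ∷ [])     _        = [-]
Linked-∷ʳ⁻ (_ ∷ x ∷ xs) (p ∷ ps) = p ∷ Linked-∷ʳ⁻ (x ∷ xs) ps

Linked-last : ∀ {x y : A} xs → Linked R (xs ∷ʳ x ∷ʳ y) → R x y
Linked-last []           (p ∷ _)  = p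
Linked-last (_ ∷ [])     (_ ∷ ps) = Linked-last [] ps
Linked-last (_ ∷ x ∷ xs) (_ ∷ ps) = Linked-last (x ∷ xs) ps

last-∷ʳ : ∀ (xs : List A) x → L.last (xs ∷ʳ x) ≡ just x
last-∷ʳ []           x = refl
last-∷ʳ (_ ∷ [])     x = refl
last-∷ʳ (_ ∷ y ∷ xs) x = last-∷ʳ (y ∷ xs) x

drop-∷ʳ : ∀ k (xs : List A) x → k ≤ length xs → L.drop k (xs ∷ʳ x) ≡ L.drop k xs ∷ʳ x
drop-∷ʳ zero    xs       x _         = refl
drop-∷ʳ (suc k) (_ ∷ xs) x (s≤s k≤) = drop-∷ʳ k xs x k≤

-- The last argument is the bottom row, or [] if there are no rows.
data Triangle : ℕ → List (List ℤ) → List ℤ → Set where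
  empty : Triangle 0 [] []
  _▹_   : ∀ {m rows r r′} → Triangle m rows r → Linked ℤ._<_ r′ × r ⊰ r′ → Triangle (suc m) (rows ∷ʳ r′) r′

length-rows : ∀ {m rows r} → Triangle m rows r → length rows ≡ m
length-rows empty               = refl
length-rows (_▹_ {rows = rows} T _) = trans (L.length-++-comm rows _) (cong suc (length-rows T))

length-bottom : ∀ {m rows r} → Triangle m rows r → length r ≡ m
length-bottom empty         = refl
length-bottom (T ▹ (_ , p)) = trans (⊰-length p) (cong suc (length-bottom T))

triangle-sound : ∀ {m rows r} → Triangle m rows r → IsMonotoneTriangle m rows
triangle-sound empty = record { rowLengths = refl ; increasing = [] ; interlacing = [] }
triangle-sound {suc m} (_▹_ {rows = rows} {r} {r′} T (r′↗ , p)) = record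
  { rowLengths  = trans (L.map-++ length rows (r′ ∷ []))
      (trans (cong₂ _∷ʳ_ rowLengths (trans (⊰-length p) (cong suc (length-bottom T))))
      (trans (sym (L.map-++ suc (L.upTo m) (m ∷ []))) (cong (map suc) (L.upTo-∷ʳ m))))
  ; increasing  = All.++⁺ increasing (r′↗ ∷ [])
  ; interlacing = linked T interlacing
  }
  where
  open IsMonotoneTriangle (triangle-sound T)
  linked : ∀ {m rows} → Triangle m rows r → Linked Interlaces rows → Linked Interlaces (rows ∷ʳ r′)
  linked empty                     _ = [-]
  linked (_▹_ {rows = rows₀} T₀ _) l = Linked-∷ʳ⁺ rows₀ l (⊰⇒interlaces p)

triangle-complete : ∀ m rows → IsMonotoneTriangle m rows → ∃ λ r → Triangle m rows r
triangle-complete zero    []          _  = [] , empty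
triangle-complete zero    (_ ∷ _)     mt with () ← IsMonotoneTriangle.rowLengths mt
triangle-complete (suc m) rows mt with L.initLast rows
... | []          with () ← IsMonotoneTriangle.rowLengths mt
... | rows₀ L.∷ʳ′ r′ = r′ , T ▹ (proj₂ (All.∷ʳ⁻ increasing) , interlaced T r′ (proj₂ lengths) interlacing)
  where
  open IsMonotoneTriangle mt
  lengths : map length rows₀ ≡ map suc (L.upTo m) × length r′ ≡ suc m
  lengths = L.∷ʳ-injective (map length rows₀) (map suc (L.upTo m))
    (trans (sym (L.map-++ length rows₀ (r′ ∷ []))) (trans rowLengths
      (trans (cong (map suc) (sym (L.upTo-∷ʳ m))) (L.map-++ suc (L.upTo m) (m ∷ [])))))
  ih : ∃ λ r → Triangle m rows₀ r
  ih = triangle-complete m rows₀ record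
    { rowLengths  = proj₁ lengths
    ; increasing  = proj₁ (All.∷ʳ⁻ increasing)
    ; interlacing = Linked-∷ʳ⁻ rows₀ interlacing
    }
  T : Triangle m rows₀ (proj₁ ih)
  T = proj₂ ih
  -- Above the first row stands the empty row, where `interlacing` imposes no condition; there the
  -- length alone decides.
  interlaced : ∀ {m rows r} → Triangle m rows r → ∀ r′ → length r′ ≡ suc m → Linked Interlaces (rows ∷ʳ r′) → r ⊰ r′
  interlaced empty                     (_ ∷ []) _ _ = one
  interlaced (_▹_ {rows = rows₀} T₀ _) (_ ∷ _)  _ l = interlaces⇒⊰ (Linked-last rows₀ l)

-- Put the tail of r on top of r.
triangle-with-bottom : ∀ r → Linked ℤ._<_ r → ∃ λ rows → Triangle (length r) rows r
triangle-with-bottom []      _  = [] , empty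
triangle-with-bottom (x ∷ r) r↗ = let rows , T = triangle-with-bottom r (tail r↗) in rows ∷ʳ (x ∷ r) , T ▹ (r↗ , tail⊰ r↗)
  where
  tail : ∀ {x r} → Linked ℤ._<_ (x ∷ r) → Linked ℤ._<_ r
  tail [-]      = []
  tail (_ ∷ r↗) = r↗
  tail⊰ : ∀ {x r} → Linked ℤ._<_ (x ∷ r) → r ⊰ x ∷ r
  tail⊰ [-]        = one
  tail⊰ (x<y ∷ r↗) = more (ℤ.<⇒≤ x<y) ℤ.≤-refl (tail⊰ r↗)

-- The listed arrays are exactly the required trapezoids

topRows : ∀ {n d} → Vec (Fin n) d → List (List ℤ)
topRows []        = []
topRows i@(_ ∷ _) = map (λ x → + val x) (V.toList i) ∷ []

∈-if : ∀ {b} {x y : A} → y ∈ (if b then x ∷ [] else []) → b ≡ true × y ≡ x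
∈-if {b = true} (here p) = refl , p

module _ {top : List (List ℤ)} {cs : Vec Bool n} where

  ∈-trapezoids-suc⁻ : ∀ m b {rows} → rows ∈ trapezoids top cs (suc m) b →
    ∃ λ u → ∃ λ rows₀ → u ∈ above b × rows₀ ∈ trapezoids top cs m u × rows ≡ rows₀ ∷ʳ row b
  ∈-trapezoids-suc⁻ m b rows∈ =
    let xs , rows∈xs , xs∈ = ∈-concat⁻′ (map (λ u → map (_∷ʳ row b) (trapezoids top cs m u)) (above b)) rows∈
        u , u∈ , xs≡ = ∈-map⁻ (λ u → map (_∷ʳ row b) (trapezoids top cs m u)) xs∈
        rows₀ , rows₀∈ , rows≡ = ∈-map⁻ (_∷ʳ row b) (subst (_ ∈_) xs≡ rows∈xs)
    in u , rows₀ , u∈ , rows₀∈ , rows≡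

  ∈-trapezoids-suc⁺ : ∀ m b {u rows₀} → u ∈ above b → rows₀ ∈ trapezoids top cs m u →
    rows₀ ∷ʳ row b ∈ trapezoids top cs (suc m) b
  ∈-trapezoids-suc⁺ m b u∈ rows₀∈ = ∈-concat⁺′ (∈-map⁺ (_∷ʳ row b) rows₀∈)
    (∈-map⁺ (λ u → map (_∷ʳ row b) (trapezoids top cs m u)) u∈)

  -- The last row determines its characteristic vector, and with no steps left the vector must be
  -- `cs`. Hence lists built over different upper rows are disjoint, as `trapezoids-unique`
  -- requires.
  trapezoids-bottom : ∀ m {b b′ rows} → rows ∈ trapezoids top cs m b → rows ∈ trapezoids top cs m b′ → b ≡ b′
  trapezoids-bottom zero p q = trans (==⇒≡ (proj₁ (∈-if p))) (sym (==⇒≡ (proj₁ (∈-if q))))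
  trapezoids-bottom (suc m) {b} {b′} p q =
    let _ , rows₁ , _ , _ , rows≡₁ = ∈-trapezoids-suc⁻ m b p
        _ , rows₂ , _ , _ , rows≡₂ = ∈-trapezoids-suc⁻ m b′ q
    in rowFrom-injective 1 b b′ (L.∷ʳ-injectiveʳ rows₁ rows₂ (trans (sym rows≡₁) rows≡₂))

  trapezoids-unique : ∀ m b → Unique (trapezoids top cs m b)
  trapezoids-unique zero b with b == cs
  ... | true  = [] ∷ []
  ... | false = []
  trapezoids-unique (suc m) b = Unique-concatMap (above-unique b)
    (λ u → Unique.map⁺ (λ {x} {y} p → L.∷ʳ-injectiveˡ x y p) (trapezoids-unique m u))
    λ {u} {u′} p q →
      let rows₁ , ∈₁ , ≡₁ = ∈-map⁻ (_∷ʳ row b) p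
          rows₂ , ∈₂ , ≡₂ = ∈-map⁻ (_∷ʳ row b) q
      in trapezoids-bottom m ∈₁ (subst (_∈ trapezoids top cs m u′)
           (sym (L.∷ʳ-injectiveˡ rows₁ rows₂ (trans (sym ≡₁) ≡₂))) ∈₂)

pred≤ : ∀ d m → d ∸ 1 ≤ m + d
pred≤ d m = ℕ.≤-trans (ℕ.m∸n≤m d 1) (ℕ.m≤n+m d m)

module _ {n d : ℕ} (i : Vec (Fin n) d) (i↗ : StrictlyIncreasing i) where

  cs : Vec Bool n
  cs = members i

  -- A trapezoid has to come from a full triangle, so the removed rows must be supplied:
  -- `triangle-with-bottom` builds some triangle over the prescribed top row, and the other rows are
  -- appended to it.
  trapezoids-sound : ∀ m b {rows} → rows ∈ trapezoids (topRows i) cs m b →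
    ∃ λ triangle → Triangle (m + d) triangle (row b) × L.drop (d ∸ 1) triangle ≡ rows
  trapezoids-sound zero b rows∈ with ∈-if rows∈
  ... | p , refl = go i (trans (cong row (==⇒≡ {as = b} {cs} p)) (row-members i↗))
    where
    go : ∀ {d} (i : Vec (Fin n) d) → row b ≡ map (λ x → + val x) (V.toList i) →
      ∃ λ triangle → Triangle d triangle (row b) × L.drop (d ∸ 1) triangle ≡ topRows i
    go []        row≡ = [] , subst (Triangle 0 []) (sym row≡) empty , refl
    go {suc d} i@(_ ∷ _) row≡ with triangle-with-bottom (row b) (rowFrom-increasing 1 b)
    ... | rows , T = drop-all rows (subst (λ k → Triangle k rows (row b)) length≡ T)
      where
      length≡ : length (row b) ≡ suc d
      length≡ = trans (cong length row≡) (trans (L.length-map (λ x → + val x) (V.toList i)) (V.length-toList i))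
      drop-all : ∀ rows → Triangle (suc d) rows (row b) → ∃ λ triangle → Triangle (suc d) triangle (row b) × L.drop d triangle ≡ topRows i
      drop-all _ T@(_▹_ {rows = rows₀} T₀ _) = _ , T ,
        trans (drop-∷ʳ d rows₀ (row b) (ℕ.≤-reflexive (sym (length-rows T₀))))
              (cong₂ _∷ʳ_ (L.drop-all d rows₀ (ℕ.≤-reflexive (length-rows T₀))) row≡)
  trapezoids-sound (suc m) b rows∈ with ∈-trapezoids-suc⁻ m b rows∈
  ... | u , rows₀ , u∈ , rows₀∈ , refl with trapezoids-sound m u rows₀∈
  ...   | triangle , T , drop≡ = triangle ∷ʳ row b , T ▹ (rowFrom-increasing 1 b , above-sound 1 b u∈) ,
    trans (drop-∷ʳ (d ∸ 1) triangle (row b) (ℕ.≤-trans (pred≤ d m) (ℕ.≤-reflexive (sym (length-rows T)))))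
          (cong (_∷ʳ row b) drop≡)

  HasTopRow-∷ʳ : ∀ {rows} r → HasTopRow i rows → HasTopRow i (rows ∷ʳ r)
  HasTopRow-∷ʳ = go i
    where
    go : ∀ {d} (i : Vec (Fin n) d) {rows} r → HasTopRow i rows → HasTopRow i (rows ∷ʳ r)
    go []      r _ = tt
    go (_ ∷ _) {_ ∷ _} r p = p

  trapezoids-top : ∀ m b {rows} → rows ∈ trapezoids (topRows i) cs m b → HasTopRow i rows
  trapezoids-top zero b rows∈ with ∈-if rows∈
  ... | _ , refl = go i
    where
    go : ∀ {d} (i : Vec (Fin n) d) → HasTopRow i (topRows i)
    go []      = tt
    go (_ ∷ _) = refl
  trapezoids-top (suc m) b rows∈ with ∈-trapezoids-suc⁻ m b rows∈
  ... | u , rows₀ , u∈ , rows₀∈ , refl = HasTopRow-∷ʳ (row b) (trapezoids-top m u rows₀∈)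

  drop-bottom : ∀ {m triangle r} → 1 ≤ m → d ≤ m → Triangle m triangle r → HasBottomRow r (L.drop (d ∸ 1) triangle)
  drop-bottom {suc m} {r = r} _ d≤m (_▹_ {rows = rows₀} T _) = trans
    (cong L.last (drop-∷ʳ (d ∸ 1) rows₀ r (ℕ.≤-trans (ℕ.∸-monoˡ-≤ 1 d≤m) (ℕ.≤-reflexive (sym (length-rows T))))))
    (last-∷ʳ (L.drop (d ∸ 1) rows₀) r)

  -- Peel off the bottom row. The row above it interlaces with `row b` and has entries at least 1,
  -- so `above-complete` provides its characteristic vector.
  trapezoids-complete : ∀ m b {triangle} → Triangle (m + d) triangle (row b) →
    HasTopRow i (L.drop (d ∸ 1) triangle) → L.drop (d ∸ 1) triangle ∈ trapezoids (topRows i) cs m b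
  trapezoids-complete zero b T t with rows≡ i T t
    where
    rows≡ : ∀ {d} (i : Vec (Fin n) d) {triangle} → Triangle d triangle (row b) → HasTopRow i (L.drop (d ∸ 1) triangle) →
      row b ≡ map (λ x → + val x) (V.toList i) × L.drop (d ∸ 1) triangle ≡ topRows i
    rows≡ [] T _ = no-rows T
      where
      no-rows : ∀ {triangle r} → Triangle 0 triangle r → r ≡ [] × triangle ≡ []
      no-rows empty = refl , refl
    rows≡ {suc d′} i@(_ ∷ _) T@(_▹_ {rows = rows₀} T₀ _) t = row≡ , trans drop≡ (cong (_∷ []) row≡)
      where
      drop≡ : L.drop d′ (rows₀ ∷ʳ row b) ≡ row b ∷ []
      drop≡ = trans (drop-∷ʳ d′ rows₀ (row b) (ℕ.≤-reflexive (sym (length-rows T₀))))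
        (cong (_∷ʳ row b) (L.drop-all d′ rows₀ (ℕ.≤-reflexive (length-rows T₀))))
      row≡ : row b ≡ map (λ x → + val x) (V.toList i)
      row≡ = just-injective (trans (sym (cong L.head drop≡)) t)
  ... | row≡ , drop≡ = subst (_∈ (if b == cs then topRows i ∷ [] else [])) (sym drop≡)
    (subst (λ c → topRows i ∈ (if c then topRows i ∷ [] else [])) (sym b==cs) (here refl))
    where
    b==cs : (b == cs) ≡ true
    b==cs = trans (cong (_== cs) (rowFrom-injective 1 b cs (trans row≡ (sym (row-members i↗))))) (==-refl cs)
  trapezoids-complete (suc m) b T t = step T t refl
    where
    step : ∀ {triangle r} → Triangle (suc m + d) triangle r → HasTopRow i (L.drop (d ∸ 1) triangle) → r ≡ row b →
      L.drop (d ∸ 1) triangle ∈ trapezoids (topRows i) cs (suc m) b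
    step (_▹_ {rows = rows₀} {r₀} T₀ (_ , r₀⊰r)) t refl =
      let u , u∈ , r₀≡ = above-complete 1 b (start T₀ r₀⊰r) r₀⊰r
      in subst (_∈ trapezoids (topRows i) cs (suc m) b) (sym drop≡)
           (∈-trapezoids-suc⁺ m b u∈ (trapezoids-complete m u (subst (Triangle (m + d) rows₀) r₀≡ T₀)
             (top i rows₀ (length-rows T₀) (subst (HasTopRow i) drop≡ t))))
      where
      drop≡ : L.drop (d ∸ 1) (rows₀ ∷ʳ row b) ≡ L.drop (d ∸ 1) rows₀ ∷ʳ row b
      drop≡ = drop-∷ʳ (d ∸ 1) rows₀ (row b) (ℕ.≤-trans (pred≤ d m) (ℕ.≤-reflexive (sym (length-rows T₀))))
      start : ∀ {k rows r₀} → Triangle k rows r₀ → r₀ ⊰ row b → IncreasingFrom (+ 1) r₀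
      start empty          _ = []
      start (_ ▹ (r↗ , _)) p = from-head p r↗ (rowFrom-≥ 1 b)
        where
        from-head : ∀ {r l} → r ⊰ l → Linked ℤ._<_ r → All (λ z → + 1 ℤ.≤ z) l → IncreasingFrom (+ 1) r
        from-head one            _  _         = []
        from-head (more a≤x _ _) r↗ (1≤a ∷ _) = increasingFrom (ℤ.≤-trans 1≤a a≤x) r↗
      -- For d ≥ 1, the m + d rows above the bottom one are more than the d - 1 dropped, so removing
      -- the bottom row leaves the head unchanged.
      top : ∀ {d} (i : Vec (Fin n) d) rows₀ → length rows₀ ≡ m + d →
        HasTopRow i (L.drop (d ∸ 1) rows₀ ∷ʳ row b) → HasTopRow i (L.drop (d ∸ 1) rows₀)
      top []                  rows₀ len t = tt
      top {suc d} i@(_ ∷ _) rows₀ len t with L.drop d rows₀ in eq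
      ... | _ ∷ _ = t
      ... | []    = ⊥-elim (ℕ.1+n≰n (ℕ.≤-trans (ℕ.m≤n+m (suc d) m) (ℕ.≤-trans (ℕ.≤-reflexive (sym len)) (ℕ.m∸n≡0⇒m≤n
                      (trans (sym (L.length-drop d rows₀)) (cong length eq))))))

theorem1 : ∀ (n c d : ℕ) → 1 ≤ n → (c+d≤n : c + d ≤ n) → (d ≡ 0 → c < n) →
    ∀ (A : Vec (Fin n) c → Vec (Fin n) d → ℚ) → IsCoefficients n c d c+d≤n A →
    ∀ (s : Vec (Fin n) c) (i : Vec (Fin n) d) → StrictlyIncreasing s → StrictlyIncreasing i →
    ∃ λ (N : ℕ) →
    ([ rows ∈ List (List ℤ) ∣ IsMonotoneTrapezoid d (n ∸ c) rows
    × HasTopRow i rows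
    × HasBottomRow (map (λ x → + val x) (complement s)) rows ] ↔ Fin N)
    × A s i ≡ fromℕ N
theorem1 n c d 1≤n c+d≤n c<n A coefficients s i s↗ i↗ =
  length (trapezoids (topRows i) (members i) m b) ,
  refinement↔Fin (L.≡-dec (L.≡-dec ℤ._≟_)) (trapezoids (topRows i) (members i) m b) (trapezoids-unique m b)
    complete sound ,
  trans (coefficient-value n c d c+d≤n A coefficients s i)
    (trans (cong₂ (λ l r → signed (Ψ n) (+ suc c) l (middles c m ++ rights (+ (c + m)) r))
             (sym (holes-nonmembers s↗)) (sym (marks-members i↗ 0)))
           (signed-count (topRows i) (members i) c m b))
  where
  m : ℕ
  m = n ∸ (c + d)
  b : Vec Bool n
  b = nonmembers s
  m+d≡n∸c : m + d ≡ n ∸ c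
  m+d≡n∸c = trans (sym (ℕ.m+n∸m≡n c (m + d))) (cong (_∸ c) (arguments-length c d c+d≤n))
  -- A bottom row exists only if there is a row at all; for d = 0 this is what c < n guarantees.
  1≤n∸c : 1 ≤ n ∸ c
  1≤n∸c = ℕ.m<n⇒0<n∸m (positive d c+d≤n c<n)
    where
    positive : ∀ d → c + d ≤ n → (d ≡ 0 → c < n) → c < n
    positive zero    _     c<n = c<n refl
    positive (suc d) c+d≤n _   = ℕ.≤-trans (ℕ.≤-trans (s≤s (ℕ.m≤m+n c d)) (ℕ.≤-reflexive (sym (ℕ.+-suc c d)))) c+d≤n
  1≤m+d : 1 ≤ m + d
  1≤m+d = ℕ.≤-trans 1≤n∸c (ℕ.≤-reflexive (sym m+d≡n∸c))
  complete : ∀ {rows} → IsMonotoneTrapezoid d (n ∸ c) rows × HasTopRow i rows ×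
    HasBottomRow (map (λ x → + val x) (complement s)) rows → rows ∈ trapezoids (topRows i) (members i) m b
  complete ((triangle , monotone , refl) , top , bottom)
    with triangle-complete (m + d) triangle (subst (λ k → IsMonotoneTriangle k triangle) (sym m+d≡n∸c) monotone)
  ... | r , T = trapezoids-complete i i↗ m b (subst (Triangle (m + d) triangle) r≡ T) top
    where
    r≡ : r ≡ row b
    r≡ = trans (just-injective (trans (sym (drop-bottom i i↗ 1≤m+d (ℕ.m≤n+m d m) T)) bottom)) (sym (row-nonmembers s))
  sound : ∀ {rows} → rows ∈ trapezoids (topRows i) (members i) m b → IsMonotoneTrapezoid d (n ∸ c) rows ×
    HasTopRow i rows × HasBottomRow (map (λ x → + val x) (complement s)) rows
  sound rows∈ with trapezoids-sound i i↗ m b rows∈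
  ... | triangle , T , refl =
    (triangle , subst (λ k → IsMonotoneTriangle k triangle) m+d≡n∸c (triangle-sound T) , refl) ,
    trapezoids-top i i↗ m b rows∈ ,
    trans (drop-bottom i i↗ 1≤m+d (ℕ.m≤n+m d m) T) (cong just (row-nonmembers s))
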